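{- For every $k\in\mathbb{N}$, the characteristic polynomial $P_A$ is weakly distinguishing on the class $\mathcal{C}_k$ of graphs of genus at most $k$.
   Context: Graphs are finite, simple, labelled on $\{1,\dots,n\}$. The characteristic polynomial $P_A(G;x)$ is the characteristic polynomial of the adjacency matrix of $G$. The genus of a graph is the minimum genus of an orientable surface in which it embeds. Two non-isomorphic graphs $G,H$ are $P$-mates if $P(G)=P(H)$. $\mathcal{C}(n)$ is the set of graphs in $\mathcal{C}$ on $\{1,\dots,n\}$; $U_{P,\mathcal{C}}(n)$ is the set of $G\in\mathcal{C}(n)$ with no $P$-mate in $\mathcal{C}$; $P$ is weakly distinguishing on $\mathcal{C}$ if $|U_{P,\mathcal{C}}(n)|/|\mathcal{C}(n)|\to0$. -}

module Defs where

open import Data.Bool using (Bool; true; false; if_then_else_; not; _∧_; _∨_; T)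
open import Data.Nat using (ℕ; zero; suc; _+_; _*_; _≤_)
open import Data.Integer as ℤ using (ℤ; +_; -_)
open import Data.Fin using (Fin; toℕ)
open import Data.Fin.Properties using () renaming (_≟_ to _≟ᶠ_)
open import Data.Vec as Vec using (Vec; []; _∷_; lookup; tabulate; removeAt)
open import Data.Bool.ListAction using (any)
open import Data.List as List using (List; []; _∷_; [_]; length; allFin; filter; filterᵇ; concatMap; foldr)
open import Data.Product using (Σ; ∃-syntax; _×_; _,_)
open import Data.Product.Properties using (≡-dec)
open import Function.Bundles using (_↔_; Inverse)
open import Relation.Nullary using (¬_; Dec; does)
open import Relation.Unary using (Decidable)
open import Relation.Binary.PropositionalEquality using (_≡_)

Graph : ℕ → Set
Graph n = Vec (Vec Bool n) n

adj : ∀ {n} → Graph n → Fin n → Fin n → Bool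
adj G i j = lookup (lookup G i) j

IsSimple : ∀ {n} → Graph n → Set
IsSimple {n} G = (∀ i j → adj G i j ≡ adj G j i) × (∀ i → adj G i i ≡ false)

Iso : ∀ {n m} → Graph n → Graph m → Set
Iso {n} {m} G H = Σ (Fin n ↔ Fin m) λ π →
  ∀ i j → adj G i j ≡ adj H (Inverse.to π i) (Inverse.to π j)

-- Integer polynomials as coefficient lists (lowest degree first).

Poly : Set
Poly = List ℤ

_+ₚ_ : Poly → Poly → Poly
[] +ₚ q = q
(a ∷ p) +ₚ [] = a ∷ p
(a ∷ p) +ₚ (b ∷ q) = (a ℤ.+ b) ∷ (p +ₚ q)

scaleₚ : ℤ → Poly → Poly
scaleₚ c = List.map (c ℤ.*_)

_*ₚ_ : Poly → Poly → Poly
[] *ₚ q = []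
(a ∷ p) *ₚ q = scaleₚ a q +ₚ (+ 0 ∷ (p *ₚ q))

coeff : Poly → ℕ → ℤ
coeff [] i = + 0
coeff (a ∷ p) zero = a
coeff (a ∷ p) (suc i) = coeff p i

-- equality of polynomials (coefficientwise; trailing zeros irrelevant)
_≈ₚ_ : Poly → Poly → Set
p ≈ₚ q = ∀ i → coeff p i ≡ coeff q i

sign : ℕ → ℤ
sign zero = + 1
sign (suc k) = - sign k

det : (n : ℕ) → Vec (Vec Poly n) n → Poly
det zero [] = [ + 1 ]
det (suc n) (r ∷ rs) =
  foldr _+ₚ_ []
    (List.map (λ j → scaleₚ (sign (toℕ j))
                       (lookup r j *ₚ det n (Vec.map (λ row → removeAt row j) rs)))
              (allFin (suc n)))

b2z : Bool → ℤ
b2z true = + 1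
b2z false = + 0

charPoly : ∀ {n} → Graph n → Poly
charPoly {n} G = det n (tabulate λ i → tabulate λ j →
  (if does (i ≟ᶠ j) then (+ 0 ∷ + 1 ∷ []) else []) +ₚ [ - b2z (adj G i j) ])

-- Genus, via rotation systems (Heffter–Edmonds).

iter : ∀ {A : Set} → (A → A) → ℕ → A → A
iter f zero x = x
iter f (suc t) x = f (iter f t x)

-- ρ v is the rotation (cyclic order) at v: a cyclic permutation of N(v)
IsRotationSystem : ∀ {n} → Graph n → (Fin n → Fin n → Fin n) → Set
IsRotationSystem {n} G ρ =
  (∀ v u → T (adj G v u) → T (adj G v (ρ v u))) ×
  (∀ v u w → T (adj G v u) → T (adj G v w) → ∃[ t ] iter (ρ v) t u ≡ w)

-- number of classes of a (decidable, Boolean) equivalence on a list: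
-- count the elements not related to any later element
classes : ∀ {A : Set} → (A → A → Bool) → List A → ℕ
classes R [] = 0
classes R (x ∷ xs) = (if any (R x) xs then 0 else 1) + classes R xs

Dart : ℕ → Set
Dart n = Fin n × Fin n

darts : ∀ {n} → Graph n → List (Dart n)
darts {n} G = filterᵇ (λ { (u , v) → adj G u v })
  (concatMap (λ u → List.map (u ,_) (allFin n)) (allFin n))

_≟ᵈ_ : ∀ {n} (d e : Dart n) → Dec (d ≡ e)
_≟ᵈ_ = ≡-dec _≟ᶠ_ _≟ᶠ_

faceStep : ∀ {n} → (Fin n → Fin n → Fin n) → Dart n → Dart n
faceStep ρ (u , v) = (v , ρ v u)

-- same face = same orbit of faceStep (orbits have length ≤ number of darts)
sameFace : ∀ {n} → Graph n → (Fin n → Fin n → Fin n) → Dart n → Dart n → Bool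
sameFace G ρ d e =
  any (λ t → does (iter (faceStep ρ) t d ≟ᵈ e)) (List.upTo (length (darts G)))

isolated : ∀ {n} → Graph n → ℕ
isolated {n} G = length (filterᵇ (λ v → not (any (adj G v) (allFin n))) (allFin n))

-- number of faces of the embedding given by ρ (an isolated vertex is one face)
faces : ∀ {n} → Graph n → (Fin n → Fin n → Fin n) → ℕ
faces G ρ = classes (sameFace G ρ) (darts G) + isolated G

walk : ∀ {n} → Graph n → ℕ → Fin n → Fin n → Bool
walk G zero u v = does (u ≟ᶠ v)
walk {n} G (suc t) u v = walk G t u v ∨ any (λ w → walk G t u w ∧ adj G w v) (allFin n)

components : ∀ {n} → Graph n → ℕ
components {n} G = classes (walk G n) (allFin n)

-- genus(G) ≤ k.  With c components, V vertices, E edges (2E darts), a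
-- rotation system ρ gives a cellular embedding of each component; summing
-- Euler's formula, V - E + F(ρ) = 2c - 2g(ρ), and genus(G) = min_ρ g(ρ).
-- So genus(G) ≤ k  iff  ∃ ρ, 2c + E ≤ V + F(ρ) + 2k  (doubled below).
GenusAtMost : ℕ → ∀ {n} → Graph n → Set
GenusAtMost k {n} G = Σ (Fin n → Fin n → Fin n) λ ρ →
  IsRotationSystem G ρ ×
  (4 * components G + length (darts G) ≤ 2 * n + 2 * faces G ρ + 4 * k)

GenusClass : ℕ → ∀ {n} → Graph n → Set
GenusClass k G = IsSimple G × GenusAtMost k G

allVec : ∀ {A : Set} → List A → (m : ℕ) → List (Vec A m)
allVec xs zero = [ [] ]
allVec xs (suc m) = concatMap (λ x → List.map (x ∷_) (allVec xs m)) xs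

allGraphs : (n : ℕ) → List (Graph n)
allGraphs n = allVec (allVec (true ∷ false ∷ []) n) n

count : ∀ {Q : ∀ {n} → Graph n → Set} → (∀ {n} → Decidable (Q {n})) → ℕ → ℕ
count Q? n = length (filter Q? (allGraphs n))

Mates : (P : ∀ {n} → Graph n → Poly) → ∀ {n m} → Graph n → Graph m → Set
Mates P G H = ¬ Iso G H × P G ≈ₚ P H

Unique : (P : ∀ {n} → Graph n → Poly) (𝒞 : ∀ {n} → Graph n → Set) →
         ∀ {n} → Graph n → Set
Unique P 𝒞 G = 𝒞 G × ¬ (Σ ℕ λ m → Σ (Graph m) λ H → 𝒞 H × Mates P G H)

-- |U(n)| / |𝒞(n)| → 0, i.e. for every m, eventually m·|U(n)| ≤ |𝒞(n)|.
-- (The counts do not depend on which decision procedures are used.)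
WeaklyDistinguishing : (P : ∀ {n} → Graph n → Poly) (𝒞 : ∀ {n} → Graph n → Set) → Set
WeaklyDistinguishing P 𝒞 =
  (𝒞? : ∀ {n} → Decidable (𝒞 {n})) (U? : ∀ {n} → Decidable (Unique P 𝒞 {n})) →
  ∀ m → ∃[ N ] (∀ n → N ≤ n → m * count {Unique P 𝒞} U? n ≤ count {𝒞} 𝒞? n)

module Submission where

-- A "gadget" is a pendant spider with three legs of length two. Godsil–McKay switching replaces
-- it by a hexagon and an isolated vertex; this keeps the characteristic polynomial and does not
-- increase the genus, and it creates an isolated vertex, so a graph with a gadget has a mate.
--
-- It remains to see that graphs without gadgets are rare, by double counting. By Euler's formula
-- a linear number of vertices v have degree at most 29 and, if their degree exceeds 2, a neighbour
-- u of bounded degree. Such a v can be freed: contract v into u, then let v be isolated. Since the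
-- former neighbours of v are now among those of u, the old graph is one of O(n) candidates. Free
-- seven vertices in turn and hang a gadget built from them at any of the other n − 7 vertices.
-- A graph without gadgets admits of order n^7 · n such constructions. All gadgets of the result
-- meet one of boundedly many altered neighbourhoods, so there are boundedly many of them and a
-- result arises from only O(n^7) constructions. Hence the proportion of gadget-free graphs is O(1/n).
--
-- The genus does not grow in a contraction because it is a sequence of moves, each adding an edge
-- between two neighbours of v that are consecutive in its rotation or deleting an edge.

open import Defs
open import Data.Bool using (Bool; true; false; if_then_else_; not; _∧_; _∨_)
open import Data.Bool.Properties using (T-≡; T?; ∧-zeroʳ; ∧-identityʳ; not-involutive; ∧-comm; ∨-comm) renaming (_≟_ to _≟ᵇ_)
open import Data.Bool.ListAction using (any)
open import Data.Empty using (⊥; ⊥-elim)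
open import Data.Fin as Fin using (Fin; zero; suc; toℕ; punchIn)
import Data.Fin.Properties as FinP
open import Data.Fin.Patterns
open import Data.List using (List; []; _∷_; _++_; length; map; filter; filterᵇ; concatMap; allFin; take)
import Data.List as List
import Data.List.Properties as ListP
open import Data.List.Membership.Propositional using (_∈_; _∉_; find; lose; mapWith∈)
open import Data.List.Membership.Propositional.Properties
open import Data.List.Relation.Unary.All as All using (All; []; _∷_)
import Data.List.Relation.Unary.All.Properties as AllP
open import Data.List.Relation.Unary.AllPairs as AllPairs using (AllPairs; []; _∷_)
import Data.List.Relation.Unary.AllPairs.Properties as AllPairsP
open import Data.List.Relation.Unary.Any as Any using (Any; here; there)
import Data.List.Relation.Unary.Any.Properties as AnyP
open import Data.List.Relation.Unary.Unique.Propositional using () renaming (Unique to Distinct)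
import Data.List.Relation.Unary.Unique.Propositional.Properties as DistinctP
open import Data.Nat using (ℕ; zero; suc; _+_; _*_; _^_; _≤_; _<_; z≤n; s≤s)
import Data.Nat as ℕ
open import Data.Nat.Induction using (<-wellFounded)
open import Data.Nat.Properties hiding (_≟_)
open import Data.Nat.Tactic.RingSolver using (solve-∀)
open import Data.Product using (Σ; ∃; _×_; _,_; proj₁; proj₂)
open import Data.Sum as Sum using (_⊎_; inj₁; inj₂)
open import Data.Sum.Properties using (inj₁-injective)
open import Data.Sum.Relation.Binary.Pointwise using (Pointwise; inj₁; inj₂)
open import Data.Unit using (⊤; tt)
open import Data.Vec as Vec using (Vec; []; _∷_; lookup; tabulate)
import Data.Vec.Properties as VecP
open import Function using (_∘_; id; case_of_)
open import Function.Bundles using (Equivalence; Inverse)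
open import Induction.WellFounded using (Acc; acc)
open import Relation.Binary.PropositionalEquality
open import Relation.Binary.Definitions using (tri<; tri≈; tri>)
open import Relation.Nullary using (¬_; Dec; yes; no; does; contradiction)
open import Relation.Nullary.Decidable using (_→-dec_; dec-true; dec-false; toWitness; ¬?; _×-dec_; _⊎-dec_)
open import Relation.Unary using (Decidable)
open import Data.Integer as ℤ using (ℤ; +_; -[1+_]; -_; 0ℤ; 1ℤ)
import Data.Integer.Properties as ℤP
open import Data.Integer.Tactic.RingSolver using () renaming (solve-∀ to solveℤ-∀)
import Algebra.Properties.Semiring.Sum as SemiringSum
open SemiringSum ℤP.+-*-semiring using (sum; sum-cong-≗; ∑-distrib-+; ∑-comm; *-distribˡ-sum; *-distribʳ-sum; sum-replicate-zero)

-- Deleting `v` outright would forget its neighbours, leaving about n^d possibilities for degree d;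
-- sliding its edges to `u` first keeps them inside one known neighbourhood. A large degree of `u`
-- would spoil this, yet for a vertex of degree at most 2 a single slide is undone in O(deg `u`)
-- ways, and the sum of this over all `u` is still O(n), because bounded genus forces O(n) edges.
-- Every other freed vertex needs a neighbour of bounded degree, whence the two alternatives in
-- `Light`. The gain of a factor n comes from the vertex `z` that carries the gadget: it is chosen
-- freely in the construction, but a gadget found in the result displays `z` together with the seven
-- freed vertices. No topology of surfaces enters. Each elementary move comes with an explicit
-- rotation system for the new graph, and the inequality in `GenusAtMost` is followed through the
-- changes of the numbers of components, darts and faces. These numbers are compared by relating the
-- classes of both graphs, with `⊤` adjoined where one class more appears.

private
  variable
    A B : Set
    n m k : ℕ

-- Counting with lists, and Boolean tests

-- Each `x` claims some related `y`, which is then struck from `ys`: no two members of `xs` share a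
-- related element, so the later ones still find theirs.
pigeonhole-lists : {R : A → B → Set} {xs : List A} {ys : List B} →
  AllPairs (λ x x′ → ∀ y → y ∈ ys → R x y → R x′ y → ⊥) xs →
  (∀ {x} → x ∈ xs → ∃ λ y → y ∈ ys × R x y) → length xs ≤ length ys
pigeonhole-lists {xs = []} _ _ = z≤n
pigeonhole-lists {R = R} {xs = x ∷ xs} {ys} (ap ∷ aps) total with total (here refl)
... | y , y∈ , Rxy = ≤-trans (s≤s (pigeonhole-lists {R = R} {xs = xs} {ys = ys Any.─ y∈} aps′ total′))
    (≤-reflexive (sym (length-─ y∈)))
  where
  length-─ : {y : B} {ys : List B} (y∈ : y ∈ ys) → length ys ≡ suc (length (ys Any.─ y∈))
  length-─ {ys = ys} y∈ = ListP.length-removeAt′ ys (Any.index y∈)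
  ∈-─⁻ : {y z : B} {ys : List B} (y∈ : y ∈ ys) → z ∈ (ys Any.─ y∈) → z ∈ ys
  ∈-─⁻ (here _) p = there p
  ∈-─⁻ (there q) (here e) = here e
  ∈-─⁻ (there q) (there p) = there (∈-─⁻ q p)
  ∈-─⁺ : {y z : B} {ys : List B} (y∈ : y ∈ ys) → z ∈ ys → z ≡ y ⊎ z ∈ (ys Any.─ y∈)
  ∈-─⁺ (here refl) (here e) = inj₁ e
  ∈-─⁺ (here _) (there p) = inj₂ p
  ∈-─⁺ (there q) (here e) = inj₂ (here e)
  ∈-─⁺ (there q) (there p) = Sum.map₂ there (∈-─⁺ q p)
  aps′ = AllPairs.map (λ f z z∈ → f z (∈-─⁻ y∈ z∈)) aps
  total′ : ∀ {x′} → x′ ∈ xs → ∃ λ z → z ∈ (ys Any.─ y∈) × R x′ z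
  total′ {x′} x′∈ with total (there x′∈)
  ... | z , z∈ , Rx′z with ∈-─⁺ y∈ z∈
  ...   | inj₂ z∈′ = z , z∈′ , Rx′z
  ...   | inj₁ refl = ⊥-elim (All.lookup ap x′∈ _ z∈ Rxy Rx′z)

distinct-⊆⇒length≤ : {xs ys : List A} → Distinct xs → (∀ {x} → x ∈ xs → x ∈ ys) → length xs ≤ length ys
distinct-⊆⇒length≤ dist sub = pigeonhole-lists {R = _≡_}
  (AllPairs.map (λ x≢x′ _ _ e e′ → x≢x′ (trans e (sym e′))) dist) (λ {x} x∈ → x , sub x∈ , refl)

length-concatMap-≤ : (f : A → List B) (xs : List A) (b : ℕ) → (∀ {x} → x ∈ xs → length (f x) ≤ b) →
  length (concatMap f xs) ≤ length xs * b
length-concatMap-≤ f [] b h = z≤n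
length-concatMap-≤ f (x ∷ xs) b h = ≤-trans (≤-reflexive (ListP.length-++ (f x)))
  (+-mono-≤ (h (here refl)) (length-concatMap-≤ f xs b (h ∘ there)))

-- The factor `q` expresses a lower bound of `b / q` per block without division.
length-concatMap-≥ : (f : A → List B) (xs : List A) (b q : ℕ) → (∀ {x} → x ∈ xs → b ≤ length (f x) * q) →
  length xs * b ≤ length (concatMap f xs) * q
length-concatMap-≥ f [] b q h = z≤n
length-concatMap-≥ f (x ∷ xs) b q h = ≤-trans
  (+-mono-≤ (h (here refl)) (length-concatMap-≥ f xs b q (h ∘ there)))
  (≤-reflexive (trans (sym (*-distribʳ-+ q (length (f x)) (length (concatMap f xs)))) (cong (_* q) (sym (ListP.length-++ (f x))))))

concatMap-distinct : {f : A → List B} {xs : List A} → Distinct xs → (∀ {x} → x ∈ xs → Distinct (f x)) →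
  (∀ {x x′ y} → x ∈ xs → x′ ∈ xs → y ∈ f x → y ∈ f x′ → x ≡ x′) → Distinct (concatMap f xs)
concatMap-distinct {xs = []} _ _ _ = []
concatMap-distinct {f = f} {xs = x ∷ xs} (x≢ ∷ dist) df inj = AllPairsP.++⁺ (df (here refl))
  (concatMap-distinct dist (df ∘ there) (λ p q → inj (there p) (there q)))
  (All.tabulate λ {y} y∈ → All.tabulate λ {y′} y′∈ y≡y′ → clash y∈ (subst (_∈ _) (sym y≡y′) y′∈))
  where
  clash : ∀ {y} → y ∈ f x → y ∈ concatMap f xs → ⊥
  clash y∈ y∈′ with find (∈-concatMap⁻ f {xs = xs} y∈′)
  ... | x′ , x′∈ , y∈fx′ = All.lookup x≢ x′∈ (inj (here refl) (there x′∈) y∈ y∈fx′)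

any-true⁺ : (p : A → Bool) {xs : List A} {x : A} → x ∈ xs → p x ≡ true → any p xs ≡ true
any-true⁺ p x∈ px = Equivalence.to T-≡ (AnyP.any⁺ p (Any.map (λ { refl → Equivalence.from T-≡ px }) x∈))

any-true⁻ : (p : A → Bool) (xs : List A) → any p xs ≡ true → ∃ λ x → x ∈ xs × p x ≡ true
any-true⁻ p xs e with find (AnyP.any⁻ p xs (Equivalence.from T-≡ e))
... | x , x∈ , px = x , x∈ , Equivalence.to T-≡ px

does-true⁻ : {P : Set} (d : Dec P) → does d ≡ true → P
does-true⁻ (yes p) _ = p

true≢false : {b : Bool} → b ≡ true → b ≡ false → ⊥
true≢false refl ()

bool-cases : (b : Bool) → b ≡ true ⊎ b ≡ false
bool-cases true = inj₁ refl
bool-cases false = inj₂ refl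

≢true⇒false : {b : Bool} → ¬ (b ≡ true) → b ≡ false
≢true⇒false {true} h = ⊥-elim (h refl)
≢true⇒false {false} h = refl

bool-≡ : {a b : Bool} → (a ≡ true → b ≡ true) → (b ≡ true → a ≡ true) → a ≡ b
bool-≡ {true} f g = sym (f refl)
bool-≡ {false} {true} f g = g refl
bool-≡ {false} {false} f g = refl

-- Orbits of a self-map

data Reach (f : A → A) : A → A → Set where
  done : ∀ {x} → Reach f x x
  step : ∀ {x y} → Reach f (f x) y → Reach f x y

module _ {f : A → A} where

  reach-trans : ∀ {x y z} → Reach f x y → Reach f y z → Reach f x z
  reach-trans done q = q
  reach-trans (step p) q = step (reach-trans p q)

  reach-snoc : ∀ {x y} → Reach f x y → Reach f x (f y)
  reach-snoc p = reach-trans p (step done)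

  iter-shift : ∀ t x → iter f t (f x) ≡ f (iter f t x)
  iter-shift zero x = refl
  iter-shift (suc t) x = cong f (iter-shift t x)

  iter-+ : ∀ s t x → iter f (s + t) x ≡ iter f s (iter f t x)
  iter-+ zero t x = refl
  iter-+ (suc s) t x = cong f (iter-+ s t x)

  reach-≡ : ∀ {x y} → x ≡ y → Reach f x y
  reach-≡ refl = done

  reach⇒iter : ∀ {x y} → Reach f x y → ∃ λ t → iter f t x ≡ y
  reach⇒iter done = 0 , refl
  reach⇒iter {x} (step p) with reach⇒iter p
  ... | t , e = suc t , trans (sym (iter-shift t x)) e

  iter-reach : ∀ t x → Reach f x (iter f t x)
  iter-reach zero x = done
  iter-reach (suc t) x = reach-snoc (iter-reach t x)

  iter⇒reach : ∀ {x y} t → iter f t x ≡ y → Reach f x y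
  iter⇒reach t refl = iter-reach t _

reach-closed : {f : A → A} (V : A → Set) → (∀ {x} → V x → V (f x)) → ∀ {x y} → Reach f x y → V x → V y
reach-closed V cl done v = v
reach-closed V cl (step p) v = reach-closed V cl p (cl v)

-- Two elements with the same image lie on one cycle through that image; Euclid's
-- algorithm on the two return times identifies them.
iter-preimages : (f : A → A) {x u u′ : A} (t t′ : ℕ) → iter f t x ≡ u → f u ≡ x → iter f t′ x ≡ u′ → f u′ ≡ x → u ≡ u′
iter-preimages f {x} t t′ = go t t′ (<-wellFounded (t + t′))
  where
  shorter : ∀ {u u′} s d → iter f s x ≡ u → f u ≡ x → iter f (suc (s + d)) x ≡ u′ → iter f d x ≡ u′
  shorter s d e fe e′ = trans (cong (iter f d) (sym back)) (trans (sym (iter-+ d (suc s) x))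
    (trans (cong (λ a → iter f a x) (trans (+-suc d s) (cong suc (+-comm d s)))) e′))
    where
    back : iter f (suc s) x ≡ x
    back = trans (cong f e) fe
  go : ∀ {u u′} t t′ → Acc _<_ (t + t′) → iter f t x ≡ u → f u ≡ x → iter f t′ x ≡ u′ → f u′ ≡ x → u ≡ u′
  go t t′ (acc rs) e fe e′ fe′ with <-cmp t t′
  ... | tri≈ _ refl _ = trans (sym e) e′
  ... | tri< t<t′ _ _ with m≤n⇒∃[o]m+o≡n t<t′
  ...   | d , refl = go t d (rs (+-monoʳ-< t (s≤s (m≤n+m d t)))) e fe (shorter t d e fe e′) fe′
  go t t′ (acc rs) e fe e′ fe′ | tri> _ _ t′<t with m≤n⇒∃[o]m+o≡n t′<t
  ...   | d , refl = go d t′ (rs (+-monoˡ-< t′ (s≤s (m≤n+m d t′)))) (shorter t′ d e′ fe′ e) fe e′ fe′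

module FiniteOrbits {f : A → A} (V : A → Set) (closed : ∀ {x} → V x → V (f x)) (xs : List A) (V⇒∈ : ∀ {x} → V x → x ∈ xs) where

  iter-closed : ∀ t {x} → V x → V (iter f t x)
  iter-closed zero v = v
  iter-closed (suc t) v = closed (iter-closed t v)

  collision : ∀ {x} → V x → ∃ λ i → ∃ λ d → suc (i + d) ≤ length xs × iter f (suc (i + d)) x ≡ iter f i x
  collision {x} v with FinP.pigeonhole (n<1+n (length xs)) (λ i → Any.index (V⇒∈ (iter-closed (toℕ i) v)))
  ... | i , j , i<j , e with m≤n⇒∃[o]m+o≡n i<j
  ...   | d , 1+i+d≡j = toℕ i , d , subst (_≤ length xs) (sym 1+i+d≡j) (FinP.toℕ≤pred[n] j) ,
    trans (cong (λ a → iter f a x) 1+i+d≡j)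
      (trans (AnyP.lookup-index (V⇒∈ (iter-closed (toℕ j) v)))
        (trans (cong (List.lookup xs) (sym e)) (sym (AnyP.lookup-index (V⇒∈ (iter-closed (toℕ i) v))))))

  -- An exponent that is too large is shortened by cutting out the period found by `collision`. The
  -- bound matters because `sameFace` tries only exponents below the number of darts.
  reach⇒iter< : ∀ {x y} → V x → Reach f x y → ∃ λ t → t < length xs × iter f t x ≡ y
  reach⇒iter< {x} {y} v r with reach⇒iter r
  ... | t , e = go t (<-wellFounded t) e
    where
    go : ∀ t → Acc _<_ t → iter f t x ≡ y → ∃ λ t → t < length xs × iter f t x ≡ y
    go t (acc rs) e with t ℕ.<? length xs
    ... | yes t< = t , t< , e
    ... | no t≮ with collision v
    ...   | i , d , j≤ , coll with m≤n⇒∃[o]m+o≡n (≤-trans j≤ (≮⇒≥ t≮))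
    ...     | r , refl = go (r + i) (rs shorter) (trans (iter-+ r i x) (trans (cong (iter f r) (sym coll))
                (trans (sym (iter-+ r (suc (i + d)) x)) (trans (cong (λ a → iter f a x) (+-comm r _)) e))))
      where
      shorter : r + i < suc (i + d) + r
      shorter = s≤s (≤-trans (≤-reflexive (+-comm r i)) (+-monoˡ-≤ r (m≤m+n i d)))

  module _ (inj : ∀ {x y} → V x → V y → f x ≡ f y → x ≡ y) where

    iter-cancel : ∀ i {x y} → V x → V y → iter f i x ≡ iter f i y → x ≡ y
    iter-cancel zero vx vy e = e
    iter-cancel (suc i) vx vy e = iter-cancel i vx vy (inj (iter-closed i vx) (iter-closed i vy) e)

    -- An injective map on a finite invariant set is a permutation: cancelling the first `i` steps
    -- of a collision makes the orbit return to `x`.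
    reach-back : ∀ {x} → V x → Reach f (f x) x
    reach-back {x} v with collision v
    ... | i , d , _ , coll = iter⇒reach d (trans (iter-shift d x) (iter-cancel i (iter-closed (suc d) v) v
            (trans (sym (iter-+ i (suc d) x)) (trans (cong (λ a → iter f a x) (+-suc i d)) coll))))

    reach-sym : ∀ {x y} → V x → Reach f x y → Reach f y x
    reach-sym v done = done
    reach-sym v (step p) = reach-trans (reach-sym (closed v) p) (reach-back v)

-- Transversals: lists of representatives, used to compare numbers of classes

record Transversal {A : Set} (V : A → Set) (S : A → A → Set) (size : ℕ) : Set where
  field
    reps : List A
    length-reps : length reps ≡ size
    reps-valid : ∀ {x} → x ∈ reps → V x
    reps-apart : AllPairs (λ x y → ¬ S x y) reps
    reps-complete : ∀ {x} → V x → ∃ λ r → r ∈ reps × S x r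

open Transversal

module _ {V : A → Set} {S : A → A → Set} {V′ : B → Set} {S′ : B → B → Set} where

  -- K assigns to each element of B a class of A, constantly on the classes of B.
  transversal-≤ : Transversal V S m → Transversal V′ S′ n → (K : B → A → Set) →
    (∀ {x} → V x → ∃ λ y → V′ y × K y x) →
    (∀ {y y′ x} → V x → V′ y → V′ y′ → S′ y y′ → K y x → K y′ x) →
    (∀ {y x x′} → V x → V x′ → V′ y → K y x → K y x′ → S x x′) → m ≤ n
  transversal-≤ t t′ K tot inv fun = subst₂ _≤_ (length-reps t) (length-reps t′)
    (pigeonhole-lists {R = λ x y → V x × K y x} (AllPairs.map (λ ¬S _ y∈ (vx , Kx) (vx′ , Kx′) →
        ¬S (fun vx vx′ (reps-valid t′ y∈) Kx Kx′)) (reps-apart t)) total)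
    where
    total : ∀ {x} → x ∈ reps t → ∃ λ y → y ∈ reps t′ × (V x × K y x)
    total x∈ with tot (reps-valid t x∈)
    ... | y , vy , Kyx with reps-complete t′ vy
    ...   | r , r∈ , Syr = r , r∈ , reps-valid t x∈ , inv (reps-valid t x∈) vy (reps-valid t′ r∈) Syr Kyx

  _⊎ᵗ_ : Transversal V S m → Transversal V′ S′ n → Transversal Sum.[ V , V′ ] (Pointwise S S′) (m + n)
  _⊎ᵗ_ t t′ .reps = map inj₁ (reps t) ++ map inj₂ (reps t′)
  _⊎ᵗ_ t t′ .length-reps = trans (ListP.length-++ (map inj₁ (reps t)))
    (cong₂ _+_ (trans (ListP.length-map inj₁ (reps t)) (length-reps t)) (trans (ListP.length-map inj₂ (reps t′)) (length-reps t′)))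
  _⊎ᵗ_ t t′ .reps-valid x∈ with ∈-++⁻ (map inj₁ (reps t)) x∈
  ... | inj₁ p with ∈-map⁻ inj₁ p
  ...   | _ , q , refl = reps-valid t q
  _⊎ᵗ_ t t′ .reps-valid x∈ | inj₂ p with ∈-map⁻ inj₂ p
  ...   | _ , q , refl = reps-valid t′ q
  _⊎ᵗ_ t t′ .reps-apart = AllPairsP.++⁺
    (AllPairsP.map⁺ (AllPairs.map (λ ¬S → λ { (inj₁ s) → ¬S s }) (reps-apart t)))
    (AllPairsP.map⁺ (AllPairs.map (λ ¬S → λ { (inj₂ s) → ¬S s }) (reps-apart t′)))
    (All.tabulate λ x∈ → All.tabulate λ y∈ → apart x∈ y∈)
    where
    apart : ∀ {x y} → x ∈ map inj₁ (reps t) → y ∈ map inj₂ (reps t′) → ¬ Pointwise S S′ x y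
    apart x∈ y∈ s with ∈-map⁻ inj₁ x∈ | ∈-map⁻ inj₂ y∈
    apart x∈ y∈ () | _ , _ , refl | _ , _ , refl
  _⊎ᵗ_ t t′ .reps-complete {inj₁ x} v with reps-complete t v
  ... | r , r∈ , s = inj₁ r , ∈-++⁺ˡ (∈-map⁺ inj₁ r∈) , inj₁ s
  _⊎ᵗ_ t t′ .reps-complete {inj₂ x} v with reps-complete t′ v
  ... | r , r∈ , s = inj₂ r , ∈-++⁺ʳ _ (∈-map⁺ inj₂ r∈) , inj₂ s

-- One extra class, so that inequalities between numbers of classes that are off by one are
-- instances of `transversal-≤` as well.
Plus : (A → Set) → ⊤ ⊎ A → Set
Plus V = Sum.[ (λ _ → ⊤) , V ]

unitᵗ : Transversal (λ (_ : ⊤) → ⊤) _≡_ 1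
unitᵗ = record { reps = tt ∷ [] ; length-reps = refl ; reps-valid = λ _ → tt ; reps-apart = [] ∷ []
               ; reps-complete = λ _ → tt , here refl , refl }

distinctᵗ : {V : A → Set} {xs : List A} → Distinct xs → (∀ {x} → x ∈ xs → V x) → (∀ {x} → V x → x ∈ xs) →
  Transversal V _≡_ (length xs)
distinctᵗ {xs = xs} d val com = record { reps = xs ; length-reps = refl ; reps-valid = val ; reps-apart = d
                                       ; reps-complete = λ {x} v → x , com v , refl }

module _ (R : A → A → Bool) where

  classReps : List A → List A
  classReps [] = []
  classReps (x ∷ xs) = if any (R x) xs then classReps xs else x ∷ classReps xs

  length-classReps : ∀ xs → length (classReps xs) ≡ classes R xs
  length-classReps [] = refl
  length-classReps (x ∷ xs) with any (R x) xs
  ... | true = length-classReps xs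
  ... | false = cong suc (length-classReps xs)

  classReps-⊆ : ∀ xs {x} → x ∈ classReps xs → x ∈ xs
  classReps-⊆ (y ∷ xs) x∈ with any (R y) xs
  classReps-⊆ (y ∷ xs) x∈ | true = there (classReps-⊆ xs x∈)
  classReps-⊆ (y ∷ xs) (here e) | false = here e
  classReps-⊆ (y ∷ xs) (there x∈) | false = there (classReps-⊆ xs x∈)

  classReps-apart : ∀ xs → AllPairs (λ x y → R x y ≡ false) (classReps xs)
  classReps-apart [] = []
  classReps-apart (x ∷ xs) with any (R x) xs in eq
  ... | true = classReps-apart xs
  ... | false = All.tabulate (λ y∈ → ≢true⇒false λ e → true≢false (any-true⁺ (R x) (classReps-⊆ xs y∈) e) eq) ∷ classReps-apart xs

  module _ {S : A → A → Set} (S-refl : ∀ {x} → S x x) (S-trans : ∀ {x y z} → S x y → S y z → S x z)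
           (sound : ∀ {x y} → R x y ≡ true → S x y) where

    classReps-complete : ∀ xs {x} → x ∈ xs → ∃ λ r → r ∈ classReps xs × S x r
    classReps-complete (y ∷ xs) x∈ with any (R y) xs in eq
    classReps-complete (y ∷ xs) (here refl) | true with any-true⁻ (R y) xs eq
    ... | w , w∈ , Ryw with classReps-complete xs w∈
    ...   | r , r∈ , s = r , r∈ , S-trans (sound Ryw) s
    classReps-complete (y ∷ xs) (there x∈) | true = classReps-complete xs x∈
    classReps-complete (y ∷ xs) (here refl) | false = y , here refl , S-refl
    classReps-complete (y ∷ xs) (there x∈) | false with classReps-complete xs x∈
    ... | r , r∈ , s = r , there r∈ , s

    classesᵗ : {V : A → Set} (xs : List A) → (∀ {x} → x ∈ xs → V x) → (∀ {x} → V x → x ∈ xs) →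
      (∀ {x y} → V x → V y → S x y → R x y ≡ true) → Transversal V S (classes R xs)
    classesᵗ xs val com complete = record
      { reps = classReps xs
      ; length-reps = length-classReps xs
      ; reps-valid = λ x∈ → val (classReps-⊆ xs x∈)
      ; reps-apart = apart (classReps-apart xs) (val ∘ classReps-⊆ xs)
      ; reps-complete = λ v → classReps-complete xs (com v) }
      where
      apart : ∀ {ys} → AllPairs (λ x y → R x y ≡ false) ys → (∀ {x} → x ∈ ys → _) → AllPairs (λ x y → ¬ S x y) ys
      apart [] _ = []
      apart (p ∷ ps) v = All.tabulate (λ y∈ s → true≢false (complete (v (here refl)) (v (there y∈)) s) (All.lookup p y∈)) ∷ apart ps (v ∘ there)

-- Graphs, rotation systems, faces and components

E : Graph n → Fin n → Fin n → Set
E G u v = adj G u v ≡ true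

Isolated : Graph n → Fin n → Set
Isolated G v = ∀ x → adj G v x ≡ false

IsDart : Graph n → Dart n → Set
IsDart G d = E G (proj₁ d) (proj₂ d)

rev : Dart n → Dart n
rev (u , v) = v , u

∈-filterᵇ⁺ : (p : A → Bool) {xs : List A} {x : A} → x ∈ xs → p x ≡ true → x ∈ filterᵇ p xs
∈-filterᵇ⁺ p x∈ px = ∈-filter⁺ (T? ∘ p) x∈ (Equivalence.from T-≡ px)

∈-filterᵇ⁻ : (p : A → Bool) (xs : List A) {x : A} → x ∈ filterᵇ p xs → x ∈ xs × p x ≡ true
∈-filterᵇ⁻ p xs x∈ with ∈-filter⁻ (T? ∘ p) {xs = xs} x∈
... | x∈xs , t = x∈xs , Equivalence.to T-≡ t

distinct-filterᵇ : (p : A → Bool) {xs : List A} → Distinct xs → Distinct (filterᵇ p xs)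
distinct-filterᵇ p = DistinctP.filter⁺ (T? ∘ p)

nbrs : Graph n → Fin n → List (Fin n)
nbrs {n} G v = filterᵇ (adj G v) (allFin n)

∈-nbrs⁺ : (G : Graph n) {v x : Fin n} → E G v x → x ∈ nbrs G v
∈-nbrs⁺ G {v} e = ∈-filterᵇ⁺ (adj G v) (∈-allFin _) e

∈-nbrs⁻ : (G : Graph n) {v x : Fin n} → x ∈ nbrs G v → E G v x
∈-nbrs⁻ G {v} x∈ = proj₂ (∈-filterᵇ⁻ (adj G v) (allFin _) x∈)

nbrs-distinct : (G : Graph n) (v : Fin n) → Distinct (nbrs G v)
nbrs-distinct {n} G v = distinct-filterᵇ (adj G v) (DistinctP.allFin⁺ n)

deg : Graph n → Fin n → ℕ
deg G v = length (nbrs G v)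

allDarts : (n : ℕ) → List (Dart n)
allDarts n = concatMap (λ u → map (u ,_) (allFin n)) (allFin n)

∈-allDarts : (d : Dart n) → d ∈ allDarts n
∈-allDarts (u , v) = ∈-concatMap⁺ (λ u → map (u ,_) (allFin _)) (lose (∈-allFin u) (∈-map⁺ (u ,_) (∈-allFin v)))

allDarts-distinct : Distinct (allDarts n)
allDarts-distinct {n} = concatMap-distinct (DistinctP.allFin⁺ n)
  (λ _ → DistinctP.map⁺ (cong proj₂) (DistinctP.allFin⁺ n)) (λ _ _ → same)
  where
  same : ∀ {x x′ y} → y ∈ map (x ,_) (allFin n) → y ∈ map (x′ ,_) (allFin n) → x ≡ x′
  same p q with ∈-map⁻ _ p | ∈-map⁻ _ q
  ... | _ , _ , refl | _ , _ , refl = refl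

∈-darts⁺ : (G : Graph n) {d : Dart n} → IsDart G d → d ∈ darts G
∈-darts⁺ G {d} e = ∈-filterᵇ⁺ _ (∈-allDarts d) e

∈-darts⁻ : (G : Graph n) {d : Dart n} → d ∈ darts G → IsDart G d
∈-darts⁻ G x∈ = proj₂ (∈-filterᵇ⁻ (λ d → adj G (proj₁ d) (proj₂ d)) (allDarts _) x∈)

darts-distinct : (G : Graph n) → Distinct (darts G)
darts-distinct G = distinct-filterᵇ _ allDarts-distinct

isolatedᵇ : Graph n → Fin n → Bool
isolatedᵇ {n} G v = not (any (adj G v) (allFin n))

isolatedᵇ⁻ : (G : Graph n) {v : Fin n} → isolatedᵇ G v ≡ true → Isolated G v
isolatedᵇ⁻ {n} G {v} e x with any (adj G v) (allFin n) in eq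
... | false = ≢true⇒false λ p → true≢false (any-true⁺ (adj G v) (∈-allFin x) p) eq

isolatedᵇ⁺ : (G : Graph n) {v : Fin n} → Isolated G v → isolatedᵇ G v ≡ true
isolatedᵇ⁺ {n} G {v} iso with any (adj G v) (allFin n) in eq
... | false = refl
... | true with any-true⁻ (adj G v) (allFin n) eq
...   | x , _ , e = ⊥-elim (true≢false e (iso x))

isolated? : (G : Graph n) (v : Fin n) → Isolated G v ⊎ ∃ (E G v)
isolated? {n} G v with any (adj G v) (allFin n) in eq
... | false = inj₁ λ x → ≢true⇒false λ p → true≢false (any-true⁺ (adj G v) (∈-allFin x) p) eq
... | true with any-true⁻ (adj G v) (allFin n) eq
...   | x , _ , e = inj₂ (x , e)

isolatedᵗ : (G : Graph n) → Transversal (Isolated G) _≡_ (isolated G)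
isolatedᵗ {n} G = distinctᵗ (distinct-filterᵇ (isolatedᵇ G) (DistinctP.allFin⁺ n))
  (λ x∈ → isolatedᵇ⁻ G (proj₂ (∈-filterᵇ⁻ (isolatedᵇ G) (allFin n) x∈)))
  (λ {x} iso → ∈-filterᵇ⁺ (isolatedᵇ G) (∈-allFin x) (isolatedᵇ⁺ G iso))

record Rot (G : Graph n) (ρ : Fin n → Fin n → Fin n) : Set where
  field
    rot-closed : ∀ {v u} → E G v u → E G v (ρ v u)
    rot-cyclic : ∀ {v u w} → E G v u → E G v w → Reach (ρ v) u w

open Rot

isRot⇒rot : {G : Graph n} {ρ : Fin n → Fin n → Fin n} → IsRotationSystem G ρ → Rot G ρ
isRot⇒rot (cl , cyc) .rot-closed {v} {u} e = Equivalence.to T-≡ (cl v u (Equivalence.from T-≡ e))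
isRot⇒rot (cl , cyc) .rot-cyclic {v} {u} {w} e e′ with cyc v u w (Equivalence.from T-≡ e) (Equivalence.from T-≡ e′)
... | t , p = iter⇒reach t p

rot⇒isRot : {G : Graph n} {ρ : Fin n → Fin n → Fin n} → Rot G ρ → IsRotationSystem G ρ
rot⇒isRot r = (λ v u e → Equivalence.from T-≡ (rot-closed r (Equivalence.to T-≡ e))) ,
  λ v u w e e′ → reach⇒iter (rot-cyclic r (Equivalence.to T-≡ e) (Equivalence.to T-≡ e′))

module Simple {n} (G : Graph n) (simple : IsSimple G) where

  E-sym : ∀ {u v} → E G u v → E G v u
  E-sym {u} {v} e = trans (proj₁ simple v u) e

  E-irrefl : ∀ {v} → ¬ E G v v
  E-irrefl {v} e = true≢false e (proj₂ simple v)

  E⇒≢ : ∀ {u v} → E G u v → u ≢ v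
  E⇒≢ e refl = E-irrefl e

-- Isolated vertices are elements beside the darts because `faces` counts one face for each of them.
Face : (Fin n → Fin n → Fin n) → Dart n ⊎ Fin n → Dart n ⊎ Fin n → Set
Face ρ = Pointwise (Reach (faceStep ρ)) _≡_

IsFaceElement : Graph n → Dart n ⊎ Fin n → Set
IsFaceElement G = Sum.[ IsDart G , Isolated G ]

module Faces {n} (G : Graph n) (simple : IsSimple G) {ρ : Fin n → Fin n → Fin n} (rot : Rot G ρ) where

  open Simple G simple

  φ : Dart n → Dart n
  φ = faceStep ρ

  φ-closed : ∀ {d} → IsDart G d → IsDart G (φ d)
  φ-closed e = rot-closed rot (E-sym e)

  -- Iterating the cyclic `ρ v` from the common image leads to both `u` and `u′`, which is the
  -- situation of `iter-preimages`.
  ρ-injective : ∀ {v u u′} → E G v u → E G v u′ → ρ v u ≡ ρ v u′ → u ≡ u′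
  ρ-injective {v} {u} {u′} e e′ eq with reach⇒iter (rot-cyclic rot (rot-closed rot e) e) | reach⇒iter (rot-cyclic rot (rot-closed rot e) e′)
  ... | t , p | t′ , p′ = iter-preimages (ρ v) t t′ p refl p′ (sym eq)

  ρ-surjective : ∀ {v w} → E G v w → ∃ λ u → E G v u × ρ v u ≡ w
  ρ-surjective {v} {w} e with reach⇒iter (rot-cyclic rot (rot-closed rot e) e)
  ... | t , p = iter (ρ v) t w , iter-closed t , trans (sym (iter-shift t w)) p
    where
    iter-closed : ∀ t → E G v (iter (ρ v) t w)
    iter-closed zero = e
    iter-closed (suc t) = rot-closed rot (iter-closed t)

  ρ-fixed : ∀ {v u} → E G v u → ρ v u ≡ u → ∀ {w} → E G v w → w ≡ u
  ρ-fixed {v} {u} e fix e′ = stays (rot-cyclic rot e e′) refl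
    where
    stays : ∀ {x y} → Reach (ρ v) x y → x ≡ u → y ≡ u
    stays done p = p
    stays (step r) refl = stays r fix

  φ-injective : ∀ {d d′} → IsDart G d → IsDart G d′ → φ d ≡ φ d′ → d ≡ d′
  φ-injective {u , v} {u′ , v′} e e′ eq with cong proj₁ eq
  ... | refl = cong (_, v) (ρ-injective (E-sym e) (E-sym e′) (cong proj₂ eq))

  open FiniteOrbits (IsDart G) (λ {d} → φ-closed {d}) (darts G) (∈-darts⁺ G) public using (reach⇒iter<)

  φ-sym : ∀ {d e} → IsDart G d → Reach φ d e → Reach φ e d
  φ-sym = FiniteOrbits.reach-sym (IsDart G) (λ {d} → φ-closed {d}) (darts G) (∈-darts⁺ G) φ-injective

  φ-reach-closed : ∀ {d e} → IsDart G d → Reach φ d e → IsDart G e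
  φ-reach-closed v r = reach-closed (IsDart G) (λ {d} → φ-closed {d}) r v

  sameFace-sound : ∀ {d e} → sameFace G ρ d e ≡ true → Reach φ d e
  sameFace-sound eq with any-true⁻ _ (List.upTo (length (darts G))) eq
  ... | t , _ , p = iter⇒reach t (does-true⁻ (_ ≟ᵈ _) p)

  sameFace-complete : ∀ {d e} → IsDart G d → Reach φ d e → sameFace G ρ d e ≡ true
  sameFace-complete v r with reach⇒iter< v r
  ... | t , t< , p = any-true⁺ _ (∈-upTo⁺ t<) (dec-true (_ ≟ᵈ _) p)

  reach? : ∀ {d} e → IsDart G d → Reach φ d e ⊎ ¬ Reach φ d e
  reach? {d} e v with bool-cases (sameFace G ρ d e)
  ... | inj₁ p = inj₁ (sameFace-sound p)
  ... | inj₂ p = inj₂ λ r → true≢false (sameFace-complete v r) p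

  dartFacesᵗ : Transversal (IsDart G) (Reach φ) (classes (sameFace G ρ) (darts G))
  dartFacesᵗ = classesᵗ (sameFace G ρ) done reach-trans sameFace-sound (darts G) (∈-darts⁻ G) (∈-darts⁺ G)
    (λ v _ → sameFace-complete v)

  facesᵗ : Transversal (IsFaceElement G) (Face ρ) (faces G ρ)
  facesᵗ = dartFacesᵗ ⊎ᵗ isolatedᵗ G

  Face-sym : ∀ {x y} → IsFaceElement G x → Face ρ x y → Face ρ y x
  Face-sym v (inj₁ r) = inj₁ (φ-sym v r)
  Face-sym v (inj₂ e) = inj₂ (sym e)

Face-refl : {ρ : Fin n → Fin n → Fin n} → ∀ {x} → Face ρ x x
Face-refl {x = inj₁ x} = inj₁ done
Face-refl {x = inj₂ x} = inj₂ refl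

Face-trans : {ρ : Fin n → Fin n → Fin n} → ∀ {x y z} → Face ρ x y → Face ρ y z → Face ρ x z
Face-trans (inj₁ r) (inj₁ s) = inj₁ (reach-trans r s)
Face-trans (inj₂ e) (inj₂ f) = inj₂ (trans e f)

data Conn (G : Graph n) : Fin n → Fin n → Set where
  nil : ∀ {u} → Conn G u u
  cons : ∀ {u w v} → E G u w → Conn G w v → Conn G u v

conn-trans : {G : Graph n} → ∀ {u v w} → Conn G u v → Conn G v w → Conn G u w
conn-trans nil q = q
conn-trans (cons e p) q = cons e (conn-trans p q)

conn-mono : {G H : Graph n} → (∀ {u v} → E G u v → Conn H u v) → ∀ {u v} → Conn G u v → Conn H u v
conn-mono f nil = nil
conn-mono f (cons e p) = conn-trans (f e) (conn-mono f p)

isolated-conn : {G : Graph n} → ∀ {u v} → Isolated G u → Conn G u v → u ≡ v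
isolated-conn iso nil = refl
isolated-conn iso (cons {w = w} e p) = ⊥-elim (true≢false e (iso w))

module Components {n} (G : Graph n) (simple : IsSimple G) where

  open Simple G simple

  conn-sym : ∀ {u v} → Conn G u v → Conn G v u
  conn-sym nil = nil
  conn-sym (cons e p) = conn-trans (conn-sym p) (cons (E-sym e) nil)

  walk-sound : ∀ t {u v} → walk G t u v ≡ true → Conn G u v
  walk-sound zero {u} {v} eq with does-true⁻ (u FinP.≟ v) eq
  ... | refl = nil
  walk-sound (suc t) {u} {v} eq with bool-cases (walk G t u v)
  ... | inj₁ p = walk-sound t p
  ... | inj₂ p with any-true⁻ _ (allFin n) (subst (λ b → b ∨ any (λ w → walk G t u w ∧ adj G w v) (allFin n) ≡ true) p eq)
  ...   | w , _ , q with bool-cases (walk G t u w)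
  ...     | inj₁ r = conn-trans (walk-sound t r) (cons (subst (λ b → b ∧ adj G w v ≡ true) r q) nil)
  ...     | inj₂ r = ⊥-elim (true≢false (subst (λ b → b ∧ adj G w v ≡ true) r q) refl)

  data Path (u : Fin n) : Fin n → List (Fin n) → Set where
    start : Path u u (u ∷ [])
    snoc : ∀ {w v xs} → Path u w xs → E G w v → Path u v (v ∷ xs)

  cut : ∀ {u w v xs} → Path u w xs → Distinct xs → v ∈ xs → ∃ λ ys → Path u v ys × Distinct ys
  cut p d (here refl) = endpoint p d
    where
    endpoint : ∀ {u w y ys} → Path u w (y ∷ ys) → Distinct (y ∷ ys) → ∃ λ zs → Path u y zs × Distinct zs
    endpoint start d = _ , start , d
    endpoint (snoc p e) d = _ , snoc p e , d
  cut (snoc p e) (_ ∷ d) (there v∈) = cut p d v∈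

  -- Loop erasure: if the next vertex has been visited before, the path is cut back to that visit.
  extend : ∀ {u w v xs} → Path u w xs → Distinct xs → Conn G w v → ∃ λ ys → Path u v ys × Distinct ys
  extend p d nil = _ , p , d
  extend {xs = xs} p d (cons {w = x} e c) with Any.any? (x FinP.≟_) xs
  ... | yes x∈ with cut p d x∈
  ...   | ys , p′ , d′ = extend p′ d′ c
  extend {xs = xs} p d (cons {w = x} e c) | no x∉ = extend (snoc p e) (AllP.¬Any⇒All¬ xs x∉ ∷ d) c

  path⇒walk : ∀ t {u v xs} → Path u v xs → length xs ≤ suc t → walk G t u v ≡ true
  path⇒walk zero {u} start _ = dec-true (u FinP.≟ u) refl
  path⇒walk zero (snoc start e) (s≤s ())
  path⇒walk zero (snoc (snoc p e′) e) (s≤s ())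
  path⇒walk (suc t) {u} start _ rewrite path⇒walk t (start {u}) (s≤s z≤n) = refl
  path⇒walk (suc t) {u} {v} (snoc {w} p e) (s≤s le) with walk G t u v
  ... | true = refl
  ... | false = any-true⁺ _ (∈-allFin w) (trans (cong (_∧ adj G w v) (path⇒walk t p le)) e)

  -- A path without repetitions has at most `n` vertices, so the `n` rounds allowed in `components`
  -- suffice.
  walk-complete : ∀ {u v} → Conn G u v → walk G n u v ≡ true
  walk-complete {u} c with extend (start {u}) ([] ∷ []) c
  ... | xs , p , d = path⇒walk n p (≤-trans (distinct-⊆⇒length≤ d (λ {x} _ → ∈-allFin x))
    (≤-trans (≤-reflexive (ListP.length-tabulate id)) (n≤1+n n)))

  conn? : ∀ u v → Conn G u v ⊎ ¬ Conn G u v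
  conn? u v with bool-cases (walk G n u v)
  ... | inj₁ p = inj₁ (walk-sound n p)
  ... | inj₂ p = inj₂ λ c → true≢false (walk-complete c) p

  componentsᵗ : Transversal (λ _ → ⊤) (Conn G) (components G)
  componentsᵗ = classesᵗ (walk G n) nil conn-trans (walk-sound n) (allFin n) (λ _ → tt) (λ {x} _ → ∈-allFin x)
    (λ _ _ → walk-complete)

-- Editing one edge

fromAdj : (Fin n → Fin n → Bool) → Graph n
fromAdj f = tabulate λ i → tabulate (f i)

adj-fromAdj : (f : Fin n → Fin n → Bool) (i j : Fin n) → adj (fromAdj f) i j ≡ f i j
adj-fromAdj f i j = trans (cong (λ r → lookup r j) (VecP.lookup∘tabulate (λ i → tabulate (f i)) i)) (VecP.lookup∘tabulate (f i) j)

graph-ext : {G H : Graph n} → (∀ i j → adj G i j ≡ adj H i j) → G ≡ H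
graph-ext {G = G} {H} h = vec-ext λ i → vec-ext (h i)
  where
  vec-ext : {xs ys : Vec A m} → (∀ i → lookup xs i ≡ lookup ys i) → xs ≡ ys
  vec-ext {xs = xs} {ys} p = trans (sym (VecP.tabulate∘lookup xs)) (trans (VecP.tabulate-cong p) (VecP.tabulate∘lookup ys))

SamePair : Fin n → Fin n → Fin n → Fin n → Set
SamePair u v i j = (i ≡ u × j ≡ v) ⊎ (i ≡ v × j ≡ u)

samePair? : (u v i j : Fin n) → Dec (SamePair u v i j)
samePair? u v i j = ((i FinP.≟ u) ×-dec (j FinP.≟ v)) ⊎-dec ((i FinP.≟ v) ×-dec (j FinP.≟ u))

samePair-sym : ∀ {u v i j : Fin n} → SamePair u v i j → SamePair u v j i
samePair-sym (inj₁ (p , q)) = inj₂ (q , p)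
samePair-sym (inj₂ (p , q)) = inj₁ (q , p)

upd : Graph n → Fin n → Fin n → Bool → Graph n
upd G u v b = fromAdj λ i j → if does (samePair? u v i j) then b else adj G i j

module _ (G : Graph n) (u v : Fin n) (b : Bool) where

  upd-hit : ∀ {i j} → SamePair u v i j → adj (upd G u v b) i j ≡ b
  upd-hit {i} {j} s = trans (adj-fromAdj _ i j) (cong (λ c → if c then b else adj G i j) (dec-true (samePair? u v i j) s))

  upd-miss : ∀ {i j} → ¬ SamePair u v i j → adj (upd G u v b) i j ≡ adj G i j
  upd-miss {i} {j} s = trans (adj-fromAdj _ i j) (cong (λ c → if c then b else adj G i j) (dec-false (samePair? u v i j) s))

  upd-simple : u ≢ v → IsSimple G → IsSimple (upd G u v b)
  upd-simple u≢v (s , irr) = symm , λ i → trans (upd-miss (λ { (inj₁ (p , q)) → u≢v (trans (sym p) q) ; (inj₂ (p , q)) → u≢v (trans (sym q) p) })) (irr i)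
    where
    symm : ∀ i j → adj (upd G u v b) i j ≡ adj (upd G u v b) j i
    symm i j with samePair? u v i j
    ... | yes p = trans (upd-hit p) (sym (upd-hit (samePair-sym p)))
    ... | no p = trans (upd-miss p) (trans (s i j) (sym (upd-miss (p ∘ samePair-sym))))

  upd-E⁻ : ∀ {i j} → E (upd G u v b) i j → (SamePair u v i j × b ≡ true) ⊎ (¬ SamePair u v i j × E G i j)
  upd-E⁻ {i} {j} e with samePair? u v i j
  ... | yes p = inj₁ (p , trans (sym (upd-hit p)) e)
  ... | no p = inj₂ (p , trans (sym (upd-miss p)) e)

upd-true-mono : (G : Graph n) {u v i j : Fin n} → E G i j → E (upd G u v true) i j
upd-true-mono G {u} {v} {i} {j} e with samePair? u v i j
... | yes p = upd-hit G u v true p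
... | no p = trans (upd-miss G u v true p) e

upd-true-id : {G : Graph n} → IsSimple G → {u v : Fin n} → E G u v → upd G u v true ≡ G
upd-true-id {G = G} simple {u} {v} e = graph-ext same
  where
  same : ∀ i j → adj (upd G u v true) i j ≡ adj G i j
  same i j with samePair? u v i j
  ... | yes p@(inj₁ (refl , refl)) = trans (upd-hit G u v true p) (sym e)
  ... | yes p@(inj₂ (refl , refl)) = trans (upd-hit G u v true p) (sym (Simple.E-sym G simple e))
  ... | no p = upd-miss G u v true p

-- The six numbers bound the changes in components, darts and faces. `balance` says that these
-- changes cancel when weighted with 4, 1 and 2, the coefficients in the doubled Euler inequality.
-- Every elementary move is one instance.
genus-transfer : {G H : Graph n} {ρ σ : Fin n → Fin n → Fin n} (x y z x′ y′ z′ : ℕ) → 4 * x′ + y′ + 2 * z′ ≡ 4 * x + y + 2 * z →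
  x + components H ≤ x′ + components G → y + length (darts H) ≤ y′ + length (darts G) → z + faces G ρ ≤ z′ + faces H σ →
  4 * components G + length (darts G) ≤ 2 * n + 2 * faces G ρ + 4 * k → 4 * components H + length (darts H) ≤ 2 * n + 2 * faces H σ + 4 * k
genus-transfer {n} {k} {G} {H} {ρ} {σ} x y z x′ y′ z′ balance c≤ D≤ F≤ =
  arith (components G) (components H) (length (darts G)) (length (darts H)) (faces G ρ) (faces H σ) c≤ D≤ F≤
  where
  arith : ∀ c c′ D D′ F F′ → x + c′ ≤ x′ + c → y + D′ ≤ y′ + D → z + F ≤ z′ + F′ →
    4 * c + D ≤ 2 * n + 2 * F + 4 * k → 4 * c′ + D′ ≤ 2 * n + 2 * F′ + 4 * k
  arith c c′ D D′ F F′ p q r h = +-cancelʳ-≤ (2 * F + (4 * x + y + 2 * z)) _ _ (≤-trans (≤-reflexive (l₁ x y z c′ D′ F))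
    (≤-trans (+-mono-≤ (+-mono-≤ (*-monoʳ-≤ 4 p) q) (*-monoʳ-≤ 2 r)) (≤-trans (≤-reflexive (l₂ x′ y′ z′ c D F′))
      (≤-trans (+-mono-≤ (+-monoˡ-≤ (2 * F′) h) (≤-reflexive balance)) (≤-reflexive (l₃ n F k F′ (4 * x + y + 2 * z)))))))
    where
    l₁ : ∀ x y z c D F → 4 * c + D + (2 * F + (4 * x + y + 2 * z)) ≡ 4 * (x + c) + (y + D) + 2 * (z + F)
    l₁ = solve-∀
    l₂ : ∀ x y z c D F → 4 * (x + c) + (y + D) + 2 * (z + F) ≡ 4 * c + D + 2 * F + (4 * x + y + 2 * z)
    l₂ = solve-∀
    l₃ : ∀ n F k F′ s → 2 * n + 2 * F + 4 * k + 2 * F′ + s ≡ 2 * n + 2 * F′ + 4 * k + (2 * F + s)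
    l₃ = solve-∀

reach-cong : {f g : A → A} → (∀ x → f x ≡ g x) → ∀ {x y} → Reach f x y → Reach g x y
reach-cong h done = done
reach-cong {f = f} {g} h {x} {y} (step p) = step (subst (λ z → Reach g z y) (h x) (reach-cong h p))

if-true : {P : Set} (d : Dec P) {x y : A} → P → (if does d then x else y) ≡ x
if-true d p rewrite dec-true d p = refl

if-false : {P : Set} (d : Dec P) {x y : A} → ¬ P → (if does d then x else y) ≡ y
if-false d p rewrite dec-false d p = refl

-- Deleting an edge

bypass : (Fin n → Fin n) → Fin n → Fin n → Fin n
bypass f p x = if does (f x FinP.≟ p) then f p else f x

module _ (f : Fin n → Fin n) (p : Fin n) (fp : f p ≢ p) where

  reach-bypass : ∀ {x y} → Reach f x y → x ≢ p → y ≢ p → Reach (bypass f p) x y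
  reach-bypass′ : ∀ {z y} → z ≡ p → Reach f z y → y ≢ p → Reach (bypass f p) (f p) y

  reach-bypass done _ _ = done
  reach-bypass {x} {y} (step r) x≢ y≢ with f x FinP.≟ p
  ... | no fx≢ = step (subst (λ z → Reach (bypass f p) z y) (sym (if-false (f x FinP.≟ p) fx≢)) (reach-bypass r fx≢ y≢))
  ... | yes fx≡ = step (subst (λ z → Reach (bypass f p) z y) (sym (if-true (f x FinP.≟ p) fx≡)) (reach-bypass′ fx≡ r y≢))

  reach-bypass′ z≡p done y≢ = ⊥-elim (y≢ z≡p)
  reach-bypass′ refl (step r) y≢ = reach-bypass r fp y≢

-- The orbit of `x` arrives at `a` without meeting `b` on the way. On a face that contains both
-- darts this names one of the two arcs between them.
data Before (f : A → A) (a b : A) : A → Set where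
  here : Before f a b a
  later : ∀ {x} → x ≢ a → x ≢ b → Before f a b (f x) → Before f a b x

before-exclusive : {f : A → A} {a b x : A} → a ≢ b → Before f a b x → Before f b a x → ⊥
before-exclusive a≢b here here = a≢b refl
before-exclusive a≢b here (later _ a≢a _) = a≢a refl
before-exclusive a≢b (later _ b≢b _) here = b≢b refl
before-exclusive a≢b (later _ _ p) (later _ _ q) = before-exclusive a≢b p q

¬before-self : {f : A → A} {a b : A} → a ≢ b → ¬ Before f a b b
¬before-self a≢b here = a≢b refl
¬before-self a≢b (later _ b≢b _) = b≢b refl

before-reach : {f : A → A} {a b x : A} → Before f a b x → Reach f x a
before-reach here = done
before-reach (later _ _ p) = step (before-reach p)

delRot : (Fin n → Fin n → Fin n) → Fin n → Fin n → Fin n → Fin n → Fin n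
delRot ρ v w y x = if does (y FinP.≟ v) then bypass (ρ y) w x else if does (y FinP.≟ w) then bypass (ρ y) v x else ρ y x

module Delete {n} (G : Graph n) (simple : IsSimple G) {ρ : Fin n → Fin n → Fin n} (rot : Rot G ρ) {v w : Fin n} (e₀ : E G v w) where

  open Simple G simple
  open Faces G simple rot

  H : Graph n
  H = upd G v w false

  σ : Fin n → Fin n → Fin n
  σ = delRot ρ v w

  d d′ : Dart n
  d = v , w
  d′ = w , v

  v≢w : v ≢ w
  v≢w = E⇒≢ e₀

  d≢d′ : d ≢ d′
  d≢d′ e = v≢w (cong proj₁ e)

  H-simple : IsSimple H
  H-simple = upd-simple G v w false v≢w simple

  dart⁺ : ∀ {x} → IsDart G x → x ≢ d → x ≢ d′ → IsDart H x
  dart⁺ {a , b} e p q = trans (upd-miss G v w false λ { (inj₁ (refl , refl)) → p refl ; (inj₂ (refl , refl)) → q refl }) e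

  dart⁻ : ∀ {x} → IsDart H x → IsDart G x × x ≢ d × x ≢ d′
  dart⁻ {a , b} e with upd-E⁻ G v w false e
  ... | inj₁ (_ , ())
  ... | inj₂ (p , e′) = e′ , (λ { refl → p (inj₁ (refl , refl)) }) , λ { refl → p (inj₂ (refl , refl)) }

  σ-v : ∀ x → σ v x ≡ bypass (ρ v) w x
  σ-v x = if-true (v FinP.≟ v) refl

  σ-w : ∀ x → σ w x ≡ bypass (ρ w) v x
  σ-w x = trans (if-false (w FinP.≟ v) (v≢w ∘ sym)) (if-true (w FinP.≟ w) refl)

  σ-other : ∀ {y} x → y ≢ v → y ≢ w → σ y x ≡ ρ y x
  σ-other {y} x y≢v y≢w = trans (if-false (y FinP.≟ v) y≢v) (if-false (y FinP.≟ w) y≢w)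

  private
    moving : ∀ {a b u} → E G a b → E G a u → u ≢ b → ρ a b ≢ b
    moving eb eu u≢b fix = u≢b (ρ-fixed eb fix eu)

    bypass-closed : ∀ {a b u} → E G a b → E G a u → u ≢ b → E G a (bypass (ρ a) b u) × bypass (ρ a) b u ≢ b
    bypass-closed {a} {b} {u} eb eu u≢b with ρ a u FinP.≟ b
    ... | yes _ = rot-closed rot eb , moving eb eu u≢b
    ... | no p = rot-closed rot eu , p

  H-rot : Rot H σ
  H-rot .rot-closed {y} {u} e with dart⁻ e
  ... | eG , ≢d , ≢d′ with y FinP.≟ v
  ...   | yes refl = dart⁺ (proj₁ cl) (λ p → proj₂ cl (cong proj₂ p)) (λ p → v≢w (cong proj₁ p))
    where cl = bypass-closed e₀ eG (λ { refl → ≢d refl })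
  ...   | no y≢v with y FinP.≟ w
  ...     | yes refl = dart⁺ (proj₁ cl) (λ p → v≢w (sym (cong proj₁ p))) (λ p → proj₂ cl (cong proj₂ p))
    where cl = bypass-closed (E-sym e₀) eG (λ { refl → ≢d′ refl })
  ...     | no y≢w = dart⁺ (rot-closed rot eG) (λ p → y≢v (cong proj₁ p)) (λ p → y≢w (cong proj₁ p))
  H-rot .rot-cyclic {y} {u} {x} e f with dart⁻ e | dart⁻ f
  ... | eG , e≢d , e≢d′ | fG , f≢d , f≢d′ with y FinP.≟ v
  ...   | yes refl = reach-bypass (ρ v) w (moving e₀ eG u≢w)
            (rot-cyclic rot eG fG) u≢w (λ { refl → f≢d refl })
    where
    u≢w : u ≢ w
    u≢w refl = e≢d refl
  ...   | no y≢v with y FinP.≟ w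
  ...     | yes refl = reach-bypass (ρ w) v (moving (E-sym e₀) eG u≢v)
            (rot-cyclic rot eG fG) u≢v (λ { refl → f≢d′ refl })
    where
    u≢v : u ≢ v
    u≢v refl = e≢d′ refl
  ...     | no y≢w = rot-cyclic rot eG fG

  ψ : Dart n → Dart n
  ψ = faceStep σ

  -- The face permutation changes only where the next dart would be `d` or `d′`: the boundary walk
  -- then goes on with the successor of the opposite dart.
  data Step (x : Dart n) : Set where
    via-d : φ x ≡ d → ψ x ≡ φ d′ → Step x
    via-d′ : φ x ≡ d′ → ψ x ≡ φ d → Step x
    plain : φ x ≢ d → φ x ≢ d′ → ψ x ≡ φ x → Step x

  step-view : ∀ x → Step x
  step-view (p , q) with q FinP.≟ v
  ... | yes refl with ρ v p FinP.≟ w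
  ...   | yes r = via-d (cong (v ,_) r) (cong (v ,_) (trans (σ-v p) (if-true (ρ v p FinP.≟ w) r)))
  ...   | no r = plain (λ e → r (cong proj₂ e)) (λ e → v≢w (cong proj₁ e)) (cong (v ,_) (trans (σ-v p) (if-false (ρ v p FinP.≟ w) r)))
  step-view (p , q) | no q≢v with q FinP.≟ w
  ... | no q≢w = plain (λ e → q≢v (cong proj₁ e)) (λ e → q≢w (cong proj₁ e)) (cong (q ,_) (σ-other p q≢v q≢w))
  ... | yes refl with ρ w p FinP.≟ v
  ...   | yes r = via-d′ (cong (w ,_) r) (cong (w ,_) (trans (σ-w p) (if-true (ρ w p FinP.≟ v) r)))
  ...   | no r = plain (λ e → v≢w (sym (cong proj₁ e))) (λ e → r (cong proj₂ e)) (cong (w ,_) (trans (σ-w p) (if-false (ρ w p FinP.≟ v) r)))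

  darts-≤ : 2 + length (darts H) ≤ length (darts G)
  darts-≤ = distinct-⊆⇒length≤ {xs = d ∷ d′ ∷ darts H}
    ((d≢d′ ∷ All.tabulate (λ x∈ e → proj₁ (proj₂ (dart⁻ (∈-darts⁻ H x∈))) (sym e))) ∷
     All.tabulate (λ x∈ e → proj₂ (proj₂ (dart⁻ (∈-darts⁻ H x∈))) (sym e)) ∷ darts-distinct H)
    λ { (here refl) → ∈-darts⁺ G e₀ ; (there (here refl)) → ∈-darts⁺ G (E-sym e₀)
      ; (there (there x∈)) → ∈-darts⁺ G (proj₁ (dart⁻ (∈-darts⁻ H x∈))) }

  isolated-H : ∀ {x} → Isolated G x → Isolated H x
  isolated-H {x} iso y = ≢true⇒false λ e → true≢false (proj₁ (dart⁻ {x , y} e)) (iso y)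

  φd≢ : ∀ {a b} → E G a b → φ (a , b) ≢ (a , b)
  φd≢ e p = E⇒≢ e (sym (cong proj₁ p))

  open Components H H-simple using (conn-sym; conn?) renaming (componentsᵗ to componentsHᵗ)
  open Components G simple using () renaming (componentsᵗ to componentsGᵗ)

  module HF = Faces H H-simple H-rot

  -- The face of d is joined to that of d′, and the old face of d leads from w back to v.
  module Apart (d≁d′ : ¬ Reach φ d d′) where

    along-face : ∀ {x} → Reach φ x d → IsDart G x → ¬ Reach φ x d′ → Conn H (proj₁ x) v
    along-face done _ _ = nil
    along-face {x} (step r) e ¬r with x ≟ᵈ d
    ... | yes refl = nil
    ... | no x≢d = cons (dart⁺ {x} e x≢d (λ { refl → ¬r done })) (along-face r (φ-closed e) (¬r ∘ step))

    w-v : Conn H w v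
    w-v = along-face (φ-sym e₀ (step done)) (φ-closed e₀) (λ r → d≁d′ (step r))

    E⇒conn : ∀ {x y} → E G x y → Conn H x y
    E⇒conn {x} {y} e with (x , y) ≟ᵈ d
    ... | yes refl = conn-sym w-v
    ... | no ≢d with (x , y) ≟ᵈ d′
    ...   | yes refl = w-v
    ...   | no ≢d′ = cons (dart⁺ {x , y} e ≢d ≢d′) nil

    components-≤ : components H ≤ components G
    components-≤ = transversal-≤ componentsHᵗ componentsGᵗ (λ y x → Conn H x y)
      (λ {x} _ → x , tt , nil) (λ _ _ _ c p → conn-trans p (conn-mono E⇒conn c)) (λ _ _ _ p q → conn-trans p (conn-sym q))

    -- The extra class takes the old face of `d`. Every dart of the merged face, also one that comes
    -- from the face of `d`, stands for the old face of `d′`.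
    K : ⊤ ⊎ (Dart n ⊎ Fin n) → Dart n ⊎ Fin n → Set
    K (inj₁ _) (inj₁ e) = Reach φ e d
    K (inj₁ _) (inj₂ _) = ⊥
    K (inj₂ (inj₁ y)) (inj₁ e) = (¬ Reach φ y d × Reach φ e y) ⊎ (Reach φ y d × Reach φ e d′)
    K (inj₂ (inj₁ y)) (inj₂ _) = ⊥
    K (inj₂ (inj₂ y)) (inj₁ _) = ⊥
    K (inj₂ (inj₂ y)) (inj₂ x) = x ≡ y

    faces-≤ : faces G ρ ≤ 1 + faces H σ
    faces-≤ = transversal-≤ facesᵗ (unitᵗ ⊎ᵗ HF.facesᵗ) K tot inv fun
      where
      tot : ∀ {x} → IsFaceElement G x → ∃ λ y → Plus (IsFaceElement H) y × K y x
      tot {inj₁ e} ve with reach? {e} d ve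
      ... | inj₁ r = inj₁ tt , tt , r
      ... | inj₂ ¬r with e ≟ᵈ d′
      ...   | no e≢d′ = inj₂ (inj₁ e) , dart⁺ {e} ve (λ { refl → ¬r done }) e≢d′ , inj₁ (¬r , done)
      -- The dart `d′` is gone from `H`; its successor represents its face.
      ...   | yes refl = inj₂ (inj₁ (φ d′)) , dart⁺ {φ d′} (φ-closed ve) (λ p → ¬r (step (reach-≡ p))) (φd≢ ve)
                , inj₁ ((λ r → ¬r (step r)) , step done)
      tot {inj₂ x} iso = inj₂ (inj₂ x) , isolated-H iso , refl
      inv-step : ∀ {y e} → IsDart H y → K (inj₂ (inj₁ y)) (inj₁ e) → K (inj₂ (inj₁ (ψ y))) (inj₁ e)
      inv-step {y} {e} vy k with step-view y | proj₁ (dart⁻ vy)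
      inv-step {y} {e} vy (inj₁ (¬r , _)) | via-d p _ | _ = ⊥-elim (¬r (step (reach-≡ p)))
      inv-step {y} {e} vy (inj₂ (_ , s)) | via-d p q | _ = subst (λ z → K (inj₂ (inj₁ z)) (inj₁ e)) (sym q)
        (inj₁ ((λ r → d≁d′ (φ-sym (E-sym e₀) (step r))) , reach-snoc s))
      inv-step {y} {e} vy (inj₁ (¬r , s)) | via-d′ p q | _ = subst (λ z → K (inj₂ (inj₁ z)) (inj₁ e)) (sym q)
        (inj₂ (φ-sym e₀ (step done) , reach-trans s (step (reach-≡ p))))
      inv-step {y} {e} vy (inj₂ (r , s)) | via-d′ p q | vG = ⊥-elim (d≁d′ (reach-trans (φ-sym vG r) (step (reach-≡ p))))
      inv-step {y} {e} vy (inj₁ (¬r , s)) | plain _ _ q | _ = subst (λ z → K (inj₂ (inj₁ z)) (inj₁ e)) (sym q)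
        (inj₁ ((λ r → ¬r (step r)) , reach-snoc s))
      inv-step {y} {e} vy (inj₂ (r , s)) | plain _ _ q | vG = subst (λ z → K (inj₂ (inj₁ z)) (inj₁ e)) (sym q)
        (inj₂ (reach-trans (φ-sym vG (step done)) r , s))
      inv-reach : ∀ {y y′ e} → IsDart H y → Reach ψ y y′ → K (inj₂ (inj₁ y)) (inj₁ e) → K (inj₂ (inj₁ y′)) (inj₁ e)
      inv-reach vy done k = k
      inv-reach {y} vy (step r) k = inv-reach (HF.φ-closed {y} vy) r (inv-step {y} vy k)
      inv : ∀ {y y′ x} → IsFaceElement G x → Plus (IsFaceElement H) y → Plus (IsFaceElement H) y′ →
        Pointwise _≡_ (Face σ) y y′ → K y x → K y′ x
      inv {inj₁ _} {inj₁ _} _ _ _ _ k = k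
      inv {inj₂ (inj₁ y)} {inj₂ (inj₁ y′)} {inj₁ e} _ vy _ (inj₂ (inj₁ r)) k = inv-reach {y} {y′} {e} vy r k
      inv {inj₂ (inj₂ y)} {inj₂ (inj₂ y′)} _ _ _ (inj₂ (inj₂ refl)) k = k
      fun : ∀ {y x x′} → IsFaceElement G x → IsFaceElement G x′ → Plus (IsFaceElement H) y → K y x → K y x′ → Face ρ x x′
      fun {inj₁ _} {inj₁ e} {inj₁ e′} v₁ v₂ _ r r′ = inj₁ (reach-trans r (φ-sym v₂ r′))
      fun {inj₂ (inj₁ y)} {inj₁ e} {inj₁ e′} v₁ v₂ _ (inj₁ (_ , r)) (inj₁ (_ , r′)) = inj₁ (reach-trans r (φ-sym v₂ r′))
      fun {inj₂ (inj₁ y)} {inj₁ e} {inj₁ e′} v₁ v₂ _ (inj₁ (p , _)) (inj₂ (q , _)) = ⊥-elim (p q)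
      fun {inj₂ (inj₁ y)} {inj₁ e} {inj₁ e′} v₁ v₂ _ (inj₂ (p , _)) (inj₁ (q , _)) = ⊥-elim (q p)
      fun {inj₂ (inj₁ y)} {inj₁ e} {inj₁ e′} v₁ v₂ _ (inj₂ (_ , r)) (inj₂ (_ , r′)) = inj₁ (reach-trans r (φ-sym v₂ r′))
      fun {inj₂ (inj₂ y)} {inj₂ x} {inj₂ x′} _ _ _ p q = inj₂ (trans p (sym q))

  module Together (d∼d′ : Reach φ d d′) where

    components-≤ : components H ≤ 1 + components G
    components-≤ = transversal-≤ componentsHᵗ (unitᵗ ⊎ᵗ componentsGᵗ) K tot inv fun
      where
      -- The extra class is the component of `v` in `H`. A vertex `y` on the side of `v` stands for
      -- the component of `w` instead, so that the two halves of a split component are kept apart.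
      K : ⊤ ⊎ Fin n → Fin n → Set
      K (inj₁ _) x = Conn H x v
      K (inj₂ y) x = ¬ Conn H x v × (Conn H x y ⊎ (Conn H x w × Conn H y v))
      tot : ∀ {x} → ⊤ → ∃ λ y → Plus (λ _ → ⊤) y × K y x
      tot {x} _ with conn? x v
      ... | inj₁ c = inj₁ tt , tt , c
      ... | inj₂ ¬c = inj₂ x , tt , ¬c , inj₁ nil
      inv-step : ∀ {y y′ x} → E G y y′ → K (inj₂ y) x → K (inj₂ y′) x
      inv-step {y} {y′} e (¬c , k) with (y , y′) ≟ᵈ d
      inv-step e (¬c , inj₁ c) | yes refl = ⊥-elim (¬c c)
      inv-step e (¬c , inj₂ (c , _)) | yes refl = ¬c , inj₁ c
      ... | no ≢d with (y , y′) ≟ᵈ d′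
      inv-step e (¬c , inj₁ c) | no ≢d | yes refl = ¬c , inj₂ (c , nil)
      inv-step e (¬c , inj₂ (c , c′)) | no ≢d | yes refl = ⊥-elim (¬c (conn-trans c c′))
      inv-step {y} {y′} e (¬c , inj₁ c) | no ≢d | no ≢d′ = ¬c , inj₁ (conn-trans c (cons (dart⁺ {y , y′} e ≢d ≢d′) nil))
      inv-step {y} {y′} e (¬c , inj₂ (c , c′)) | no ≢d | no ≢d′ = ¬c , inj₂ (c , conn-trans (conn-sym (cons (dart⁺ {y , y′} e ≢d ≢d′) nil)) c′)
      inv-conn : ∀ {y y′ x} → Conn G y y′ → K (inj₂ y) x → K (inj₂ y′) x
      inv-conn nil k = k
      inv-conn (cons e c) k = inv-conn c (inv-step e k)
      inv : ∀ {y y′ x} → ⊤ → Plus (λ _ → ⊤) y → Plus (λ _ → ⊤) y′ → Pointwise _≡_ (Conn G) y y′ → K y x → K y′ x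
      inv _ _ _ (inj₁ refl) k = k
      inv _ _ _ (inj₂ c) k = inv-conn c k
      fun : ∀ {y x x′} → ⊤ → ⊤ → Plus (λ _ → ⊤) y → K y x → K y x′ → Conn H x x′
      fun {inj₁ _} _ _ _ c c′ = conn-trans c (conn-sym c′)
      fun {inj₂ y} _ _ _ (_ , inj₁ c) (_ , inj₁ c′) = conn-trans c (conn-sym c′)
      fun {inj₂ y} _ _ _ (¬c , inj₁ c) (_ , inj₂ (_ , c′)) = ⊥-elim (¬c (conn-trans c c′))
      fun {inj₂ y} _ _ _ (_ , inj₂ (_ , c)) (¬c , inj₁ c′) = ⊥-elim (¬c (conn-trans c′ c))
      fun {inj₂ y} _ _ _ (_ , inj₂ (c , _)) (_ , inj₂ (c′ , _)) = conn-trans c (conn-sym c′)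

    d′∼d : Reach φ d′ d
    d′∼d = φ-sym e₀ d∼d′

    -- After the last visit to `b` on the way to `a`, only `a` remains to be met.
    before-from : ∀ {a b} → a ≢ b → Reach φ b a → Before φ a b (φ b)
    before-from {a} {b} a≢b r = start r
      where
      search : ∀ {x} → Reach φ x a → Before φ a b x ⊎ Before φ a b (φ b)
      search done = inj₁ here
      search {x} (step r) with search r
      ... | inj₂ p = inj₂ p
      ... | inj₁ p with x ≟ᵈ b | x ≟ᵈ a
      ...   | yes refl | _ = inj₂ p
      ...   | no x≢b | yes refl = inj₁ here
      ...   | no x≢b | no x≢a = inj₁ (later x≢a x≢b p)
      start : Reach φ b a → Before φ a b (φ b)
      start done = ⊥-elim (a≢b refl)
      start (step r) with search r
      ... | inj₁ p = p
      ... | inj₂ p = p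

    -- The face of d and d′ falls apart; A is the part between d and d′.
    InA : Dart n → Set
    InA = Before φ d′ d

    φd∈A : InA (φ d)
    φd∈A = before-from (d≢d′ ∘ sym) d∼d′

    φd′∉A : ¬ InA (φ d′)
    φd′∉A p = before-exclusive (d≢d′ ∘ sym) p (before-from d≢d′ d′∼d)

    -- An arc between `d` and `d′` is empty only if an end of the edge has no other neighbour. This
    -- end becomes isolated and supplies the face that the arc cannot give.
    isolated-end : ∀ {a b} → E G a b → (a , b) ≡ d ⊎ (a , b) ≡ d′ → φ (a , b) ≡ (b , a) → Isolated H b
    isolated-end {a} {b} e which p y = ≢true⇒false λ f → absurd f which
      where
      y≡a : E H b y → y ≡ a
      y≡a f = ρ-fixed (E-sym e) (cong proj₂ p) (proj₁ (dart⁻ {b , y} f))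
      absurd : E H b y → (a , b) ≡ d ⊎ (a , b) ≡ d′ → ⊥
      absurd f (inj₁ refl) = proj₂ (proj₂ (dart⁻ {b , y} f)) (cong (b ,_) (y≡a f))
      absurd f (inj₂ refl) = proj₁ (proj₂ (dart⁻ {b , y} f)) (cong (b ,_) (y≡a f))

    K : Dart n ⊎ Fin n → ⊤ ⊎ (Dart n ⊎ Fin n) → Set
    K (inj₁ y) (inj₁ _) = InA y
    K (inj₁ y) (inj₂ (inj₁ e)) = ¬ InA y × Reach φ e y
    K (inj₁ y) (inj₂ (inj₂ _)) = ⊥
    K (inj₂ y) (inj₁ _) = y ≡ w
    K (inj₂ y) (inj₂ (inj₁ e)) = y ≡ v × Reach φ e d′
    K (inj₂ y) (inj₂ (inj₂ x)) = y ≡ x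

    faces-≤ : 1 + faces G ρ ≤ faces H σ
    faces-≤ = transversal-≤ (unitᵗ ⊎ᵗ facesᵗ) HF.facesᵗ K tot inv fun
      where
      V : ⊤ ⊎ (Dart n ⊎ Fin n) → Set
      V = Plus (IsFaceElement G)
      tot : ∀ {x} → V x → ∃ λ y → IsFaceElement H y × K y x
      tot {inj₁ _} _ with φ d ≟ᵈ d′
      ... | yes p = inj₂ w , isolated-end e₀ (inj₁ refl) p , refl
      ... | no p = inj₁ (φ d) , dart⁺ {φ d} (φ-closed e₀) (φd≢ e₀) p , φd∈A
      tot {inj₂ (inj₁ e)} ve with reach? {e} d ve
      ... | inj₂ ¬r = inj₁ e , dart⁺ {e} ve (λ { refl → ¬r done }) (λ { refl → ¬r d′∼d }) , (λ p → ¬r (reach-trans (before-reach p) d′∼d)) , done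
      ... | inj₁ r with φ d′ ≟ᵈ d
      ...   | yes p = inj₂ v , isolated-end (E-sym e₀) (inj₂ refl) p , refl , reach-trans r d∼d′
      ...   | no p = inj₁ (φ d′) , dart⁺ {φ d′} (φ-closed (E-sym e₀)) p (φd≢ (E-sym e₀)) , φd′∉A , reach-snoc (reach-trans r d∼d′)
      tot {inj₂ (inj₂ x)} iso = inj₂ x , isolated-H iso , refl
      -- The jumps of `ψ` close each arc to a cycle: where `φ` would leave the arc `A` through its
      -- last dart `d′`, `ψ` returns to its first dart `φ d`.
      InA-step : ∀ {y} → IsDart H y → InA y → InA (ψ y)
      InA-step {y} vy here = ⊥-elim (proj₂ (proj₂ (dart⁻ {d′} vy)) refl)
      InA-step {y} vy (later _ _ p) with step-view y
      ... | plain _ _ q = subst InA (sym q) p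
      ... | via-d′ _ q = subst InA (sym q) φd∈A
      ... | via-d r q = ⊥-elim (¬before-self (d≢d′ ∘ sym) (subst InA r p))
      ¬InA-step : ∀ {y} → IsDart H y → ¬ InA y → ¬ InA (ψ y)
      ¬InA-step {y} vy ¬a a with dart⁻ {y} vy | step-view y
      ... | _ , ≢d , ≢d′ | plain _ _ q = ¬a (later ≢d′ ≢d (subst InA q a))
      ... | _ , ≢d , ≢d′ | via-d′ p q = ¬a (later ≢d′ ≢d (subst InA (sym p) here))
      ... | _ , ≢d , ≢d′ | via-d p q = φd′∉A (subst InA q a)
      reach-step : ∀ {y e} → Reach φ e y → Reach φ e (ψ y)
      reach-step {y} {e} r with step-view y
      ... | plain _ _ q = subst (Reach φ e) (sym q) (reach-snoc r)
      ... | via-d p q = subst (Reach φ e) (sym q) (reach-snoc (reach-trans (subst (Reach φ e) p (reach-snoc r)) d∼d′))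
      ... | via-d′ p q = subst (Reach φ e) (sym q) (reach-snoc (reach-trans (subst (Reach φ e) p (reach-snoc r)) d′∼d))
      inv-step : ∀ {y x} → IsDart H y → K (inj₁ y) x → K (inj₁ (ψ y)) x
      inv-step {x = inj₁ _} vy k = InA-step vy k
      inv-step {x = inj₂ (inj₁ e)} vy (a , r) = ¬InA-step vy a , reach-step r
      inv-reach : ∀ {y y′ x} → IsDart H y → Reach ψ y y′ → K (inj₁ y) x → K (inj₁ y′) x
      inv-reach vy done k = k
      inv-reach {y} {x = x} vy (step r) k = inv-reach {x = x} (HF.φ-closed {y} vy) r (inv-step {y} {x} vy k)
      inv : ∀ {y y′ x} → V x → IsFaceElement H y → IsFaceElement H y′ → Face σ y y′ → K y x → K y′ x
      inv {inj₁ y} {inj₁ y′} {x} _ vy _ (inj₁ r) k = inv-reach {y} {y′} {x} vy r k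
      inv {inj₂ y} {inj₂ y′} _ _ _ (inj₂ refl) k = k
      fun : ∀ {y x x′} → V x → V x′ → IsFaceElement H y → K y x → K y x′ → Pointwise _≡_ (Face ρ) x x′
      fun {inj₁ y} {inj₁ _} {inj₁ _} _ _ _ _ _ = inj₁ refl
      fun {inj₁ y} {inj₁ _} {inj₂ (inj₁ e)} _ _ _ a (¬a , _) = ⊥-elim (¬a a)
      fun {inj₁ y} {inj₂ (inj₁ e)} {inj₁ _} _ _ _ (¬a , _) a = ⊥-elim (¬a a)
      fun {inj₁ y} {inj₂ (inj₁ e)} {inj₂ (inj₁ e′)} _ v₂ _ (_ , r) (_ , r′) = inj₂ (inj₁ (reach-trans r (φ-sym v₂ r′)))
      fun {inj₂ y} {inj₁ _} {inj₁ _} _ _ _ _ _ = inj₁ refl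
      fun {inj₂ y} {inj₁ _} {inj₂ (inj₁ e)} _ _ _ p (q , _) = ⊥-elim (v≢w (trans (sym q) p))
      fun {inj₂ y} {inj₁ _} {inj₂ (inj₂ x)} _ iso _ refl refl = ⊥-elim (true≢false (E-sym e₀) (iso v))
      fun {inj₂ y} {inj₂ (inj₁ e)} {inj₁ _} _ _ _ (q , _) p = ⊥-elim (v≢w (trans (sym q) p))
      fun {inj₂ y} {inj₂ (inj₁ e)} {inj₂ (inj₁ e′)} _ v₂ _ (_ , r) (_ , r′) = inj₂ (inj₁ (reach-trans r (φ-sym v₂ r′)))
      fun {inj₂ y} {inj₂ (inj₁ e)} {inj₂ (inj₂ x)} _ iso _ (refl , _) refl = ⊥-elim (true≢false e₀ (iso w))
      fun {inj₂ y} {inj₂ (inj₂ x)} {inj₁ _} iso _ _ refl refl = ⊥-elim (true≢false (E-sym e₀) (iso v))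
      fun {inj₂ y} {inj₂ (inj₂ x)} {inj₂ (inj₁ e)} iso _ _ refl (refl , _) = ⊥-elim (true≢false e₀ (iso w))
      fun {inj₂ y} {inj₂ (inj₂ x)} {inj₂ (inj₂ x′)} _ _ _ p q = inj₂ (inj₂ (trans (sym p) q))

  genus-≤ : 4 * components G + length (darts G) ≤ 2 * n + 2 * faces G ρ + 4 * k →
    4 * components H + length (darts H) ≤ 2 * n + 2 * faces H σ + 4 * k
  genus-≤ {k = k} with reach? {d} d′ e₀
  -- With one face on both sides, a possible new component is paid for by two lost darts and one new
  -- face, 4 = 2 + 2. With two faces, the lost face is paid for by the two lost darts, 2 = 2.
  ... | inj₁ r = genus-transfer {k = k} {G} {H} {ρ} {σ} 0 2 1 1 0 0 refl (Together.components-≤ r) darts-≤ (Together.faces-≤ r)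
  ... | inj₂ ¬r = genus-transfer {k = k} {G} {H} {ρ} {σ} 0 2 0 0 0 1 refl (Apart.components-≤ ¬r) darts-≤ (Apart.faces-≤ ¬r)

genusClass-delete : {G : Graph n} {v w : Fin n} → E G v w → GenusClass k G → GenusClass k (upd G v w false)
genusClass-delete {k = k} {G} {v} {w} e (simple , ρ , rot , p) =
  H-simple , σ , rot⇒isRot H-rot , genus-≤ {k = k} p
  where open Delete G simple (isRot⇒rot rot) e

-- Adding a chord and adding a leaf

upd-true-E⁻ : (G : Graph n) {u v i j : Fin n} → E (upd G u v true) i j → SamePair u v i j ⊎ E G i j
upd-true-E⁻ G {u} {v} e with upd-E⁻ G u v true e
... | inj₁ (s , _) = inj₁ s
... | inj₂ (_ , e′) = inj₂ e′

-- Unlike _≟_, it occurs in no function defined by case distinction, so that matching on it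
-- leaves these functions folded in the goal.
eqFin? : (x y : Fin n) → Dec (x ≡ y)
eqFin? x y with x FinP.≟ y
... | yes p = yes p
... | no p = no p

insertBefore : (Fin n → Fin n) → Fin n → Fin n → Fin n → Fin n
insertBefore f q g x = if does (x FinP.≟ q) then g else (if does (f x FinP.≟ g) then q else f x)

module Insert (f : Fin n → Fin n) (q g : Fin n) (N : Fin n → Set) (closed : ∀ {x} → N x → N (f x))
  (cyclic : ∀ {x y} → N x → N y → Reach f x y) (q∉ : ¬ N q) (g∈ : N g) (p : Fin n) (p∈ : N p) (fp≡g : f p ≡ g) where

  h : Fin n → Fin n
  h = insertBefore f q g

  insert-q : h q ≡ g
  insert-q = if-true (q FinP.≟ q) refl

  insert-gap : ∀ {x} → N x → f x ≡ g → h x ≡ q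
  insert-gap {x} x∈ e = trans (if-false (x FinP.≟ q) (λ { refl → q∉ x∈ })) (if-true (f x FinP.≟ g) e)

  insert-old : ∀ {x} → N x → f x ≢ g → h x ≡ f x
  insert-old {x} x∈ e = trans (if-false (x FinP.≟ q) (λ { refl → q∉ x∈ })) (if-false (f x FinP.≟ g) e)

  insert-closed : ∀ {x} → x ≡ q ⊎ N x → h x ≡ q ⊎ N (h x)
  insert-closed (inj₁ refl) = inj₂ (subst N (sym insert-q) g∈)
  insert-closed {x} (inj₂ x∈) with eqFin? (f x) g
  ... | yes e = inj₁ (insert-gap x∈ e)
  ... | no e = inj₂ (subst N (sym (insert-old x∈ e)) (closed x∈))

  reach-insert : ∀ {x y} → N x → Reach f x y → Reach h x y
  reach-insert x∈ done = done
  reach-insert {x} {y} x∈ (step r) with eqFin? (f x) g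
  ... | no e = step (subst (λ z → Reach h z y) (sym (insert-old x∈ e)) (reach-insert (closed x∈) r))
  ... | yes e = step (subst (λ z → Reach h z y) (sym (insert-gap x∈ e))
      (step (subst (λ z → Reach h z y) (trans e (sym insert-q)) (reach-insert (closed x∈) r))))

  insert-cyclic : ∀ {x y} → x ≡ q ⊎ N x → y ≡ q ⊎ N y → Reach h x y
  insert-cyclic (inj₁ refl) (inj₁ refl) = done
  insert-cyclic {y = y} (inj₁ refl) (inj₂ y∈) = step (subst (λ z → Reach h z y) (sym insert-q) (reach-insert g∈ (cyclic g∈ y∈)))
  insert-cyclic (inj₂ x∈) (inj₁ refl) = reach-trans (reach-insert x∈ (cyclic x∈ p∈)) (subst (Reach h p) (insert-gap p∈ fp≡g) (step done))
  insert-cyclic (inj₂ x∈) (inj₂ y∈) = reach-insert x∈ (cyclic x∈ y∈)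

-- The new edge is drawn inside the corner `u`, `v`, `w`: directly before `v` in the rotation at `u`
-- and directly after `v` in that at `w`. It cuts off the triangle as a face of its own, and this
-- face pays for the two new darts.
module Chord {n} (G : Graph n) (simple : IsSimple G) {ρ : Fin n → Fin n → Fin n} (rot : Rot G ρ) {v u w : Fin n}
  (vu : E G v u) (ρvu : ρ v u ≡ w) (w≢u : w ≢ u) (u≁w : ¬ E G u w) where

  open Simple G simple
  open Faces G simple rot

  vw : E G v w
  vw = subst (E G v) ρvu (rot-closed rot vu)

  v≢u : v ≢ u
  v≢u = E⇒≢ vu

  v≢w : v ≢ w
  v≢w = E⇒≢ vw

  H : Graph n
  H = upd G u w true

  H-simple : IsSimple H
  H-simple = upd-simple G u w true (w≢u ∘ sym) simple

  E-H : ∀ {x y} → E G x y → E H x y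
  E-H = upd-true-mono G

  uw-H : E H u w
  uw-H = upd-hit G u w true (inj₁ (refl , refl))

  g : Fin n
  g = ρ w v

  private
    pu = ρ-surjective (E-sym vu)

  module Iᵤ = Insert (ρ u) w v (E G u) (rot-closed rot) (rot-cyclic rot) u≁w (E-sym vu) (proj₁ pu) (proj₁ (proj₂ pu)) (proj₂ (proj₂ pu))
  module Iw = Insert (ρ w) u g (E G w) (rot-closed rot) (rot-cyclic rot) (u≁w ∘ E-sym) (rot-closed rot (E-sym vw)) v (E-sym vw) refl

  σ : Fin n → Fin n → Fin n
  σ y x = if does (y FinP.≟ u) then Iᵤ.h x else if does (y FinP.≟ w) then Iw.h x else ρ y x

  σ-u : ∀ x → σ u x ≡ Iᵤ.h x
  σ-u x = if-true (u FinP.≟ u) refl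

  σ-w : ∀ x → σ w x ≡ Iw.h x
  σ-w x = trans (if-false (w FinP.≟ u) w≢u) (if-true (w FinP.≟ w) refl)

  σ-other : ∀ {y} x → y ≢ u → y ≢ w → σ y x ≡ ρ y x
  σ-other {y} x y≢u y≢w = trans (if-false (y FinP.≟ u) y≢u) (if-false (y FinP.≟ w) y≢w)

  H-u : ∀ {x} → E H u x → x ≡ w ⊎ E G u x
  H-u e with upd-true-E⁻ G e
  ... | inj₁ (inj₁ (_ , p)) = inj₁ p
  ... | inj₁ (inj₂ (p , _)) = ⊥-elim (w≢u (sym p))
  ... | inj₂ e′ = inj₂ e′

  H-w : ∀ {x} → E H w x → x ≡ u ⊎ E G w x
  H-w e with upd-true-E⁻ G e
  ... | inj₁ (inj₁ (p , _)) = ⊥-elim (w≢u p)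
  ... | inj₁ (inj₂ (_ , p)) = inj₁ p
  ... | inj₂ e′ = inj₂ e′

  H-other : ∀ {x y} → E H y x → y ≢ u → y ≢ w → E G y x
  H-other e y≢u y≢w with upd-true-E⁻ G e
  ... | inj₁ (inj₁ (p , _)) = ⊥-elim (y≢u p)
  ... | inj₁ (inj₂ (p , _)) = ⊥-elim (y≢w p)
  ... | inj₂ e′ = e′

  H-u⁺ : ∀ {x} → x ≡ w ⊎ E G u x → E H u x
  H-u⁺ (inj₁ refl) = uw-H
  H-u⁺ (inj₂ e) = E-H e

  H-w⁺ : ∀ {x} → x ≡ u ⊎ E G w x → E H w x
  H-w⁺ (inj₁ refl) = Simple.E-sym H H-simple uw-H
  H-w⁺ (inj₂ e) = E-H e

  H-rot : Rot H σ
  H-rot .rot-closed {y} {x} e with y FinP.≟ u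
  ... | yes refl = H-u⁺ (Iᵤ.insert-closed (H-u e))
  ... | no y≢u with y FinP.≟ w
  ...   | yes refl = H-w⁺ (Iw.insert-closed (H-w e))
  ...   | no y≢w = E-H (rot-closed rot (H-other e y≢u y≢w))
  H-rot .rot-cyclic {y} e f with y FinP.≟ u
  ... | yes refl = Iᵤ.insert-cyclic (H-u e) (H-u f)
  ... | no y≢u with y FinP.≟ w
  ...   | yes refl = Iw.insert-cyclic (H-w e) (H-w f)
  ...   | no y≢w = rot-cyclic rot (H-other e y≢u y≢w) (H-other f y≢u y≢w)

  module HF = Faces H H-simple H-rot

  ψ : Dart n → Dart n
  ψ = faceStep σ

  data Tri : Dart n → Set where
    tri-uv : Tri (u , v)
    tri-vw : Tri (v , w)
    tri-wu : Tri (w , u)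

  tri? : ∀ x → Tri x ⊎ ¬ Tri x
  tri? x with x ≟ᵈ (u , v) | x ≟ᵈ (v , w) | x ≟ᵈ (w , u)
  ... | yes refl | _ | _ = inj₁ tri-uv
  ... | no _ | yes refl | _ = inj₁ tri-vw
  ... | no _ | no _ | yes refl = inj₁ tri-wu
  ... | no p | no q | no r = inj₂ λ { tri-uv → p refl ; tri-vw → q refl ; tri-wu → r refl }

  tri-closed : ∀ {x} → Tri x → Tri (ψ x)
  tri-closed tri-uv = subst Tri (sym (cong (v ,_) (trans (σ-other u v≢u v≢w) ρvu))) tri-vw
  tri-closed tri-vw = subst Tri (sym (cong (w ,_) (trans (σ-w v) (Iw.insert-gap (E-sym vw) refl)))) tri-wu
  tri-closed tri-wu = subst Tri (sym (cong (u ,_) (trans (σ-u w) Iᵤ.insert-q))) tri-uv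

  -- Contracting the new face onto the corner u, v, w.
  back : Dart n → Dart n
  back x = if does (x ≟ᵈ (u , w)) then (u , v) else x

  back-uw : back (u , w) ≡ (u , v)
  back-uw = if-true ((u , w) ≟ᵈ (u , w)) refl

  back-id : ∀ {x} → x ≢ (u , w) → back x ≡ x
  back-id {x} p = if-false (x ≟ᵈ (u , w)) p

  -- Away from the triangle a step of `ψ` is a step of `φ`, except that `(u , w)` replaces the
  -- passage through `(u , v)` and `(v , w)`.
  non-tri-step : ∀ {y} → IsDart H y → ¬ Tri y → ¬ Tri (ψ y) × Reach φ (back y) (back (ψ y))
  non-tri-step {p , q} e ¬t with eqFin? q u
  ... | yes refl with H-u (Simple.E-sym H H-simple e)
  ...   | inj₁ refl = ⊥-elim (¬t tri-wu)
  ...   | inj₂ up with eqFin? (ρ u p) v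
  ...     | yes r = subst (λ z → ¬ Tri z × Reach φ (back (p , u)) (back z)) (sym (cong (u ,_) (trans (σ-u p) (Iᵤ.insert-gap up r))))
              ((λ { tri-uv → v≢w refl ; tri-vw → v≢u refl ; tri-wu → w≢u refl }) ,
               subst₂ (Reach φ) (sym (back-id λ pu≡ → w≢u (sym (cong proj₂ pu≡)))) (sym back-uw) (step (reach-≡ (cong (u ,_) r))))
  ...     | no r = subst (λ z → ¬ Tri z × Reach φ (back (p , u)) (back z)) (sym (cong (u ,_) (trans (σ-u p) (Iᵤ.insert-old up r))))
              ((λ t → not-tri t refl) ,
               subst₂ (Reach φ) (sym (back-id λ pu≡ → w≢u (sym (cong proj₂ pu≡))))
                 (sym (back-id λ e → u≁w (subst (E G u) (cong proj₂ e) (rot-closed rot up)))) (step done))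
    where
    not-tri : ∀ {x} → Tri x → x ≡ (u , ρ u p) → ⊥
    not-tri tri-uv e = r (sym (cong proj₂ e))
    not-tri tri-vw e = v≢u (cong proj₁ e)
    not-tri tri-wu e = w≢u (cong proj₁ e)
  non-tri-step {p , q} e ¬t | no q≢u with eqFin? q w
  ... | no q≢w = subst (λ z → ¬ Tri z × Reach φ (back (p , q)) (back z)) (sym (cong (q ,_) (σ-other p q≢u q≢w)))
        ((λ t → not-tri t refl) , subst₂ (Reach φ) (sym (back-id λ e → q≢w (cong proj₂ e))) (sym (back-id λ e → q≢u (cong proj₁ e))) (step done))
    where
    qp : E G q p
    qp = H-other (Simple.E-sym H H-simple e) q≢u q≢w
    not-tri : ∀ {x} → Tri x → x ≡ (q , ρ q p) → ⊥
    not-tri tri-uv e = q≢u (sym (cong proj₁ e))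
    not-tri tri-wu e = q≢w (sym (cong proj₁ e))
    not-tri tri-vw e with cong proj₁ e
    ... | refl with ρ-injective qp vu (trans (sym (cong proj₂ e)) (sym ρvu))
    ...   | refl = ¬t tri-uv
  ... | yes refl with H-w (Simple.E-sym H H-simple e)
  ...   | inj₁ refl = subst (λ z → ¬ Tri z × Reach φ (back (u , w)) (back z)) (sym (cong (w ,_) (trans (σ-w u) Iw.insert-q)))
          ((λ t → not-tri t refl) , subst₂ (Reach φ) (sym back-uw) (sym (back-id λ e → w≢u (cong proj₁ e)))
            (step (subst (λ z → Reach φ (v , z) (w , g)) (sym ρvu) (step done))))
    where
    not-tri : ∀ {x} → Tri x → x ≡ (w , g) → ⊥
    not-tri tri-uv e = w≢u (sym (cong proj₁ e))
    not-tri tri-vw e = v≢w (cong proj₁ e)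
    not-tri tri-wu e = u≁w (E-sym (subst (E G w) (sym (cong proj₂ e)) (rot-closed rot (E-sym vw))))
  ...   | inj₂ wp with eqFin? (ρ w p) g
  ...     | yes r = ⊥-elim (¬t (subst (λ z → Tri (z , w)) (ρ-injective (E-sym vw) wp (sym r)) tri-vw))
  ...     | no r = subst (λ z → ¬ Tri z × Reach φ (back (p , w)) (back z)) (sym (cong (w ,_) (trans (σ-w p) (Iw.insert-old wp r))))
            ((λ t → not-tri t refl) , subst₂ (Reach φ)
              (sym (back-id λ e → u≁w (E-sym (subst (E G w) (cong proj₁ e) wp)))) (sym (back-id λ e → w≢u (cong proj₁ e))) (step done))
    where
    not-tri : ∀ {x} → Tri x → x ≡ (w , ρ w p) → ⊥
    not-tri tri-uv e = w≢u (sym (cong proj₁ e))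
    not-tri tri-vw e = v≢w (cong proj₁ e)
    not-tri tri-wu e = u≁w (E-sym (subst (E G w) (sym (cong proj₂ e)) (rot-closed rot wp)))

  K : Dart n ⊎ Fin n → ⊤ ⊎ (Dart n ⊎ Fin n) → Set
  K (inj₁ y) (inj₁ _) = Tri y
  K (inj₁ y) (inj₂ (inj₁ e)) = ¬ Tri y × Reach φ e (back y)
  K (inj₁ y) (inj₂ (inj₂ _)) = ⊥
  K (inj₂ y) (inj₁ _) = ⊥
  K (inj₂ y) (inj₂ (inj₁ _)) = ⊥
  K (inj₂ y) (inj₂ (inj₂ x)) = x ≡ y

  faces-≤ : 1 + faces G ρ ≤ faces H σ
  faces-≤ = transversal-≤ (unitᵗ ⊎ᵗ facesᵗ) HF.facesᵗ K tot inv fun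
    where
    V : ⊤ ⊎ (Dart n ⊎ Fin n) → Set
    V = Plus (IsFaceElement G)
    not-uw : ∀ {x} → IsDart G x → x ≢ (u , w)
    not-uw e refl = u≁w e
    uw-not-tri : ∀ {x} → Tri x → x ≢ (u , w)
    uw-not-tri tri-uv e = v≢w (cong proj₂ e)
    uw-not-tri tri-vw e = v≢u (cong proj₁ e)
    uw-not-tri tri-wu e = w≢u (cong proj₁ e)
    tot : ∀ {x} → V x → ∃ λ y → IsFaceElement H y × K y x
    tot {inj₁ _} _ = inj₁ (w , u) , Simple.E-sym H H-simple uw-H , tri-wu
    tot {inj₂ (inj₁ e)} ve with tri? e
    ... | inj₂ ¬t = inj₁ e , E-H ve , ¬t , subst (Reach φ e) (sym (back-id (not-uw ve))) done
    ... | inj₁ t = inj₁ (u , w) , uw-H , (λ t′ → uw-not-tri t′ refl) , subst (Reach φ e) (sym back-uw) (to-uv ve t)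
      where
      to-uv : ∀ {e} → IsDart G e → Tri e → Reach φ e (u , v)
      to-uv ve tri-uv = done
      to-uv ve tri-vw = φ-sym (E-sym vu) (step (reach-≡ (cong (v ,_) ρvu)))
      to-uv ve tri-wu = ⊥-elim (u≁w (E-sym ve))
    tot {inj₂ (inj₂ x)} iso = inj₂ x , (λ y → trans (upd-miss G u w true not-pair) (iso y)) , refl
      where
      not-pair : ∀ {y} → ¬ SamePair u w x y
      not-pair (inj₁ (refl , _)) = true≢false (E-sym vu) (iso v)
      not-pair (inj₂ (refl , _)) = true≢false (E-sym vw) (iso v)
    inv-reach : ∀ {y y′ x} → IsDart H y → Reach ψ y y′ → K (inj₁ y) x → K (inj₁ y′) x
    inv-reach vy done k = k
    inv-reach {y} {x = inj₁ _} vy (step r) t = inv-reach {x = inj₁ tt} (HF.φ-closed {y} vy) r (tri-closed t)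
    inv-reach {y} {x = inj₂ (inj₁ e)} vy (step r) (¬t , s) with non-tri-step {y} vy ¬t
    ... | ¬t′ , s′ = inv-reach {x = inj₂ (inj₁ e)} (HF.φ-closed {y} vy) r (¬t′ , reach-trans s s′)
    inv : ∀ {y y′ x} → V x → IsFaceElement H y → IsFaceElement H y′ → Face σ y y′ → K y x → K y′ x
    inv {inj₁ y} {inj₁ y′} {x} _ vy _ (inj₁ r) k = inv-reach {y} {y′} {x} vy r k
    inv {inj₂ y} {inj₂ y′} _ _ _ (inj₂ refl) k = k
    fun : ∀ {y x x′} → V x → V x′ → IsFaceElement H y → K y x → K y x′ → Pointwise _≡_ (Face ρ) x x′
    fun {inj₁ y} {inj₁ _} {inj₁ _} _ _ _ _ _ = inj₁ refl
    fun {inj₁ y} {inj₁ _} {inj₂ (inj₁ e)} _ _ _ a (¬a , _) = ⊥-elim (¬a a)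
    fun {inj₁ y} {inj₂ (inj₁ e)} {inj₁ _} _ _ _ (¬a , _) a = ⊥-elim (¬a a)
    fun {inj₁ y} {inj₂ (inj₁ e)} {inj₂ (inj₁ e′)} _ v₂ _ (_ , r) (_ , r′) = inj₂ (inj₁ (reach-trans r (φ-sym v₂ r′)))
    fun {inj₂ y} {inj₂ (inj₂ x)} {inj₂ (inj₂ x′)} _ _ _ p q = inj₂ (inj₂ (trans p (sym q)))

  components-≤ : components H ≤ components G
  components-≤ = transversal-≤ (Components.componentsᵗ H H-simple) (Components.componentsᵗ G simple) (λ y x → Conn H x y)
    (λ {x} _ → x , tt , nil) (λ _ _ _ c p → conn-trans p (conn-mono (λ e → cons (E-H e) nil) c))
    (λ _ _ _ p q → conn-trans p (Components.conn-sym H H-simple q))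

darts-upd-true-≤ : (G : Graph n) (u w : Fin n) → length (darts (upd G u w true)) ≤ 2 + length (darts G)
darts-upd-true-≤ G u w = distinct-⊆⇒length≤ {ys = (u , w) ∷ (w , u) ∷ darts G} (darts-distinct (upd G u w true)) λ {x} x∈ → new {x} (upd-true-E⁻ G (∈-darts⁻ (upd G u w true) {x} x∈))
  where
  new : ∀ {x} → SamePair u w (proj₁ x) (proj₂ x) ⊎ E G (proj₁ x) (proj₂ x) → x ∈ (u , w) ∷ (w , u) ∷ darts G
  new (inj₁ (inj₁ (refl , refl))) = here refl
  new (inj₁ (inj₂ (refl , refl))) = there (here refl)
  new (inj₂ e) = there (there (∈-darts⁺ G e))

genusClass-corner : {G : Graph n} → IsSimple G → ∀ {ρ} → IsRotationSystem G ρ →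
  4 * components G + length (darts G) ≤ 2 * n + 2 * faces G ρ + 4 * k →
  ∀ {v u} → E G v u → ρ v u ≢ u → GenusClass k (upd G u (ρ v u) true)
genusClass-corner {n} {k} {G} simple {ρ} rot p {v} {u} vu w≢u with bool-cases (adj G u (ρ v u))
... | inj₁ e = subst (GenusClass k) (sym (upd-true-id simple e)) (simple , ρ , rot , p)
... | inj₂ e = H-simple , σ , rot⇒isRot H-rot ,
    genus-transfer {k = k} {G} {H} {ρ} {σ} 0 0 1 0 2 0 refl components-≤ (darts-upd-true-≤ G u (ρ v u)) faces-≤ p
  where open Chord G simple (isRot⇒rot rot) vu refl w≢u (λ e′ → true≢false e′ e)

-- Hooking up the isolated vertex `v` merges two components, adds two darts and loses the face of
-- `v` itself: 4 = 2 + 2 in the balance.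
module Leaf {n} (G : Graph n) (simple : IsSimple G) {ρ : Fin n → Fin n → Fin n} (rot : Rot G ρ) {v z : Fin n}
  (v-iso : Isolated G v) (z≢v : z ≢ v) where

  open Simple G simple
  open Faces G simple rot

  H : Graph n
  H = upd G z v true

  H-simple : IsSimple H
  H-simple = upd-simple G z v true z≢v simple

  E-H : ∀ {x y} → E G x y → E H x y
  E-H = upd-true-mono G

  zv-H : E H z v
  zv-H = upd-hit G z v true (inj₁ (refl , refl))

  no-v : ∀ {x} → ¬ E G v x
  no-v {x} e = true≢false e (v-iso x)

  H-v : ∀ {x} → E H v x → x ≡ z
  H-v e with upd-true-E⁻ G e
  ... | inj₁ (inj₁ (p , _)) = ⊥-elim (z≢v (sym p))
  ... | inj₁ (inj₂ (_ , p)) = p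
  ... | inj₂ e′ = ⊥-elim (no-v e′)

  H-z : ∀ {x} → E H z x → x ≡ v ⊎ E G z x
  H-z e with upd-true-E⁻ G e
  ... | inj₁ (inj₁ (_ , p)) = inj₁ p
  ... | inj₁ (inj₂ (p , _)) = ⊥-elim (z≢v p)
  ... | inj₂ e′ = inj₂ e′

  H-z⁺ : ∀ {x} → x ≡ v ⊎ E G z x → E H z x
  H-z⁺ (inj₁ refl) = zv-H
  H-z⁺ (inj₂ e) = E-H e

  H-other : ∀ {x y} → E H y x → y ≢ v → y ≢ z → E G y x
  H-other e y≢v y≢z with upd-true-E⁻ G e
  ... | inj₁ (inj₁ (p , _)) = ⊥-elim (y≢z p)
  ... | inj₁ (inj₂ (p , _)) = ⊥-elim (y≢v p)
  ... | inj₂ e′ = e′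

  components-≤ : 1 + components H ≤ components G
  components-≤ = transversal-≤ (unitᵗ ⊎ᵗ componentsᵗ) (Components.componentsᵗ G simple) K tot inv fun
    where
    open Components H H-simple
    V : ⊤ ⊎ Fin n → Set
    V = Plus (λ _ → ⊤)
    K : Fin n → ⊤ ⊎ Fin n → Set
    K y (inj₁ _) = y ≡ v
    K y (inj₂ x) = y ≢ v × Conn H x y
    tot : ∀ {x} → V x → ∃ λ y → ⊤ × K y x
    tot {inj₁ _} _ = v , tt , refl
    tot {inj₂ x} _ with eqFin? x v
    ... | no p = x , tt , p , nil
    ... | yes refl = z , tt , z≢v , cons (Simple.E-sym H H-simple zv-H) nil
    inv : ∀ {y y′ x} → V x → ⊤ → ⊤ → Conn G y y′ → K y x → K y′ x
    inv {x = inj₁ _} _ _ _ c refl = sym (isolated-conn v-iso c)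
    inv {x = inj₂ x} _ _ _ c (p , q) = (λ { refl → p (sym (isolated-conn v-iso (Components.conn-sym G simple c))) }) ,
      conn-trans q (conn-mono (λ e → cons (E-H e) nil) c)
    fun : ∀ {y x x′} → V x → V x′ → ⊤ → K y x → K y x′ → Pointwise _≡_ (Conn H) x x′
    fun {y} {inj₁ _} {inj₁ _} _ _ _ _ _ = inj₁ refl
    fun {y} {inj₁ _} {inj₂ _} _ _ _ p (q , _) = ⊥-elim (q p)
    fun {y} {inj₂ _} {inj₁ _} _ _ _ (q , _) p = ⊥-elim (q p)
    fun {y} {inj₂ _} {inj₂ _} _ _ _ (_ , c) (_ , c′) = inj₂ (conn-trans c (conn-sym c′))

  -- o is the face element of G at the corner of z that receives the leaf.
  back : Dart n ⊎ Fin n → Dart n → Dart n ⊎ Fin n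
  back o y = if does (samePair? z v (proj₁ y) (proj₂ y)) then o else inj₁ y

  back-new : ∀ {o y} → SamePair z v (proj₁ y) (proj₂ y) → back o y ≡ o
  back-new {o} {y} s = if-true (samePair? z v (proj₁ y) (proj₂ y)) s

  back-old : ∀ {o y} → ¬ SamePair z v (proj₁ y) (proj₂ y) → back o y ≡ inj₁ y
  back-old {o} {y} s = if-false (samePair? z v (proj₁ y) (proj₂ y)) s

  old-dart : ∀ {y} → IsDart G y → ¬ SamePair z v (proj₁ y) (proj₂ y)
  old-dart e (inj₁ (refl , refl)) = no-v (E-sym e)
  old-dart e (inj₂ (refl , refl)) = no-v e

  -- The cases of an isolated and of a non-isolated `z` differ only in the rotation `turn` at `z`
  -- and in the element `o`, so these are parameters.
  module Turn (turn : Fin n → Fin n) (o : Dart n ⊎ Fin n) (o-valid : IsFaceElement G o)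
    (turn-closed : ∀ {x} → E H z x → E H z (turn x))
    (turn-cyclic : ∀ {x y} → E H z x → E H z y → Reach turn x y)
    (turn-v : Face ρ o (back o (z , turn v)))
    (turn-old : ∀ {x} → E G z x → Face ρ (inj₁ (z , ρ z x)) (back o (z , turn x)))
    (o-isolated : Isolated G z → o ≡ inj₂ z) where

    σ : Fin n → Fin n → Fin n
    σ y x = if does (y FinP.≟ v) then z else if does (y FinP.≟ z) then turn x else ρ y x

    σ-v : ∀ x → σ v x ≡ z
    σ-v x = if-true (v FinP.≟ v) refl

    σ-z : ∀ x → σ z x ≡ turn x
    σ-z x = trans (if-false (z FinP.≟ v) z≢v) (if-true (z FinP.≟ z) refl)

    σ-other : ∀ {y} x → y ≢ v → y ≢ z → σ y x ≡ ρ y x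
    σ-other {y} x p q = trans (if-false (y FinP.≟ v) p) (if-false (y FinP.≟ z) q)

    H-rot : Rot H σ
    H-rot .rot-closed {y} {x} e with y FinP.≟ v
    ... | yes refl = Simple.E-sym H H-simple zv-H
    ... | no y≢v with y FinP.≟ z
    ...   | yes refl = turn-closed e
    ...   | no y≢z = E-H (rot-closed rot (H-other e y≢v y≢z))
    H-rot .rot-cyclic {y} {x} {x′} e f with y FinP.≟ v
    ... | yes refl = subst (Reach (λ _ → z) x) (trans (H-v e) (sym (H-v f))) done
    ... | no y≢v with y FinP.≟ z
    ...   | yes refl = turn-cyclic e f
    ...   | no y≢z = rot-cyclic rot (H-other e y≢v y≢z) (H-other f y≢v y≢z)

    module HF = Faces H H-simple H-rot

    ψ : Dart n → Dart n
    ψ = faceStep σ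

    back-step : ∀ {y} → IsDart H y → Face ρ (back o y) (back o (ψ y))
    back-step {p , q} e with eqFin? q v
    ... | yes refl with H-v (Simple.E-sym H H-simple e)
    ...   | refl = subst₂ (Face ρ) (sym (back-new {o} {z , v} (inj₁ (refl , refl))))
              (sym (trans (cong (λ a → back o (v , a)) (σ-v z)) (back-new {o} {v , z} (inj₂ (refl , refl))))) Face-refl
    back-step {p , q} e | no q≢v with eqFin? q z
    ... | no q≢z = subst₂ (Face ρ) (sym (back-old {o} {p , q} (old-dart (E-sym qp))))
              (sym (trans (cong (λ a → back o (q , a)) (σ-other p q≢v q≢z)) (back-old {o} {q , ρ q p} (old-dart (rot-closed rot qp))))) (inj₁ (step done))
      where
      qp : E G q p
      qp = H-other (Simple.E-sym H H-simple e) q≢v q≢z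
    ... | yes refl with H-z (Simple.E-sym H H-simple e)
    ...   | inj₁ refl = subst₂ (Face ρ) (sym (back-new {o} {v , z} (inj₂ (refl , refl)))) (cong (λ a → back o (z , a)) (sym (σ-z v))) turn-v
    ...   | inj₂ zp = subst₂ (Face ρ) (sym (back-old {o} {p , z} (old-dart (E-sym zp)))) (cong (λ a → back o (z , a)) (sym (σ-z p)))
              (Face-trans (inj₁ (step done)) (turn-old zp))

    K : ⊤ ⊎ (Dart n ⊎ Fin n) → Dart n ⊎ Fin n → Set
    K (inj₁ _) x = x ≡ inj₂ v
    K (inj₂ (inj₁ y)) x = Face ρ x (back o y)
    K (inj₂ (inj₂ y)) x = x ≡ inj₂ y

    faces-≤ : faces G ρ ≤ 1 + faces H σ
    faces-≤ = transversal-≤ facesᵗ (unitᵗ ⊎ᵗ HF.facesᵗ) K tot inv fun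
      where
      V : ⊤ ⊎ (Dart n ⊎ Fin n) → Set
      V = Plus (IsFaceElement H)
      tot : ∀ {x} → IsFaceElement G x → ∃ λ y → V y × K y x
      tot {inj₁ e} ve = inj₂ (inj₁ e) , E-H ve , subst (Face ρ (inj₁ e)) (sym (back-old {o} {e} (old-dart ve))) Face-refl
      tot {inj₂ x} iso with eqFin? x v
      ... | yes refl = inj₁ tt , tt , refl
      ... | no x≢v with eqFin? x z
      ...   | yes refl = inj₂ (inj₁ (z , v)) , zv-H ,
                subst (Face ρ (inj₂ z)) (sym (trans (back-new {o} {z , v} (inj₁ (refl , refl))) (o-isolated iso))) Face-refl
      ...   | no x≢z = inj₂ (inj₂ x) , (λ y → trans (upd-miss G z v true λ { (inj₁ (p , _)) → x≢z p ; (inj₂ (p , _)) → x≢v p }) (iso y)) , refl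
      inv-reach : ∀ {y y′ x} → IsDart H y → Reach ψ y y′ → Face ρ x (back o y) → Face ρ x (back o y′)
      inv-reach vy done k = k
      inv-reach {y} vy (step r) k = inv-reach (HF.φ-closed {y} vy) r (Face-trans k (back-step {y} vy))
      inv : ∀ {y y′ x} → IsFaceElement G x → V y → V y′ → Pointwise _≡_ (Face σ) y y′ → K y x → K y′ x
      inv {inj₁ _} {inj₁ _} _ _ _ _ k = k
      inv {inj₂ (inj₁ y)} {inj₂ (inj₁ y′)} _ vy _ (inj₂ (inj₁ r)) k = inv-reach {y} {y′} vy r k
      inv {inj₂ (inj₂ y)} {inj₂ (inj₂ y′)} _ _ _ (inj₂ (inj₂ refl)) k = k
      fun : ∀ {y x x′} → IsFaceElement G x → IsFaceElement G x′ → V y → K y x → K y x′ → Face ρ x x′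
      fun {inj₁ _} _ _ _ refl refl = Face-refl
      fun {inj₂ (inj₁ y)} {x} {x′} _ v₂ _ p q = Face-trans p (Face-sym {x′} v₂ q)
      fun {inj₂ (inj₂ y)} _ _ _ refl refl = Face-refl

    genus-≤ : 4 * components G + length (darts G) ≤ 2 * n + 2 * faces G ρ + 4 * k → GenusClass k H
    genus-≤ {k = k} p = H-simple , σ , rot⇒isRot H-rot ,
      genus-transfer {k = k} {G} {H} {ρ} {σ} 1 0 0 0 2 1 refl components-≤ (darts-upd-true-≤ G z v) faces-≤ p

genusClass-leaf : {G : Graph n} {v z : Fin n} → Isolated G v → z ≢ v → GenusClass k G → GenusClass k (upd G z v true)
genusClass-leaf {k = k} {G} {v} {z} v-iso z≢v (simple , ρ , isRot , p) with isolated? G z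
... | inj₁ z-iso = Turn.genus-≤ (λ _ → v) (inj₂ z) z-iso (λ _ → zv-H)
      (λ {x} e f → subst (Reach (λ _ → v) x) (trans (only e) (sym (only f))) done)
      (subst (Face ρ (inj₂ z)) (sym (back-new {inj₂ z} {z , v} (inj₁ (refl , refl)))) Face-refl)
      (λ {x} e → ⊥-elim (true≢false e (z-iso x))) (λ _ → refl) {k = k} p
  where
  open Leaf G simple (isRot⇒rot isRot) v-iso z≢v
  only : ∀ {x} → E H z x → x ≡ v
  only {x} e with H-z e
  ... | inj₁ q = q
  ... | inj₂ e′ = ⊥-elim (true≢false e′ (z-iso x))
... | inj₂ (g , zg) = Turn.genus-≤ I.h (inj₁ (z , g)) zg (λ e → H-z⁺ (I.insert-closed (H-z e))) (λ e f → I.insert-cyclic (H-z e) (H-z f))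
      (subst (Face ρ (inj₁ (z , g))) (sym (trans (cong (λ a → back (inj₁ (z , g)) (z , a)) I.insert-q) (back-old {inj₁ (z , g)} {z , g} (old-dart zg)))) Face-refl)
      turn-old (λ iso → ⊥-elim (true≢false zg (iso g))) {k = k} p
  where
  rot : Rot G ρ
  rot = isRot⇒rot isRot
  open Leaf G simple rot v-iso z≢v
  pg = Faces.ρ-surjective G simple rot zg
  module I = Insert (ρ z) v g (E G z) (rot-closed rot) (rot-cyclic rot) (λ e → no-v (Simple.E-sym G simple e)) zg (proj₁ pg) (proj₁ (proj₂ pg)) (proj₂ (proj₂ pg))
  turn-old : ∀ {x} → E G z x → Face ρ (inj₁ (z , ρ z x)) (back (inj₁ (z , g)) (z , I.h x))
  turn-old {x} e with eqFin? (ρ z x) g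
  ... | yes r = subst₂ (Face ρ) (cong (λ a → inj₁ (z , a)) (sym r))
        (sym (trans (cong (λ a → back (inj₁ (z , g)) (z , a)) (I.insert-gap e r)) (back-new {inj₁ (z , g)} {z , v} (inj₁ (refl , refl))))) Face-refl
  ... | no r = subst (Face ρ (inj₁ (z , ρ z x)))
        (sym (trans (cong (λ a → back (inj₁ (z , g)) (z , a)) (I.insert-old e r)) (back-old {inj₁ (z , g)} {z , ρ z x} (old-dart (rot-closed rot e))))) Face-refl

-- Consequences of Euler's formula

-- The edges outside `H` are deleted one at a time; the bound `m` on the number of darts is the
-- recursion measure.
genusClass-subgraph : {G H : Graph n} → IsSimple H → (∀ {x y} → E H x y → E G x y) → GenusClass k G → GenusClass k H
genusClass-subgraph {n} {k} {G} {H} H-simple sub gc = go (length (darts G)) G ≤-refl sub gc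
  where
  go : ∀ m (G : Graph n) → length (darts G) ≤ m → (∀ {x y} → E H x y → E G x y) → GenusClass k G → GenusClass k H
  go m G le sub gc with any (λ d → not (adj H (proj₁ d) (proj₂ d))) (darts G) in eq
  ... | false = subst (GenusClass k) (graph-ext λ x y → bool-≡ (λ e → kept (x , y) e (adj H x y) refl) sub) gc
    where
    kept : ∀ d → IsDart G d → (b : Bool) → adj H (proj₁ d) (proj₂ d) ≡ b → b ≡ true
    kept d e true _ = refl
    kept d e false q = ⊥-elim (true≢false (any-true⁺ (λ d → not (adj H (proj₁ d) (proj₂ d))) (∈-darts⁺ G {d} e) (cong not q)) eq)
  go m G le sub gc | true with any-true⁻ (λ d → not (adj H (proj₁ d) (proj₂ d))) (darts G) eq
  go zero G le sub gc | true | (x , y) , xy∈ , q with darts G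
  go zero G () sub gc | true | (x , y) , xy∈ , q | _ ∷ _
  go (suc m) G le sub gc | true | (x , y) , xy∈ , q =
    go m (upd G x y false) (≤-pred (≤-trans (n≤1+n _) (≤-trans (Delete.darts-≤ G simple rot e) le))) sub′ (genusClass-delete {k = k} e gc)
    where
    simple = proj₁ gc
    rot : Rot G (proj₁ (proj₂ gc))
    rot = isRot⇒rot (proj₁ (proj₂ (proj₂ gc)))
    e : E G x y
    e = ∈-darts⁻ G {x , y} xy∈
    not-xy : ∀ {a b} → E H a b → ¬ SamePair x y a b
    not-xy f (inj₁ (refl , refl)) = true≢false q (cong not f)
    not-xy f (inj₂ (refl , refl)) = true≢false q (cong not (Simple.E-sym H H-simple f))
    sub′ : ∀ {a b} → E H a b → E (upd G x y false) a b
    sub′ f = trans (upd-miss G x y false (not-xy f)) (sub f)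

isolated-≤-n : (G : Graph n) → isolated G ≤ n
isolated-≤-n {n} G = ≤-trans (ListP.length-filter (T? ∘ isolatedᵇ G) (allFin n)) (≤-reflexive (ListP.length-tabulate id))

apart⇒≡ : {S : A → A → Set} {xs : List A} → AllPairs (λ x y → ¬ S x y) xs → ∀ {x y} → x ∈ xs → y ∈ xs → S x y → S y x → x ≡ y
apart⇒≡ (ap ∷ aps) (here refl) (here refl) _ _ = refl
apart⇒≡ (ap ∷ aps) (here refl) (there y∈) s _ = ⊥-elim (All.lookup ap y∈ s)
apart⇒≡ (ap ∷ aps) (there x∈) (here refl) _ s = ⊥-elim (All.lookup ap x∈ s)
apart⇒≡ (ap ∷ aps) (there x∈) (there y∈) s s′ = apart⇒≡ aps x∈ y∈ s s′

apart⇒distinct : {S : A → A → Set} → (∀ {x} → S x x) → {xs : List A} → AllPairs (λ x y → ¬ S x y) xs → Distinct xs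
apart⇒distinct S-refl = AllPairs.map λ { ¬S refl → ¬S S-refl }

module FaceCount {n} (G : Graph n) (simple : IsSimple G) {ρ : Fin n → Fin n → Fin n} (rot : Rot G ρ) where

  open Simple G simple
  open Faces G simple rot

  faceReps : List (Dart n)
  faceReps = reps dartFacesᵗ

  φ≢ : ∀ {d} → IsDart G d → d ≢ φ d
  φ≢ {u , v} e p = E⇒≢ e (cong proj₁ p)

  digon : ∀ {u v} → E G u v → φ (φ (u , v)) ≡ (u , v) → ρ v u ≡ u × ρ u v ≡ v
  digon {u} {v} e p = q , subst (λ a → ρ a v ≡ v) q (cong proj₂ p)
    where
    q : ρ v u ≡ u
    q = cong proj₁ p

  -- Every face hands out `a` distinct tokens from `ys`; by `same`, different faces never share a
  -- token.
  faces-* : {B : Set} (f : Dart n → List B) (a : ℕ) (ys : List B) → (∀ d → length (f d) ≡ a) →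
    (∀ {d} → IsDart G d → Distinct (f d)) → (∀ {d y} → IsDart G d → y ∈ f d → y ∈ ys) →
    (∀ {d d′ y} → IsDart G d → IsDart G d′ → y ∈ f d → y ∈ f d′ → Reach φ d d′) →
    classes (sameFace G ρ) (darts G) * a ≤ length ys
  faces-* f a ys len dist sub same = ≤-trans (*-monoˡ-≤ a (≤-reflexive (sym (length-reps dartFacesᵗ))))
    (≤-trans (length-concatMap-≥ f faceReps a 1 (λ {d} _ → ≤-reflexive (sym (trans (*-identityʳ (length (f d))) (len d)))))
      (≤-trans (≤-reflexive (*-identityʳ (length (concatMap f faceReps)))) (distinct-⊆⇒length≤ (concatMap-distinct {f = f} {xs = faceReps} (apart⇒distinct done (reps-apart dartFacesᵗ))
          (λ {r} r∈ → dist {r} (valid r∈))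
          (λ {r} {r′} r∈ r′∈ y∈ y∈′ → apart⇒≡ (reps-apart dartFacesᵗ) r∈ r′∈
            (same {r} {r′} (valid r∈) (valid r′∈) y∈ y∈′) (same {r′} {r} (valid r′∈) (valid r∈) y∈′ y∈)))
        member)))
    where
    valid : ∀ {r} → r ∈ faceReps → IsDart G r
    valid = reps-valid dartFacesᵗ
    member : ∀ {y} → y ∈ concatMap f faceReps → y ∈ ys
    member y∈ with find (∈-concatMap⁻ f {xs = faceReps} y∈)
    ... | r , r∈ , y∈fr = sub {r} (valid r∈) y∈fr

  -- A face of a simple graph has at least three darts unless it surrounds a component that is a
  -- single edge. Such a face takes an end of the edge as its third token, whence the summand `n` in
  -- `triangles-≤`.
  triple : Dart n → List (Dart n ⊎ Fin n)
  triple d = inj₁ d ∷ inj₁ (φ d) ∷ (if does (φ (φ d) ≟ᵈ d) then inj₂ (proj₁ d) else inj₁ (φ (φ d))) ∷ []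

  data InTriple (d : Dart n) : Dart n ⊎ Fin n → Set where
    at : ∀ {e} → Reach φ d e → InTriple d (inj₁ e)
    exceptional : φ (φ d) ≡ d → InTriple d (inj₂ (proj₁ d))

  triple⁻ : ∀ {d y} → y ∈ triple d → InTriple d y
  triple⁻ (here refl) = at done
  triple⁻ (there (here refl)) = at (step done)
  triple⁻ {d} (there (there (here refl))) with φ (φ d) ≟ᵈ d
  ... | yes p = exceptional p
  ... | no _ = at (step (step done))

  triangles-≤ : classes (sameFace G ρ) (darts G) * 3 ≤ length (darts G) + n
  triangles-≤ = ≤-trans (faces-* triple 3 (map inj₁ (darts G) ++ map inj₂ (allFin n)) (λ _ → refl) dist sub same)
    (≤-reflexive (trans (ListP.length-++ (map inj₁ (darts G))) (cong₂ _+_ (ListP.length-map inj₁ (darts G))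
      (trans (ListP.length-map inj₂ (allFin n)) (ListP.length-tabulate id)))))
    where
    dist : ∀ {d} → IsDart G d → Distinct (triple d)
    dist {d} e with φ (φ d) ≟ᵈ d
    ... | yes p = ((φ≢ {d} e ∘ inj₁-injective) ∷ (λ ()) ∷ []) ∷ ((λ ()) ∷ []) ∷ [] ∷ []
    ... | no p = ((φ≢ {d} e ∘ inj₁-injective) ∷ (λ q → p (sym (inj₁-injective q))) ∷ []) ∷
                 ((φ≢ {φ d} (φ-closed e) ∘ inj₁-injective) ∷ []) ∷ [] ∷ []
    sub : ∀ {d y} → IsDart G d → y ∈ triple d → y ∈ map inj₁ (darts G) ++ map inj₂ (allFin n)
    sub e y∈ with triple⁻ y∈
    ... | at r = ∈-++⁺ˡ (∈-map⁺ inj₁ (∈-darts⁺ G (φ-reach-closed e r)))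
    ... | exceptional _ = ∈-++⁺ʳ (map inj₁ (darts G)) (∈-map⁺ inj₂ (∈-allFin _))
    same : ∀ {d d′ y} → IsDart G d → IsDart G d′ → y ∈ triple d → y ∈ triple d′ → Reach φ d d′
    same {d} {d′} e e′ y∈ y∈′ = join (triple⁻ y∈) (triple⁻ y∈′)
      where
      join : ∀ {y} → InTriple d y → InTriple d′ y → Reach φ d d′
      join (at r) (at r′) = reach-trans r (φ-sym e′ r′)
      join (exceptional p) q = exc d d′ e e′ p q
        where
        exc : ∀ d d′ → IsDart G d → IsDart G d′ → φ (φ d) ≡ d → InTriple d′ (inj₂ (proj₁ d)) → Reach φ d d′
        exc (u , v) (.u , v′) e e′ p (exceptional _) = subst (λ a → Reach φ (u , v) (u , a)) (sym (ρ-fixed e (proj₂ (digon e p)) e′)) done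

  quad : Dart n → List (Dart n)
  quad d = d ∷ φ d ∷ φ (φ d) ∷ φ (φ (φ d)) ∷ []

  -- Sides alternate along a face, which rules out length 3. Length 2 would mean an isolated edge,
  -- whose end on the `true` side has no second neighbour. So the first four darts of a face are
  -- distinct.
  quadrangles-≤ : (side : Fin n → Bool) → (∀ {x y} → E G x y → side x ≢ side y) →
    (∀ {x y} → E G x y → side x ≡ true → ∃ λ z → E G x z × z ≢ y) →
    classes (sameFace G ρ) (darts G) * 4 ≤ length (darts G)
  quadrangles-≤ side alt second = faces-* quad 4 (darts G) (λ _ → refl) dist
    (λ e y∈ → ∈-darts⁺ G (φ-reach-closed e (quad⁻ y∈)))
    (λ e e′ y∈ y∈′ → reach-trans (quad⁻ y∈) (φ-sym e′ (quad⁻ y∈′)))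
    where
    quad⁻ : ∀ {d y} → y ∈ quad d → Reach φ d y
    quad⁻ (here refl) = done
    quad⁻ (there (here refl)) = step done
    quad⁻ (there (there (here refl))) = step (step done)
    quad⁻ (there (there (there (here refl)))) = step (step (step done))
    no-digon : ∀ {d} → IsDart G d → d ≢ φ (φ d)
    no-digon {u , v} e p with digon e (sym p) | bool-cases (side u) | bool-cases (side v)
    ... | q , r | inj₁ s | _ = case second e s of λ { (z , f , z≢) → z≢ (ρ-fixed e r f) }
    ... | q , r | inj₂ s | inj₁ t = case second (E-sym e) t of λ { (z , f , z≢) → z≢ (ρ-fixed (E-sym e) q f) }
    ... | q , r | inj₂ s | inj₂ t = alt e (trans s (sym t))
    side-φ : ∀ {d} → IsDart G d → side (proj₁ (φ d)) ≡ not (side (proj₁ d))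
    side-φ {u , v} e with side u in p | side v in q
    ... | true | true = ⊥-elim (alt e (trans p (sym q)))
    ... | true | false = refl
    ... | false | true = refl
    ... | false | false = ⊥-elim (alt e (trans p (sym q)))
    not-fixed : ∀ b → b ≢ not (not (not b))
    not-fixed true ()
    not-fixed false ()
    dist : ∀ {d} → IsDart G d → Distinct (quad d)
    dist {d} e = (φ≢ {d} e ∷ no-digon {d} e ∷ odd ∷ []) ∷ (φ≢ {φ d} e₁ ∷ no-digon {φ d} e₁ ∷ []) ∷ (φ≢ {φ (φ d)} e₂ ∷ []) ∷ [] ∷ []
      where
      e₁ = φ-closed {d} e
      e₂ = φ-closed {φ d} e₁
      odd : d ≢ φ (φ (φ d))
      odd p = not-fixed (side (proj₁ d)) (trans (cong (side ∘ proj₁) p)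
        (trans (side-φ {φ (φ d)} e₂) (cong not (trans (side-φ {φ d} e₁) (cong not (side-φ {d} e))))))

  isolated-≤-components : isolated G ≤ components G
  isolated-≤-components = transversal-≤ (isolatedᵗ G) (Components.componentsᵗ G simple) (λ y x → Conn G x y)
    (λ {x} _ → x , tt , nil) (λ _ _ _ c p → conn-trans p c)
    (λ iso iso′ _ c c′ → trans (isolated-conn iso c) (sym (isolated-conn iso′ c′)))

-- In Euler's inequality times three, 14 = 6 + 2 + 6 collects the vertices, the single-edge faces
-- and the isolated vertices. The constant is crude; linearity is what counts.
darts-≤ : {G : Graph n} → GenusClass k G → length (darts G) ≤ 14 * n + 12 * k
darts-≤ {n} {k} {G} (simple , ρ , rot , p) = arith (components G) (length (darts G)) (classes (sameFace G ρ) (darts G)) (isolated G) p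
    (FaceCount.triangles-≤ G simple (isRot⇒rot rot)) (isolated-≤-n G)
  where
  arith : ∀ c D f i → 4 * c + D ≤ 2 * n + 2 * (f + i) + 4 * k → f * 3 ≤ D + n → i ≤ n → D ≤ 14 * n + 12 * k
  arith c D f i p q r = +-cancelʳ-≤ (2 * D) _ _ (≤-trans (≤-trans (m≤n+m (D + 2 * D) (12 * c)) (≤-reflexive (l₁ c D)))
    (≤-trans (*-monoʳ-≤ 3 p) (≤-trans (≤-reflexive (l₂ n f i k))
      (≤-trans (+-mono-≤ (+-mono-≤ (≤-refl {6 * n + 12 * k}) (*-monoʳ-≤ 2 q)) (*-monoʳ-≤ 6 r)) (≤-reflexive (l₃ n D k))))))
    where
    l₁ : ∀ c D → 12 * c + (D + 2 * D) ≡ 3 * (4 * c + D)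
    l₁ = solve-∀
    l₂ : ∀ n f i k → 3 * (2 * n + 2 * (f + i) + 4 * k) ≡ 6 * n + 12 * k + 2 * (f * 3) + 6 * i
    l₂ = solve-∀
    l₃ : ∀ n D k → 6 * n + 12 * k + 2 * (D + n) + 6 * n ≡ 14 * n + 12 * k + 2 * D
    l₃ = solve-∀

-- The term `4 * isolated G` discounts the vertices without edges, leaving about four darts for each
-- remaining vertex. It is available because every isolated vertex is a component.
bipartite-darts-≤ : {G : Graph n} → GenusClass k G → (side : Fin n → Bool) → (∀ {x y} → E G x y → side x ≢ side y) →
  (∀ {x y} → E G x y → side x ≡ true → ∃ λ z → E G x z × z ≢ y) → length (darts G) + 4 * isolated G ≤ 4 * n + 8 * k
bipartite-darts-≤ {n} {k} {G} (simple , ρ , rot , p) side alt second =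
  arith (components G) (length (darts G)) (classes (sameFace G ρ) (darts G)) (isolated G) p
    (FaceCount.quadrangles-≤ G simple (isRot⇒rot rot) side alt second) (FaceCount.isolated-≤-components G simple (isRot⇒rot rot))
  where
  arith : ∀ c D f i → 4 * c + D ≤ 2 * n + 2 * (f + i) + 4 * k → f * 4 ≤ D → i ≤ c → D + 4 * i ≤ 4 * n + 8 * k
  arith c D f i p q r = +-cancelʳ-≤ (D + 4 * i) _ _ (≤-trans (≤-reflexive (l₁ D i)) (≤-trans (+-monoˡ-≤ (2 * D) (*-monoʳ-≤ 8 r))
    (≤-trans (≤-reflexive (l₂ c D)) (≤-trans (*-monoʳ-≤ 2 p) (≤-trans (≤-reflexive (l₃ n f i k))
      (≤-trans (+-monoʳ-≤ (4 * n + 8 * k + 4 * i) q) (≤-reflexive (l₄ n i k D))))))))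
    where
    l₁ : ∀ D i → D + 4 * i + (D + 4 * i) ≡ 8 * i + 2 * D
    l₁ = solve-∀
    l₂ : ∀ c D → 8 * c + 2 * D ≡ 2 * (4 * c + D)
    l₂ = solve-∀
    l₃ : ∀ n f i k → 2 * (2 * n + 2 * (f + i) + 4 * k) ≡ 4 * n + 8 * k + 4 * i + f * 4
    l₃ = solve-∀
    l₄ : ∀ n i k D → 4 * n + 8 * k + 4 * i + D ≡ 4 * n + 8 * k + (D + 4 * i)
    l₄ = solve-∀

-- Vertices of small degree with a neighbour of bounded degree

length-two : {xs : List A} {x y : A} → Distinct xs → x ∈ xs → y ∈ xs → x ≢ y → 2 ≤ length xs
length-two {xs = xs} {x} {y} _ x∈ y∈ x≢y = distinct-⊆⇒length≤ {xs = x ∷ y ∷ []} ((x≢y ∷ []) ∷ [] ∷ [])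
  λ { (here refl) → x∈ ; (there (here refl)) → y∈ }

second-element : {xs : List (Fin n)} → Distinct xs → 2 ≤ length xs → ∀ y → ∃ λ z → z ∈ xs × z ≢ y
second-element {xs = a ∷ b ∷ _} ((a≢b ∷ _) ∷ _) _ y with a FinP.≟ y
... | no a≢y = a , here refl , a≢y
... | yes refl = b , there (here refl) , a≢b ∘ sym
second-element {xs = _ ∷ []} _ (s≤s ())

length-allFin : ∀ n → length (allFin n) ≡ n
length-allFin n = ListP.length-tabulate id

∧-true⁻ : ∀ {a b} → a ∧ b ≡ true → a ≡ true × b ≡ true
∧-true⁻ {true} {true} _ = refl , refl

not-true⁻ : ∀ {b} → not b ≡ true → b ≡ false
not-true⁻ {false} _ = refl

does-false⁻ : {P : Set} (d : Dec P) → does d ≡ false → ¬ P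
does-false⁻ (no p) _ = p

highᵇ : Graph n → ℕ → Fin n → Bool
highᵇ G t v = does (t ℕ.≤? deg G v)

dartsAt : Graph n → Fin n → List (Dart n)
dartsAt G v = map (v ,_) (nbrs G v)

dartsFrom : Graph n → List (Fin n) → List (Dart n)
dartsFrom G = concatMap (dartsAt G)

∈-dartsFrom⁻ : (G : Graph n) (vs : List (Fin n)) {d : Dart n} → d ∈ dartsFrom G vs → proj₁ d ∈ vs × IsDart G d
∈-dartsFrom⁻ G vs d∈ with find (∈-concatMap⁻ (dartsAt G) {xs = vs} d∈)
... | v , v∈ , d∈′ with ∈-map⁻ (v ,_) d∈′
...   | u , u∈ , refl = v∈ , ∈-nbrs⁻ G u∈

dartsFrom-distinct : (G : Graph n) {vs : List (Fin n)} → Distinct vs → Distinct (dartsFrom G vs)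
dartsFrom-distinct G dist = concatMap-distinct dist (λ {v} _ → DistinctP.map⁺ (cong proj₂) (nbrs-distinct G v)) (λ _ _ → same)
  where
  same : ∀ {x x′ y} → y ∈ dartsAt G x → y ∈ dartsAt G x′ → x ≡ x′
  same p q with ∈-map⁻ _ p | ∈-map⁻ _ q
  ... | _ , _ , refl | _ , _ , refl = refl

dartsFrom-≤ : (G : Graph n) {vs : List (Fin n)} → Distinct vs → length (dartsFrom G vs) ≤ length (darts G)
dartsFrom-≤ G {vs} dist = distinct-⊆⇒length≤ (dartsFrom-distinct G dist) λ d∈ → ∈-darts⁺ G (proj₂ (∈-dartsFrom⁻ G vs d∈))

dartsFrom-≥ : (G : Graph n) (t : ℕ) (vs : List (Fin n)) → (∀ {v} → v ∈ vs → t ≤ deg G v) → length vs * t ≤ length (dartsFrom G vs)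
dartsFrom-≥ G t vs h = ≤-trans (length-concatMap-≥ (dartsAt G) vs t 1
    λ {v} v∈ → ≤-trans (h v∈) (≤-reflexive (sym (trans (*-identityʳ (length (dartsAt G v))) (ListP.length-map (v ,_) (nbrs G v))))))
  (≤-reflexive (*-identityʳ (length (dartsFrom G vs))))

select : (Fin n → Bool) → List (Fin n)
select {n} p = filterᵇ p (allFin n)

∈-select⁻ : (p : Fin n → Bool) {v : Fin n} → v ∈ select p → p v ≡ true
∈-select⁻ p v∈ = proj₂ (∈-filterᵇ⁻ p (allFin _) v∈)

∈-select⁺ : (p : Fin n → Bool) {v : Fin n} → p v ≡ true → v ∈ select p
∈-select⁺ p = ∈-filterᵇ⁺ p (∈-allFin _)

select-distinct : (p : Fin n → Bool) → Distinct (select p)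
select-distinct p = distinct-filterᵇ p (DistinctP.allFin⁺ _)

high-count : (G : Graph n) (t : ℕ) → length (select (highᵇ G t)) * t ≤ length (darts G)
high-count G t = ≤-trans (dartsFrom-≥ G t (select (highᵇ G t)) (λ {v} v∈ → does-true⁻ (t ℕ.≤? deg G v) (∈-select⁻ (highᵇ G t) v∈)))
  (dartsFrom-≤ G (select-distinct (highᵇ G t)))

-- For large n there are at most 15 n darts, so at most n/2 vertices have degree 30 or more and at
-- most n/16 have degree 240 or more.
Light : Graph n → Fin n → Set
Light G v = deg G v ≤ 29 × (deg G v ≤ 2 ⊎ ∃ λ u → E G v u × deg G u ≤ 239)

badᵇ : Graph n → Fin n → Bool
badᵇ G v = not (highᵇ G 30 v) ∧ (highᵇ G 3 v ∧ not (any (not ∘ highᵇ G 240) (nbrs G v)))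

lightᵇ : Graph n → Fin n → Bool
lightᵇ G v = not (highᵇ G 30 v) ∧ not (badᵇ G v)

not-high⁻ : (G : Graph n) (t : ℕ) {v : Fin n} → highᵇ G (suc t) v ≡ false → deg G v ≤ t
not-high⁻ G t {v} p = ≤-pred (≰⇒> (does-false⁻ (suc t ℕ.≤? deg G v) p))

lightᵇ⁻ : (G : Graph n) {v : Fin n} → lightᵇ G v ≡ true → Light G v
lightᵇ⁻ G {v} p with highᵇ G 30 v in h₃₀ | highᵇ G 3 v in h₃ | any (not ∘ highᵇ G 240) (nbrs G v) in ex
... | false | false | _ = not-high⁻ G 29 h₃₀ , inj₁ (not-high⁻ G 2 h₃)
... | false | true | true with any-true⁻ (not ∘ highᵇ G 240) (nbrs G v) ex
...   | u , u∈ , q = not-high⁻ G 29 h₃₀ , inj₂ (u , ∈-nbrs⁻ G u∈ , not-high⁻ G 239 (not-true⁻ q))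

record Bad (G : Graph n) (v : Fin n) : Set where
  field
    bad-deg≤ : deg G v ≤ 29
    bad-deg≥ : 3 ≤ deg G v
    bad-nbr : ∀ {u} → E G v u → highᵇ G 240 u ≡ true

open Bad

badᵇ⁻ : (G : Graph n) {v : Fin n} → badᵇ G v ≡ true → Bad G v
badᵇ⁻ G {v} p with highᵇ G 30 v in h₃₀ | highᵇ G 3 v in h₃ | any (not ∘ highᵇ G 240) (nbrs G v) in ex
... | false | true | false = record
  { bad-deg≤ = not-high⁻ G 29 h₃₀
  ; bad-deg≥ = does-true⁻ (3 ℕ.≤? deg G v) h₃
  ; bad-nbr = λ {u} e → nbr u e (highᵇ G 240 u) refl }
  where
  nbr : ∀ u → E G v u → (b : Bool) → highᵇ G 240 u ≡ b → b ≡ true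
  nbr u e true _ = refl
  nbr u e false q = ⊥-elim (true≢false (any-true⁺ (not ∘ highᵇ G 240) (∈-nbrs⁺ G e) (cong not q)) ex)

cover₃ : (p q r : Fin n → Bool) → (∀ v → p v ≡ true ⊎ q v ≡ true ⊎ r v ≡ true) → n ≤ length (select p) + length (select q) + length (select r)
cover₃ {n} p q r h = ≤-trans (≤-reflexive (sym (length-allFin n))) (≤-trans
  (distinct-⊆⇒length≤ (DistinctP.allFin⁺ n) (λ {v} _ → member v (h v)))
  (≤-reflexive (trans (ListP.length-++ (select p ++ select q)) (cong (_+ length (select r)) (ListP.length-++ (select p))))))
  where
  member : ∀ v → p v ≡ true ⊎ q v ≡ true ⊎ r v ≡ true → v ∈ (select p ++ select q) ++ select r
  member v (inj₁ e) = ∈-++⁺ˡ (∈-++⁺ˡ (∈-select⁺ p e))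
  member v (inj₂ (inj₁ e)) = ∈-++⁺ˡ (∈-++⁺ʳ (select p) (∈-select⁺ q e))
  member v (inj₂ (inj₂ e)) = ∈-++⁺ʳ (select p ++ select q) (∈-select⁺ r e)

-- The edges between bad vertices and vertices of degree at least 240 form a bipartite graph of
-- bounded genus; it has about twice as many edges as vertices, but three for every bad vertex.
bad-count : {G : Graph n} → GenusClass k G → length (select (badᵇ G)) ≤ 2 * length (select (highᵇ G 240)) + 4 * k
bad-count {n} {k} {G} gc@(simple , _) = arith (length (select (badᵇ G))) (length (select (highᵇ G 240))) (isolated X) (length (darts X))
    (bipartite-darts-≤ {k = k} B-class (badᵇ G) sides second) darts-lower cover
  where
  open Simple G simple
  heavy : Fin n → Bool
  heavy = highᵇ G 240
  crossing : Fin n → Fin n → Bool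
  crossing x y = (badᵇ G x ∧ heavy y) ∨ (heavy x ∧ badᵇ G y)
  crossing-sym : ∀ x y → crossing x y ≡ crossing y x
  crossing-sym x y = trans (∨-comm (badᵇ G x ∧ heavy y) _) (cong₂ _∨_ (∧-comm (heavy x) _) (∧-comm (badᵇ G x) _))
  X : Graph n
  X = fromAdj λ x y → adj G x y ∧ crossing x y
  B-adj : ∀ x y → adj X x y ≡ adj G x y ∧ crossing x y
  B-adj = adj-fromAdj _
  B-E⁻ : ∀ {x y} → E X x y → E G x y × crossing x y ≡ true
  B-E⁻ {x} {y} e = ∧-true⁻ (trans (sym (B-adj x y)) e)
  B-E⁺ : ∀ {x y} → E G x y → crossing x y ≡ true → E X x y
  B-E⁺ {x} {y} e c = trans (B-adj x y) (cong₂ _∧_ e c)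
  B-simple : IsSimple X
  B-simple = (λ x y → trans (B-adj x y) (trans (cong₂ _∧_ (proj₁ simple x y) (crossing-sym x y)) (sym (B-adj y x)))) ,
    λ x → trans (B-adj x x) (cong (_∧ crossing x x) (proj₂ simple x))
  B-class : GenusClass k X
  B-class = genusClass-subgraph {k = k} B-simple (proj₁ ∘ B-E⁻) gc
  heavy-not-bad : ∀ {x} → heavy x ≡ true → badᵇ G x ≡ false
  heavy-not-bad {x} h = ≢true⇒false λ b → 240≰29 (≤-trans (does-true⁻ (240 ℕ.≤? deg G x) h) (bad-deg≤ (badᵇ⁻ G b)))
    where
    240≰29 : ¬ (240 ≤ 29)
    240≰29 p = contradiction p (does-false⁻ (240 ℕ.≤? 29) refl)
  ends : ∀ {x y} → E X x y → (badᵇ G x ≡ true × heavy y ≡ true) ⊎ (heavy x ≡ true × badᵇ G y ≡ true)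
  ends {x} {y} e with bool-cases (badᵇ G x ∧ heavy y)
  ... | inj₁ p = inj₁ (∧-true⁻ p)
  ... | inj₂ p = inj₂ (∧-true⁻ (trans (sym (cong (_∨ (heavy x ∧ badᵇ G y)) p)) (proj₂ (B-E⁻ e))))
  sides : ∀ {x y} → E X x y → badᵇ G x ≢ badᵇ G y
  sides e q with ends e
  ... | inj₁ (b , h) = true≢false (trans (sym q) b) (heavy-not-bad h)
  ... | inj₂ (h , b) = true≢false (trans q b) (heavy-not-bad h)
  B-deg : ∀ {x} → badᵇ G x ≡ true → 3 ≤ deg X x
  B-deg {x} b = ≤-trans (bad-deg≥ (badᵇ⁻ G b)) (distinct-⊆⇒length≤ (nbrs-distinct G x) λ {y} y∈ →
    ∈-nbrs⁺ X (B-E⁺ (∈-nbrs⁻ G y∈) (cong (_∨ (heavy x ∧ badᵇ G y)) (cong₂ _∧_ b (bad-nbr (badᵇ⁻ G b) (∈-nbrs⁻ G y∈))))))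
  second : ∀ {x y} → E X x y → badᵇ G x ≡ true → ∃ λ z → E X x z × z ≢ y
  second {x} {y} e b with second-element (nbrs-distinct X x) (≤-trans (n≤1+n 2) (B-deg b)) y
  ... | z , z∈ , z≢y = z , ∈-nbrs⁻ X z∈ , z≢y
  from : List (Dart n)
  from = dartsFrom X (select (badᵇ G))
  from-bad : ∀ {d} → d ∈ from → badᵇ G (proj₁ d) ≡ true × IsDart X d
  from-bad {d} d∈ = ∈-select⁻ (badᵇ G) (proj₁ p) , proj₂ p
    where p = ∈-dartsFrom⁻ X (select (badᵇ G)) d∈
  both-distinct : Distinct (from ++ map rev from)
  both-distinct = AllPairsP.++⁺ (dartsFrom-distinct X (select-distinct (badᵇ G)))
    (DistinctP.map⁺ (λ { refl → refl }) (dartsFrom-distinct X (select-distinct (badᵇ G))))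
    (All.tabulate λ d∈ → All.tabulate λ d′∈ → clash d∈ d′∈)
    where
    clash : ∀ {d d′} → d ∈ from → d′ ∈ map rev from → d ≢ d′
    clash d∈ d′∈ eq with ∈-map⁻ rev d′∈
    clash d∈ d′∈ refl | (x , y) , r∈ , refl = sides {x} {y} (proj₂ (from-bad r∈)) (trans (proj₁ (from-bad r∈)) (sym (proj₁ (from-bad d∈))))
  both-⊆ : ∀ {d} → d ∈ from ++ map rev from → d ∈ darts X
  both-⊆ d∈ with ∈-++⁻ from d∈
  ... | inj₁ p = ∈-darts⁺ X (proj₂ (from-bad p))
  ... | inj₂ p with ∈-map⁻ rev p
  ...   | (x , y) , q , refl = ∈-darts⁺ X {y , x} (Simple.E-sym X B-simple (proj₂ (from-bad q)))
  darts-lower : length (select (badᵇ G)) * 3 + length (select (badᵇ G)) * 3 ≤ length (darts X)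
  darts-lower = ≤-trans (+-mono-≤ from-≥ from-≥) (≤-trans
    (≤-reflexive (sym (trans (ListP.length-++ from) (cong (_+_ (length from)) (ListP.length-map rev from)))))
    (distinct-⊆⇒length≤ both-distinct both-⊆))
    where
    from-≥ : length (select (badᵇ G)) * 3 ≤ length from
    from-≥ = dartsFrom-≥ X 3 (select (badᵇ G)) (λ v∈ → B-deg (∈-select⁻ (badᵇ G) v∈))
  cover : n ≤ isolated X + length (select (badᵇ G)) + length (select heavy)
  cover = cover₃ (isolatedᵇ X) (badᵇ G) heavy which
    where
    which : ∀ v → isolatedᵇ X v ≡ true ⊎ badᵇ G v ≡ true ⊎ heavy v ≡ true
    which v with isolated? X v
    ... | inj₁ iso = inj₁ (isolatedᵇ⁺ X iso)
    ... | inj₂ (u , e) with ends e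
    ...   | inj₁ (b , _) = inj₂ (inj₁ b)
    ...   | inj₂ (h , _) = inj₂ (inj₂ h)
  arith : ∀ L H i D → D + 4 * i ≤ 4 * n + 8 * k → L * 3 + L * 3 ≤ D → n ≤ i + L + H → L ≤ 2 * H + 4 * k
  arith L H i D p q r = *-cancelˡ-≤ 2 (+-cancelʳ-≤ (4 * L + 4 * i) _ _ (≤-trans (≤-reflexive (l₁ L i)) (≤-trans (+-monoˡ-≤ (4 * i) q)
    (≤-trans p (≤-trans (+-monoˡ-≤ (8 * k) (*-monoʳ-≤ 4 r)) (≤-reflexive (l₂ i L H k)))))))
    where
    l₁ : ∀ L i → 2 * L + (4 * L + 4 * i) ≡ L * 3 + L * 3 + 4 * i
    l₁ = solve-∀
    l₂ : ∀ i L H k → 4 * (i + L + H) + 8 * k ≡ 2 * (2 * H + 4 * k) + (4 * L + 4 * i)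
    l₂ = solve-∀

-- With D darts, at most D/30 vertices have degree 30 or more and at most 2D/240 + 4k are bad,
-- together D/24 + 4k. As D is at most 14n + 12k, a quarter of the vertices is left when n is at
-- least 32k.
light-count : {G : Graph n} → GenusClass k G → 32 * k ≤ n → 2 * n ≤ 8 * length (select (lightᵇ G))
light-count {n} {k} {G} gc 32k≤n = arith (length (select (highᵇ G 30))) (length (select (badᵇ G))) (length (select (lightᵇ G)))
    (length (select (highᵇ G 240))) (length (darts G)) (darts-≤ {k = k} gc) (high-count G 30) (high-count G 240) (bad-count {k = k} gc)
    (cover₃ (highᵇ G 30) (badᵇ G) (lightᵇ G) which)
  where
  which : ∀ v → highᵇ G 30 v ≡ true ⊎ badᵇ G v ≡ true ⊎ lightᵇ G v ≡ true
  which v = go (highᵇ G 30 v) (badᵇ G v) refl refl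
    where
    go : ∀ a b → highᵇ G 30 v ≡ a → badᵇ G v ≡ b → highᵇ G 30 v ≡ true ⊎ badᵇ G v ≡ true ⊎ lightᵇ G v ≡ true
    go true _ p _ = inj₁ p
    go false true _ q = inj₂ (inj₁ q)
    go false false p q = inj₂ (inj₂ (cong₂ (λ a b → not a ∧ not b) p q))
  arith : ∀ a b c h D → D ≤ 14 * n + 12 * k → a * 30 ≤ D → h * 240 ≤ D → b ≤ 2 * h + 4 * k → n ≤ a + b + c → 2 * n ≤ 8 * c
  arith a b c h D dn p q r s = *-cancelˡ-≤ 15 (+-cancelʳ-≤ (4 * D + D + 480 * k) _ _ (≤-trans small (≤-trans (*-monoʳ-≤ 120 s)
      (≤-trans (≤-reflexive (l₂ a b c)) (≤-trans (+-monoʳ-≤ (120 * c) (+-mono-≤ (*-monoʳ-≤ 4 p) (≤-trans (*-monoʳ-≤ 120 r)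
        (≤-trans (≤-reflexive (l₃ h k)) (+-monoˡ-≤ (480 * k) q))))) (≤-reflexive (l₄ c D k)))))))
    where
    l₂ : ∀ a b c → 120 * (a + b + c) ≡ 120 * c + (4 * (a * 30) + 120 * b)
    l₂ = solve-∀
    l₃ : ∀ h k → 120 * (2 * h + 4 * k) ≡ h * 240 + 480 * k
    l₃ = solve-∀
    l₄ : ∀ c D k → 120 * c + (4 * D + (D + 480 * k)) ≡ 15 * (8 * c) + (4 * D + D + 480 * k)
    l₄ = solve-∀
    l₅ : ∀ n k → 15 * (2 * n) + (5 * (14 * n + 12 * k) + 480 * k) ≡ 100 * n + 540 * k
    l₅ = solve-∀
    l₆ : ∀ n k → 100 * n + 540 * k + 100 * k ≡ 100 * n + 20 * (32 * k)
    l₆ = solve-∀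
    l₇ : ∀ D → 4 * D + D ≡ 5 * D
    l₇ = solve-∀
    l₈ : ∀ n → 100 * n + 20 * n ≡ 120 * n
    l₈ = solve-∀
    small : 15 * (2 * n) + (4 * D + D + 480 * k) ≤ 120 * n
    small = ≤-trans (+-monoʳ-≤ (15 * (2 * n)) (+-monoˡ-≤ (480 * k) (≤-trans (≤-reflexive (l₇ D)) (*-monoʳ-≤ 5 dn))))
      (≤-trans (≤-reflexive (l₅ n k)) (≤-trans (m≤m+n _ (100 * k)) (≤-trans (≤-reflexive (l₆ n k))
        (≤-trans (+-monoʳ-≤ (100 * n) (*-monoʳ-≤ 20 32k≤n)) (≤-reflexive (l₈ n))))))

-- Freeing a vertex, and the graphs it may come from

upd-undo : {G : Graph n} → IsSimple G → (u v : Fin n) (b c : Bool) → adj G u v ≡ c → upd (upd G u v b) u v c ≡ G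
upd-undo {G = G} simple u v b c e = graph-ext same
  where
  same : ∀ i j → adj (upd (upd G u v b) u v c) i j ≡ adj G i j
  same i j with samePair? u v i j
  ... | yes p@(inj₁ (refl , refl)) = trans (upd-hit (upd G u v b) u v c p) (sym e)
  ... | yes p@(inj₂ (refl , refl)) = trans (upd-hit (upd G u v b) u v c p) (trans (sym e) (proj₁ simple u v))
  ... | no p = trans (upd-miss (upd G u v b) u v c p) (upd-miss G u v b p)

-- An edge v w was replaced by u w, which may have been present before.
undo : ℕ → Fin n → Fin n → Graph n → List (Graph n)
undo b u v R = concatMap (λ w → upd R v w true ∷ upd (upd R v w true) u w false ∷ []) (take b (nbrs R u))

-- `R` itself is kept at every level because sliding stops once `u` is the only neighbour of `v`,
-- possibly before `m` moves.
undos : ℕ → ℕ → Fin n → Fin n → Graph n → List (Graph n)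
undos b zero u v R = R ∷ []
undos b (suc m) u v R = R ∷ concatMap (undo b u v) (undos b m u v R)

undoBound : ℕ → ℕ → ℕ
undoBound b zero = 1
undoBound b (suc m) = 1 + undoBound b m * (b * 2)

length-undo : (b : ℕ) (u v : Fin n) (R : Graph n) → length (undo b u v R) ≤ b * 2
length-undo b u v R = ≤-trans (length-concatMap-≤ _ (take b (nbrs R u)) 2 (λ _ → ≤-refl))
  (*-monoˡ-≤ 2 (≤-trans (≤-reflexive (ListP.length-take b (nbrs R u))) (m⊓n≤m b (deg R u))))

length-undos : (b m : ℕ) (u v : Fin n) (R : Graph n) → length (undos b m u v R) ≤ undoBound b m
length-undos b zero u v R = ≤-refl
length-undos b (suc m) u v R = s≤s (≤-trans (length-concatMap-≤ (undo b u v) (undos b m u v R) (b * 2) (λ {G} _ → length-undo b u v G))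
  (*-monoˡ-≤ (b * 2) (length-undos b m u v R)))

record Slid (k : ℕ) (G : Graph n) (v u : Fin n) (b m : ℕ) : Set where
  field
    slid : Graph n
    slid-class : GenusClass k slid
    slid-edge : E slid v u
    slid-only : ∀ {x} → E slid v x → x ≡ u
    slid-undo : G ∈ undos b m u v slid
    slid-deg : deg G u ≤ deg slid u
    slid-far : ∀ {x} → x ≢ v → x ≢ u → ¬ E G v x → ∀ y → adj slid x y ≡ adj G x y

open Slid

deg≤⇒take : (G : Graph n) {b : ℕ} {v x : Fin n} → deg G v ≤ b → x ∈ nbrs G v → x ∈ take b (nbrs G v)
deg≤⇒take G {b} {v} le x∈ = subst (_ ∈_) (sym (ListP.take-all b (nbrs G v) le)) x∈

-- One move concerns the neighbour `w` that follows `u` in the rotation at `v`: the chord `u w` is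
-- drawn across the corner, then `v w` is deleted. The degree of `v` falls by one and that of `u`
-- grows by at most one, so the sum `deg G u + m` stays below `b`.
slide : ∀ m b {G : Graph n} {v u} → GenusClass k G → E G v u → deg G v ≤ suc m → deg G u + m ≤ b → Slid k G v u b m
slide {n} {k} m b {G} {v} {u} gc@(simple , ρ , isRot , p) vu dv du with ρ v u FinP.≟ u
... | yes fix = record
  { slid = G ; slid-class = gc ; slid-edge = vu
  ; slid-only = λ e → Faces.ρ-fixed G simple (isRot⇒rot isRot) vu fix e
  ; slid-undo = self m ; slid-deg = ≤-refl ; slid-far = λ _ _ _ _ → refl }
  where
  self : ∀ m → G ∈ undos b m u v G
  self zero = here refl
  self (suc m) = here refl
slide zero b {G} {v} {u} gc@(simple , ρ , isRot , p) vu dv du | no w≢u =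
  contradiction (≤-trans (length-two (nbrs-distinct G v) (∈-nbrs⁺ G (rot-closed (isRot⇒rot {G = G} isRot) vu)) (∈-nbrs⁺ G vu) w≢u) dv) λ { (s≤s ()) }
slide {n} {k} (suc m) b {G} {v} {u} gc@(simple , ρ , isRot , p) vu dv du | no w≢u = record
  { slid = slid rec ; slid-class = slid-class rec ; slid-edge = slid-edge rec ; slid-only = slid-only rec
  ; slid-undo = there (∈-concatMap⁺ (undo b u v) (lose (slid-undo rec) undo-G₁))
  ; slid-deg = ≤-trans deg-u-mono (slid-deg rec)
  ; slid-far = λ x≢v x≢u ¬vx y → trans (slid-far rec x≢v x≢u (¬vx ∘ vx-G₁) y) (far x≢v x≢u (λ { refl → ¬vx vw }) y) }
  where
  rot : Rot G ρ
  rot = isRot⇒rot isRot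
  open Simple G simple
  w : Fin n
  w = ρ v u
  vw : E G v w
  vw = rot-closed rot vu
  v≢u : v ≢ u
  v≢u = E⇒≢ vu
  v≢w : v ≢ w
  v≢w = E⇒≢ vw
  G₀ G₁ : Graph n
  G₀ = upd G u w true
  G₁ = upd G₀ v w false
  G₀-class : GenusClass k G₀
  G₀-class = genusClass-corner {k = k} simple isRot p vu w≢u
  vw₀ : E G₀ v w
  vw₀ = upd-true-mono G vw
  G₁-class : GenusClass k G₁
  G₁-class = genusClass-delete {k = k} vw₀ G₀-class
  keep₁ : ∀ {x y} → ¬ SamePair v w x y → adj G₁ x y ≡ adj G₀ x y
  keep₁ = upd-miss G₀ v w false
  vx-G₁ : ∀ {x} → E G₁ v x → E G v x
  vx-G₁ e with upd-E⁻ G₀ v w false e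
  ... | inj₂ (_ , e₀) with upd-true-E⁻ G e₀
  ...   | inj₂ e′ = e′
  ...   | inj₁ (inj₁ (q , _)) = ⊥-elim (v≢u q)
  ...   | inj₁ (inj₂ (q , _)) = ⊥-elim (v≢w q)
  vx≢w : ∀ {x} → E G₁ v x → x ≢ w
  vx≢w e refl = true≢false e (upd-hit G₀ v w false (inj₁ (refl , refl)))
  vu₁ : E G₁ v u
  vu₁ = trans (keep₁ λ { (inj₁ (_ , q)) → w≢u (sym q) ; (inj₂ (q , _)) → v≢w q }) (upd-true-mono G vu)
  u-not-pair : ∀ {x} → ¬ SamePair v w u x
  u-not-pair (inj₁ (q , _)) = v≢u (sym q)
  u-not-pair (inj₂ (q , _)) = w≢u (sym q)
  uw₁ : E G₁ u w
  uw₁ = trans (keep₁ u-not-pair) (upd-hit G u w true (inj₁ (refl , refl)))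
  ux-G₁ : ∀ {x} → E G₁ u x → x ∈ w ∷ nbrs G u
  ux-G₁ e with upd-true-E⁻ G (trans (sym (keep₁ u-not-pair)) e)
  ... | inj₁ (inj₁ (_ , q)) = here q
  ... | inj₁ (inj₂ (q , _)) = ⊥-elim (w≢u (sym q))
  ... | inj₂ e′ = there (∈-nbrs⁺ G e′)
  deg-v : deg G₁ v ≤ suc m
  deg-v = ≤-pred (≤-trans (distinct-⊆⇒length≤ {xs = w ∷ nbrs G₁ v}
    (All.tabulate (λ x∈ q → vx≢w (∈-nbrs⁻ G₁ x∈) (sym q)) ∷ nbrs-distinct G₁ v)
    λ { (here refl) → ∈-nbrs⁺ G vw ; (there x∈) → ∈-nbrs⁺ G (vx-G₁ (∈-nbrs⁻ G₁ x∈)) }) dv)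
  deg-u : deg G₁ u ≤ suc (deg G u)
  deg-u = distinct-⊆⇒length≤ (nbrs-distinct G₁ u) (ux-G₁ ∘ ∈-nbrs⁻ G₁)
  deg-u-mono : deg G u ≤ deg G₁ u
  deg-u-mono = distinct-⊆⇒length≤ (nbrs-distinct G u) λ x∈ → ∈-nbrs⁺ G₁ (trans (keep₁ u-not-pair) (upd-true-mono G (∈-nbrs⁻ G x∈)))
  rec : Slid k G₁ v u b m
  rec = slide m b G₁-class vu₁ deg-v (≤-trans (+-monoˡ-≤ m deg-u) (≤-trans (≤-reflexive (sym (+-suc (deg G u) m))) du))
  deg-u≤b : deg G₁ u ≤ b
  deg-u≤b = ≤-trans deg-u (≤-trans (≤-trans (s≤s (m≤m+n (deg G u) m)) (≤-reflexive (sym (+-suc (deg G u) m)))) du)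
  restored : upd G₁ v w true ≡ G₀
  restored = upd-undo (proj₁ G₀-class) v w false true vw₀
  undo-G₁ : G ∈ undo b u v G₁
  undo-G₁ = ∈-concatMap⁺ _ (lose (deg≤⇒take G₁ deg-u≤b (∈-nbrs⁺ G₁ uw₁)) (which (adj G u w) refl))
    where
    which : ∀ c → adj G u w ≡ c → G ∈ upd G₁ v w true ∷ upd (upd G₁ v w true) u w false ∷ []
    which true e = here (sym (trans restored (upd-true-id simple e)))
    which false e = there (here (sym (trans (cong (λ Z → upd Z u w false) restored) (upd-undo simple u w true false e))))
  far : ∀ {x} → x ≢ v → x ≢ u → x ≢ w → ∀ y → adj G₁ x y ≡ adj G x y
  far x≢v x≢u x≢w y = trans (keep₁ λ { (inj₁ (q , _)) → x≢v q ; (inj₂ (q , _)) → x≢w q })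
    (upd-miss G u w true λ { (inj₁ (q , _)) → x≢u q ; (inj₂ (q , _)) → x≢w q })

-- The first list serves vertices of degree at most 2: one slide, but no bound on the degree of `u`.
-- Its length is linear in that degree, so it sums to O(n). The second list serves the neighbours
-- `u` of bounded degree and has constant length.
restores : ℕ → ℕ → Fin n → Graph n → List (Graph n)
restores {n} b m v R = R ∷ concatMap (λ u → undos (2 + deg R u) 1 u v (upd R v u true) ++ undos b m u v (upd R v u true)) (allFin n)

length-concatMap-affine : (f : A → List B) {C : Set} (g : A → List C) (a c : ℕ) → (∀ x → length (f x) ≤ a * length (g x) + c) →
  ∀ xs → length (concatMap f xs) ≤ a * length (concatMap g xs) + length xs * c
length-concatMap-affine f g a c h [] = z≤n
length-concatMap-affine f g a c h (x ∷ xs) = ≤-trans (≤-reflexive (ListP.length-++ (f x)))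
  (≤-trans (+-mono-≤ (h x) (length-concatMap-affine f g a c h xs))
    (≤-trans (≤-reflexive (rearrange a (length (g x)) (length (concatMap g xs)) c (length xs)))
      (+-monoˡ-≤ (c + length xs * c) (*-monoʳ-≤ a (≤-reflexive (sym (ListP.length-++ (g x))))))))
  where
  rearrange : ∀ a p q c l → a * p + c + (a * q + l * c) ≡ a * (p + q) + (c + l * c)
  rearrange = solve-∀

-- 36 = 1 + 30 + 5: the graph itself, twice the at most 15n darts, and the constant part of the
-- first list for each `u`.
length-restores : (b m : ℕ) (v : Fin n) {R : Graph n} → GenusClass k R → 12 * k ≤ n → 1 ≤ n →
  length (restores b m v R) ≤ n * (36 + undoBound b m)
length-restores {n} {k} b m v {R} gc 12k≤n 1≤n = ≤-trans (s≤s (length-concatMap-affine _ (dartsAt R) 2 (5 + undoBound b m) each (allFin n)))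
  (arith (length (dartsFrom R (allFin n))) (length (allFin n)) (undoBound b m)
    (≤-trans (dartsFrom-≤ R (DistinctP.allFin⁺ n)) (darts-≤ {k = k} gc)) (≤-reflexive (length-allFin n)))
  where
  each : ∀ u → length (undos (2 + deg R u) 1 u v (upd R v u true) ++ undos b m u v (upd R v u true)) ≤ 2 * length (dartsAt R u) + (5 + undoBound b m)
  each u = ≤-trans (≤-reflexive (ListP.length-++ (undos (2 + deg R u) 1 u v (upd R v u true))))
    (≤-trans (+-mono-≤ (length-undos (2 + deg R u) 1 u v (upd R v u true)) (length-undos b m u v (upd R v u true)))
      (≤-reflexive (trans (rearrange (deg R u) (undoBound b m)) (cong (λ d → 2 * d + (5 + undoBound b m)) (sym (ListP.length-map (u ,_) (nbrs R u)))))))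
    where
    rearrange : ∀ d c → 1 + 1 * ((2 + d) * 2) + c ≡ 2 * d + (5 + c)
    rearrange = solve-∀
  arith : ∀ D l c → D ≤ 14 * n + 12 * k → l ≤ n → 1 + (2 * D + l * (5 + c)) ≤ n * (36 + c)
  arith D l c p q = ≤-trans (+-mono-≤ 1≤n (+-mono-≤ (*-monoʳ-≤ 2 (≤-trans p (+-monoʳ-≤ (14 * n) 12k≤n))) (*-monoˡ-≤ (5 + c) q)))
    (≤-reflexive (rearrange n c))
    where
    rearrange : ∀ n c → n + (2 * (14 * n + n) + n * (5 + c)) ≡ n * (36 + c)
    rearrange = solve-∀

record Freed (k : ℕ) (G : Graph n) (v : Fin n) : Set where
  field
    freed : Graph n
    freed-class : GenusClass k freed
    freed-isolated : Isolated freed v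
    freed-restores : G ∈ restores 267 28 v freed
    freed-far : ∀ {x} → x ≢ v → ¬ E G v x → ∀ y → adj freed x y ≡ adj G x y

open Freed

free-via : ∀ {G : Graph n} {v u b m} → (s : Slid k G v u b m) → deg G v ≤ 29 → E G v u →
  (∀ {R} → deg (slid s) u ≤ suc (deg R u) → G ∈ undos b m u v (slid s) → slid s ≡ upd R v u true → G ∈ restores 267 28 v R) → Freed k G v
free-via {n} {k} {G} {v} {u} s dv vu restore = record
  { freed = R
  ; freed-class = genusClass-delete {k = k} (slid-edge s) (slid-class s)
  ; freed-isolated = λ x → ≢true⇒false λ e → iso e
  ; freed-restores = restore deg-R (slid-undo s) (sym (upd-undo (proj₁ (slid-class s)) v u false true (slid-edge s)))
  ; freed-far = λ {x} x≢v ¬vx y → trans (upd-miss (slid s) v u false λ { (inj₁ (q , _)) → x≢v q ; (inj₂ (q , _)) → ¬vx (subst (E G v) (sym q) vu) })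
      (slid-far s x≢v (λ { refl → ¬vx vu }) ¬vx y) }
  where
  R : Graph n
  R = upd (slid s) v u false
  iso : ∀ {x} → ¬ E R v x
  iso e with upd-E⁻ (slid s) v u false e
  ... | inj₂ (¬p , e′) = ¬p (inj₁ (refl , slid-only s e′))
  deg-R : deg (slid s) u ≤ suc (deg R u)
  deg-R = distinct-⊆⇒length≤ {ys = v ∷ nbrs R u} (nbrs-distinct (slid s) u) λ {x} x∈ → member x (∈-nbrs⁻ (slid s) x∈)
    where
    member : ∀ x → E (slid s) u x → x ∈ v ∷ nbrs R u
    member x e with x FinP.≟ v
    ... | yes q = here q
    ... | no x≢v = there (∈-nbrs⁺ R (trans (upd-miss (slid s) v u false λ { (inj₁ (refl , refl)) → Simple.E-irrefl (slid s) (proj₁ (slid-class s)) (slid-edge s)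
                                                                              ; (inj₂ (_ , q)) → x≢v q }) e))

free : {G : Graph n} {v : Fin n} → GenusClass k G → Light G v → Freed k G v
free {n} {k} {G} {v} gc (dv , light) with isolated? G v
... | inj₁ iso = record { freed = G ; freed-class = gc ; freed-isolated = iso ; freed-restores = here refl ; freed-far = λ _ _ _ → refl }
... | inj₂ (u , vu) = by light
  where
  by : deg G v ≤ 2 ⊎ (∃ λ u → E G v u × deg G u ≤ 239) → Freed k G v
  -- A vertex of degree at most 29 needs at most 28 slides, during which the degree of `u` grows
  -- from at most 239 to at most 267.
  by (inj₂ (u , vu , du)) = free-via (slide 28 267 gc vu dv (+-monoˡ-≤ 28 du)) dv vu λ {R} _ G∈ eq →
    there (∈-concatMap⁺ _ (lose (∈-allFin u) (∈-++⁺ʳ (undos (2 + deg R u) 1 u v (upd R v u true)) (subst (λ Z → G ∈ undos 267 28 u v Z) eq G∈))))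
  by (inj₁ dv≤2) = f
    where
    b : ℕ
    b = deg G u + 1
    s : Slid k G v u b 1
    s = slide 1 b gc vu dv≤2 ≤-refl
    f : Freed k G v
    -- The bound `b` refers to `G`, which is unknown when undoing; it is enlarged to `2 + deg R u`,
    -- which is read off from `R`.
    f = free-via s dv vu λ {R} dR G∈ eq →
      there (∈-concatMap⁺ _ (lose (∈-allFin u) (∈-++⁺ˡ (subst (λ Z → G ∈ undos (2 + deg R u) 1 u v Z) eq (widen {b} {2 + deg R u} {slid s} (bound {R} dR) G∈)))))
      where
      bound : ∀ {R} → deg (slid s) u ≤ suc (deg R u) → b ≤ 2 + deg R u
      bound dR = ≤-trans (≤-reflexive (+-comm (deg G u) 1)) (s≤s (≤-trans (slid-deg s) dR))
      take-⊆ : ∀ {a c} {xs : List (Fin n)} {x} → a ≤ c → x ∈ take a xs → x ∈ take c xs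
      take-⊆ {suc a} {suc c} {x ∷ xs} (s≤s le) (here p) = here p
      take-⊆ {suc a} {suc c} {x ∷ xs} (s≤s le) (there p) = there (take-⊆ le p)
      undo-⊆ : ∀ {a c R} → a ≤ c → G ∈ undo a u v R → G ∈ undo c u v R
      undo-⊆ {a} {c} {R} le G∈ with find (∈-concatMap⁻ _ {xs = take a (nbrs R u)} G∈)
      ... | w , w∈ , p = ∈-concatMap⁺ _ (lose (take-⊆ le w∈) p)
      widen : ∀ {a c R} → a ≤ c → G ∈ undos a 1 u v R → G ∈ undos c 1 u v R
      widen le (here p) = here p
      widen {a} {c} {R} le (there p) = there (∈-++⁺ˡ (undo-⊆ {a} {c} {R} le (one p)))
        where
        one : G ∈ concatMap (undo a u v) (R ∷ []) → G ∈ undo a u v R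
        one p with ∈-concatMap⁻ (undo a u v) {xs = R ∷ []} p
        ... | here q = q

-- Determinants of integer matrices

Row : ℕ → Set
Row n = Fin n → ℤ

sgn : Fin n → ℤ
sgn j = sign (toℕ j)

minor : (Fin (suc m) → Row (suc n)) → Fin (suc n) → Fin m → Row n
minor M j a c = M (suc a) (punchIn j c)

detℤ : (n : ℕ) → (Fin n → Row n) → ℤ
detℤ zero M = 1ℤ
detℤ (suc n) M = sum λ j → sgn j ℤ.* (M zero j ℤ.* detℤ n (minor M j))

_[_≔_] : (Fin n → A) → Fin n → A → Fin n → A
(M [ zero ≔ r ]) zero = r
(M [ zero ≔ r ]) (suc a) = M (suc a)
(M [ suc i ≔ r ]) zero = M zero
(M [ suc i ≔ r ]) (suc a) = ((M ∘ suc) [ i ≔ r ]) a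

set-hit : (M : Fin n → A) (i : Fin n) {r : A} → (M [ i ≔ r ]) i ≡ r
set-hit M zero = refl
set-hit M (suc i) = set-hit (M ∘ suc) i

set-miss : (M : Fin n → A) {i a : Fin n} {r : A} → a ≢ i → (M [ i ≔ r ]) a ≡ M a
set-miss M {zero} {zero} p = ⊥-elim (p refl)
set-miss M {zero} {suc a} p = refl
set-miss M {suc i} {zero} p = refl
set-miss M {suc i} {suc a} p = set-miss (M ∘ suc) (p ∘ cong suc)

set-map : (g : A → B) (M : Fin n → A) (i : Fin n) (r : A) (a : Fin n) → g ((M [ i ≔ r ]) a) ≡ ((g ∘ M) [ i ≔ g r ]) a
set-map g M zero r zero = refl
set-map g M zero r (suc a) = refl
set-map g M (suc i) r zero = refl
set-map g M (suc i) r (suc a) = set-map g (M ∘ suc) i r a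

combine : ℤ → Row n → ℤ → Row n → Row n
combine x r y s c = x ℤ.* r c ℤ.+ y ℤ.* s c

drop-one : ∀ a b → 1ℤ ℤ.* a ℤ.+ b ≡ a ℤ.+ b
drop-one a b = cong (ℤ._+ b) (ℤP.*-identityˡ a)

-- For square matrices such a function is determined by its value at the identity matrix
-- (`det-unique`). Multiplicativity of `detℤ` is obtained from this.
record Alternating {m n} (D : (Fin m → Row n) → ℤ) : Set where
  field
    ext : ∀ {M N} → (∀ a c → M a c ≡ N a c) → D M ≡ D N
    lin : ∀ M i x r y s → D (M [ i ≔ combine x r y s ]) ≡ x ℤ.* D (M [ i ≔ r ]) ℤ.+ y ℤ.* D (M [ i ≔ s ])
    alt : ∀ M {i j} → i ≢ j → (∀ c → M i c ≡ M j c) → D M ≡ 0ℤ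

  ext-rows : ∀ {M N} → (∀ a → M a ≡ N a) → D M ≡ D N
  ext-rows h = ext λ a c → cong (λ r → r c) (h a)

  lin-row : ∀ M i r s t x → (∀ c → M i c ≡ combine 1ℤ r x s c) → (∀ a → a ≢ i → ∀ c → M a c ≡ t a c) →
    D M ≡ D (t [ i ≔ r ]) ℤ.+ x ℤ.* D (t [ i ≔ s ])
  lin-row M i r s t x hi ha = trans (ext pointwise) (trans (lin t i 1ℤ r x s) (drop-one (D (t [ i ≔ r ])) (x ℤ.* D (t [ i ≔ s ]))))
    where
    pointwise : ∀ a c → M a c ≡ (t [ i ≔ combine 1ℤ r x s ]) a c
    pointwise a c with a FinP.≟ i
    ... | yes refl = trans (hi c) (cong (λ q → q c) (sym (set-hit t i)))
    ... | no p = trans (ha a p c) (cong (λ q → q c) (sym (set-miss t p)))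

  -- With the sum of the two rows in both places the value is 0; expanding, the two mixed terms are
  -- all that survives.
  swap : ∀ {M N i j} → i ≢ j → (∀ c → N i c ≡ M j c) → (∀ c → N j c ≡ M i c) → (∀ a → a ≢ i → a ≢ j → ∀ c → N a c ≡ M a c) →
    D N ≡ - D M
  swap {M} {N} {i} {j} i≢j Ni Nj Na = solve (D M) (D N) (trans (cong₂ ℤ._+_ (sym DM) (sym DN)) total)
    where
    u v : Row n
    u = M i
    v = M j
    at : Row n → Row n → Fin m → Row n
    at r s = (M [ i ≔ r ]) [ j ≔ s ]
    at-i : ∀ r s → at r s i ≡ r
    at-i r s = trans (set-miss (M [ i ≔ r ]) i≢j) (set-hit M i)
    at-j : ∀ r s → at r s j ≡ s
    at-j r s = set-hit (M [ i ≔ r ]) j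
    at-a : ∀ r s {a} → a ≢ i → a ≢ j → at r s a ≡ M a
    at-a r s p q = trans (set-miss (M [ i ≔ r ]) q) (set-miss M p)
    both : ∀ {r s K} → (∀ c → K i c ≡ r c) → (∀ c → K j c ≡ s c) → (∀ a → a ≢ i → a ≢ j → ∀ c → K a c ≡ M a c) → D (at r s) ≡ D K
    both {r} {s} {K} hi hj ha = ext pointwise
      where
      pointwise : ∀ a c → at r s a c ≡ K a c
      pointwise a c with a FinP.≟ i | a FinP.≟ j
      ... | yes refl | _ = trans (cong (λ q → q c) (at-i r s)) (sym (hi c))
      ... | no p | yes refl = trans (cong (λ q → q c) (at-j r s)) (sym (hj c))
      ... | no p | no q = trans (cong (λ q → q c) (at-a r s p q)) (sym (ha a p q c))
    DM : D (at u v) ≡ D M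
    DM = both (λ _ → refl) (λ _ → refl) (λ _ _ _ _ → refl)
    DN : D (at v u) ≡ D N
    DN = both Ni Nj Na
    w : Row n
    w = combine 1ℤ u 1ℤ v
    same : ∀ r → D (at r r) ≡ 0ℤ
    same r = alt (at r r) i≢j (λ c → cong (λ q → q c) (trans (at-i r r) (sym (at-j r r))))
    on-i : ∀ s → D (at w s) ≡ D (at u s) ℤ.+ D (at v s)
    on-i s = trans (lin-row (at w s) i u v (at u s) 1ℤ (λ c → cong (λ q → q c) (at-i w s))
        (λ a p c → rest a p c))
      (cong₂ ℤ._+_ (ext-rows (λ a → over u a)) (trans (ℤP.*-identityˡ _) (ext-rows (λ a → over v a))))
      where
      rest : ∀ a → a ≢ i → ∀ c → at w s a c ≡ at u s a c
      rest a p c with a FinP.≟ j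
      ... | yes refl = cong (λ q → q c) (trans (at-j w s) (sym (at-j u s)))
      ... | no q = cong (λ q → q c) (trans (at-a w s p q) (sym (at-a u s p q)))
      over : ∀ r a → (at u s [ i ≔ r ]) a ≡ at r s a
      over r a with a FinP.≟ i | a FinP.≟ j
      ... | yes refl | _ = trans (set-hit (at u s) i) (sym (at-i r s))
      ... | no p | yes refl = trans (set-miss (at u s) p) (trans (at-j u s) (sym (at-j r s)))
      ... | no p | no q = trans (set-miss (at u s) p) (trans (at-a u s p q) (sym (at-a r s p q)))
    on-j : ∀ r → D (at r w) ≡ D (at r u) ℤ.+ D (at r v)
    on-j r = trans (lin (M [ i ≔ r ]) j 1ℤ u 1ℤ v) (cong₂ ℤ._+_ (ℤP.*-identityˡ (D (at r u))) (ℤP.*-identityˡ (D (at r v))))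
    total : D (at u v) ℤ.+ D (at v u) ≡ 0ℤ
    total = trans (sym (trans (trans (on-i w) (cong₂ ℤ._+_ (on-j u) (on-j v)))
      (trans (cong₂ ℤ._+_ (cong (ℤ._+ D (at u v)) (same u)) (cong (ℤ._+_ (D (at v u))) (same v)))
        (cong₂ ℤ._+_ (ℤP.+-identityˡ (D (at u v))) (ℤP.+-identityʳ (D (at v u))))))) (same w)
    solve : ∀ a b → a ℤ.+ b ≡ 0ℤ → b ≡ - a
    solve a b h = trans (sym (trans (cong (ℤ._+ b) (ℤP.+-inverseˡ a)) (ℤP.+-identityˡ b))) (trans (ℤP.+-assoc (- a) a b)
      (trans (cong (ℤ._+_ (- a)) h) (ℤP.+-identityʳ (- a))))

open Alternating

sum-zero : (f : Fin n → ℤ) → (∀ j → f j ≡ 0ℤ) → sum f ≡ 0ℤ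
sum-zero {n} f h = trans (sum-cong-≗ h) (sum-replicate-zero n)

detℤ-cong : ∀ n {M N : Fin n → Row n} → (∀ a c → M a c ≡ N a c) → detℤ n M ≡ detℤ n N
detℤ-cong zero h = refl
detℤ-cong (suc n) h = sum-cong-≗ λ j → cong₂ (λ p q → sgn j ℤ.* (p ℤ.* q)) (h zero j) (detℤ-cong n λ a c → h (suc a) (punchIn j c))

-- Two columns j < k are removed in either order: first j, then k (as an index among the
-- remaining columns), or first k, then j.
other : Fin (suc n) → Fin n → Fin n
other zero (zero {n}) = zero
other zero (suc l) = zero
other (suc j) zero = j
other (suc j) (suc l) = suc (other j l)

punchIn-other : (j : Fin (suc n)) (l : Fin n) → punchIn (punchIn j l) (other j l) ≡ j
punchIn-other zero zero = refl
punchIn-other zero (suc l) = refl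
punchIn-other (suc j) zero = refl
punchIn-other (suc j) (suc l) = cong suc (punchIn-other j l)

punchIn-exchange : (j : Fin (suc (suc n))) (l : Fin (suc n)) (c : Fin n) →
  punchIn j (punchIn l c) ≡ punchIn (punchIn j l) (punchIn (other j l) c)
punchIn-exchange zero zero c = refl
punchIn-exchange zero (suc l) c = refl
punchIn-exchange (suc j) zero c = refl
punchIn-exchange (suc j) (suc l) zero = refl
punchIn-exchange (suc j) (suc l) (suc c) = cong suc (punchIn-exchange j l c)

sgn-other : (j : Fin (suc n)) (l : Fin n) → sgn (punchIn j l) ℤ.* sgn (other j l) ≡ - (sgn j ℤ.* sgn l)
sgn-other zero zero = refl
sgn-other zero (suc l) = neg (sgn l)
  where
  neg : ∀ a → - - a ℤ.* 1ℤ ≡ - (1ℤ ℤ.* - a)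
  neg = solveℤ-∀
sgn-other (suc j) zero = neg (sgn j)
  where
  neg : ∀ a → 1ℤ ℤ.* a ≡ - (- a ℤ.* 1ℤ)
  neg = solveℤ-∀
sgn-other (suc j) (suc l) = trans (neg (sgn (punchIn j l)) (sgn (other j l))) (trans (sgn-other j l) (cong -_ (sym (neg (sgn j) (sgn l)))))
  where
  neg : ∀ a b → - a ℤ.* - b ≡ a ℤ.* b
  neg = solveℤ-∀

-- A pair `(j , l)` stands for removing column `j` and then column `punchIn j l`. Its image under
-- the substitution removes the same columns in the opposite order, so the index pairs are merely
-- permuted.
sum-other : (h : Fin (suc n) → Fin n → ℤ) → sum (λ j → sum (h j)) ≡ sum (λ j → sum (λ l → h (punchIn j l) (other j l)))
sum-other {zero} h = refl
sum-other {suc n} h = begin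
  sum (h zero) ℤ.+ sum (λ j → h (suc j) zero ℤ.+ sum (λ l → h (suc j) (suc l)))
    ≡⟨ cong (ℤ._+_ (sum (h zero))) (∑-distrib-+ (λ j → h (suc j) zero) (λ j → sum (λ l → h (suc j) (suc l)))) ⟩
  sum (h zero) ℤ.+ (sum (λ j → h (suc j) zero) ℤ.+ sum (λ j → sum (λ l → h (suc j) (suc l))))
    ≡⟨ cong (λ a → sum (h zero) ℤ.+ (sum (λ j → h (suc j) zero) ℤ.+ a)) (sum-other (λ j l → h (suc j) (suc l))) ⟩
  sum (h zero) ℤ.+ (sum (λ j → h (suc j) zero) ℤ.+ rest)
    ≡⟨ exchange (sum (h zero)) (sum (λ j → h (suc j) zero)) rest ⟩
  sum (λ j → h (suc j) zero) ℤ.+ (sum (h zero) ℤ.+ rest)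
    ≡⟨ cong₂ ℤ._+_ (sum-cong-≗ first) (sym (∑-distrib-+ (h zero) (λ j → sum (λ l → h (suc (punchIn j l)) (suc (other j l)))))) ⟩
  sum (λ l → h (suc l) (other zero l)) ℤ.+ sum (λ j → h zero j ℤ.+ sum (λ l → h (suc (punchIn j l)) (suc (other j l)))) ∎
  where
  open ≡-Reasoning
  rest : ℤ
  rest = sum (λ j → sum (λ l → h (suc (punchIn j l)) (suc (other j l))))
  exchange : ∀ a b c → a ℤ.+ (b ℤ.+ c) ≡ b ℤ.+ (a ℤ.+ c)
  exchange = solveℤ-∀
  first : ∀ l → h (suc l) zero ≡ h (suc l) (other zero l)
  first zero = refl
  first (suc l) = refl

≡-neg⇒≡0 : ∀ x → x ≡ - x → x ≡ 0ℤ
≡-neg⇒≡0 (+ zero) _ = refl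
≡-neg⇒≡0 (+ suc _) ()
≡-neg⇒≡0 -[1+ _ ] ()

sum-neg : (f : Fin n → ℤ) → sum (λ j → - f j) ≡ - sum f
sum-neg {zero} f = refl
sum-neg {suc n} f = trans (cong (ℤ._+_ (- f zero)) (sum-neg (f ∘ suc))) (sym (ℤP.neg-distrib-+ (f zero) (sum (f ∘ suc))))

-- In the expansion along both rows, the two orders of removing the same two columns give opposite
-- terms. Hence the determinant equals its own negative.
detℤ-equal-01 : ∀ n (M : Fin (suc (suc n)) → Row (suc (suc n))) → (∀ c → M zero c ≡ M (suc zero) c) → detℤ (suc (suc n)) M ≡ 0ℤ
detℤ-equal-01 n M eq = trans double (≡-neg⇒≡0 (sum (λ j → sum (term j)))
    (trans (sum-other term) (trans (sum-cong-≗ λ j → trans (sum-cong-≗ (flip j)) (sum-neg (term j))) (sum-neg (λ j → sum (term j))))))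
  where
  D : Fin (suc (suc n)) → Fin (suc n) → ℤ
  D j l = detℤ n (minor (minor M j) l)
  term : Fin (suc (suc n)) → Fin (suc n) → ℤ
  term j l = sgn j ℤ.* (M zero j ℤ.* (sgn l ℤ.* (M (suc zero) (punchIn j l) ℤ.* D j l)))
  double : detℤ (suc (suc n)) M ≡ sum (λ j → sum (term j))
  double = sum-cong-≗ λ j → trans (cong (sgn j ℤ.*_) (*-distribˡ-sum (M zero j) (λ l → sgn l ℤ.* (M (suc zero) (punchIn j l) ℤ.* D j l))))
    (*-distribˡ-sum (sgn j) (λ l → M zero j ℤ.* (sgn l ℤ.* (M (suc zero) (punchIn j l) ℤ.* D j l))))
  flip : ∀ j l → term (punchIn j l) (other j l) ≡ - term j l
  flip j l = begin
    sgn j′ ℤ.* (M zero j′ ℤ.* (sgn l′ ℤ.* (M (suc zero) (punchIn j′ l′) ℤ.* D j′ l′)))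
      ≡⟨ cong₂ (λ p q → sgn j′ ℤ.* (p ℤ.* (sgn l′ ℤ.* (q ℤ.* D j′ l′)))) (eq j′) (trans (cong (M (suc zero)) (punchIn-other j l)) (sym (eq j))) ⟩
    sgn j′ ℤ.* (M (suc zero) j′ ℤ.* (sgn l′ ℤ.* (M zero j ℤ.* D j′ l′)))
      ≡⟨ group (sgn j′) (M (suc zero) j′) (sgn l′) (M zero j) (D j′ l′) ⟩
    (sgn j′ ℤ.* sgn l′) ℤ.* (M zero j ℤ.* (M (suc zero) j′ ℤ.* D j′ l′))
      ≡⟨ cong₂ (λ p q → p ℤ.* (M zero j ℤ.* (M (suc zero) j′ ℤ.* q))) (sgn-other j l) (sym (detℤ-cong n λ a c → cong (M (suc (suc a))) (punchIn-exchange j l c))) ⟩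
    - (sgn j ℤ.* sgn l) ℤ.* (M zero j ℤ.* (M (suc zero) j′ ℤ.* D j l))
      ≡⟨ ungroup (sgn j) (sgn l) (M zero j) (M (suc zero) j′) (D j l) ⟩
    - term j l ∎
    where
    open ≡-Reasoning
    j′ = punchIn j l
    l′ = other j l
    group : ∀ a b c d e → a ℤ.* (b ℤ.* (c ℤ.* (d ℤ.* e))) ≡ (a ℤ.* c) ℤ.* (d ℤ.* (b ℤ.* e))
    group = solveℤ-∀
    ungroup : ∀ a b c d e → - (a ℤ.* b) ℤ.* (c ℤ.* (d ℤ.* e)) ≡ - (a ℤ.* (c ℤ.* (b ℤ.* (d ℤ.* e))))
    ungroup = solveℤ-∀

-- The row equal to row 0 is exchanged with row 1. This takes place inside the minors along row 0,
-- where the smaller determinant is already known to be alternating.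
detℤ-equal-0k : ∀ {n} → Alternating (detℤ n) → (M : Fin (suc n) → Row (suc n)) (k : Fin n) → (∀ c → M zero c ≡ M (suc k) c) → detℤ (suc n) M ≡ 0ℤ
detℤ-equal-0k {suc n} _ M zero eq = detℤ-equal-01 n M eq
detℤ-equal-0k {suc n} alternating M (suc k) eq = neg-zero (trans (sym (detℤ-equal-01 n N eq)) N≡-M)
  where
  neg-zero : ∀ {x} → 0ℤ ≡ - x → x ≡ 0ℤ
  neg-zero {+ zero} _ = refl
  second-row : Fin (suc (suc n))
  second-row = suc zero
  N : Fin (suc (suc n)) → Row (suc (suc n))
  N = (M [ second-row ≔ M (suc (suc k)) ]) [ suc (suc k) ≔ M second-row ]
  tail : Fin n → Row (suc (suc n))
  tail a = M (suc (suc a))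
  N≡-M : detℤ (suc (suc n)) N ≡ - detℤ (suc (suc n)) M
  N≡-M = trans (sum-cong-≗ λ j → trans (cong (λ d → sgn j ℤ.* (M zero j ℤ.* d))
      (swap alternating {minor M j} {minor N j} {zero} {suc k} (λ ()) (λ c → refl)
        (λ c → cong (λ q → q (punchIn j c)) (set-hit tail k))
        (λ { zero p _ _ → ⊥-elim (p refl) ; (suc a) _ q c → cong (λ r → r (punchIn j c)) (set-miss tail (q ∘ cong suc)) })))
      (neg (sgn j) (M zero j) (detℤ (suc n) (minor M j)))) (sum-neg (λ j → sgn j ℤ.* (M zero j ℤ.* detℤ (suc n) (minor M j))))
    where
    neg : ∀ a b c → a ℤ.* (b ℤ.* - c) ≡ - (a ℤ.* (b ℤ.* c))
    neg = solveℤ-∀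

sum-lin : ∀ {n} (x y : ℤ) (f g : Fin n → ℤ) → sum (λ j → x ℤ.* f j ℤ.+ y ℤ.* g j) ≡ x ℤ.* sum f ℤ.+ y ℤ.* sum g
sum-lin x y f g = trans (∑-distrib-+ (λ j → x ℤ.* f j) (λ j → y ℤ.* g j)) (cong₂ ℤ._+_ (sym (*-distribˡ-sum x f)) (sym (*-distribˡ-sum y g)))

detℤ-alternating : ∀ n → Alternating (detℤ n)
detℤ-alternating n .ext = detℤ-cong n
detℤ-alternating (suc n) .lin M zero x r y s = trans (sum-cong-≗ λ j → expand (sgn j) x (r j) y (s j) (detℤ n (minor M j)))
    (sum-lin x y (λ j → sgn j ℤ.* (r j ℤ.* detℤ n (minor M j))) (λ j → sgn j ℤ.* (s j ℤ.* detℤ n (minor M j))))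
  where
  expand : ∀ e x a y b d → e ℤ.* ((x ℤ.* a ℤ.+ y ℤ.* b) ℤ.* d) ≡ x ℤ.* (e ℤ.* (a ℤ.* d)) ℤ.+ y ℤ.* (e ℤ.* (b ℤ.* d))
  expand = solveℤ-∀
detℤ-alternating (suc n) .lin M (suc i) x r y s = trans
    (sum-cong-≗ λ j → trans (cong (λ d → sgn j ℤ.* (M zero j ℤ.* d)) (minors j)) (expand (sgn j) x y (M zero j) (part r j) (part s j)))
    (sum-lin x y (λ j → sgn j ℤ.* (M zero j ℤ.* part r j)) (λ j → sgn j ℤ.* (M zero j ℤ.* part s j)))
  where
  part : Row (suc n) → Fin (suc n) → ℤ
  part r j = detℤ n (minor (M [ suc i ≔ r ]) j)
  part-set : ∀ r j → part r j ≡ detℤ n (minor M j [ i ≔ (λ c → r (punchIn j c)) ])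
  part-set r j = detℤ-cong n λ a c → cong (λ q → q c) (set-map (λ q c → q (punchIn j c)) (M ∘ suc) i r a)
  minors : ∀ j → part (combine x r y s) j ≡ x ℤ.* part r j ℤ.+ y ℤ.* part s j
  minors j = trans (part-set (combine x r y s) j) (trans (detℤ-alternating n .lin (minor M j) i x (λ c → r (punchIn j c)) y (λ c → s (punchIn j c)))
    (cong₂ (λ p q → x ℤ.* p ℤ.+ y ℤ.* q) (sym (part-set r j)) (sym (part-set s j))))
  expand : ∀ e x y m a b → e ℤ.* (m ℤ.* (x ℤ.* a ℤ.+ y ℤ.* b)) ≡ x ℤ.* (e ℤ.* (m ℤ.* a)) ℤ.+ y ℤ.* (e ℤ.* (m ℤ.* b))
  expand = solveℤ-∀
detℤ-alternating (suc n) .alt M {i} {j} i≢j eq = go i j i≢j eq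
  where
  go : ∀ i j → i ≢ j → (∀ c → M i c ≡ M j c) → detℤ (suc n) M ≡ 0ℤ
  go zero zero p _ = ⊥-elim (p refl)
  go zero (suc j) _ eq = detℤ-equal-0k (detℤ-alternating n) M j eq
  go (suc i) zero _ eq = detℤ-equal-0k (detℤ-alternating n) M i (sym ∘ eq)
  go (suc i) (suc j) p eq = sum-zero _ λ l → trans (cong (λ d → sgn l ℤ.* (M zero l ℤ.* d))
      (detℤ-alternating n .alt (minor M l) (p ∘ cong suc) (λ c → eq (punchIn l c)))) (zeros (sgn l) (M zero l))
    where
    zeros : ∀ a b → a ℤ.* (b ℤ.* 0ℤ) ≡ 0ℤ
    zeros = solveℤ-∀

-- Multiplicativity of the determinant

δ : Fin n → Row n
δ zero zero = 1ℤ
δ zero (suc _) = 0ℤ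
δ (suc i) zero = 0ℤ
δ (suc i) (suc c) = δ i c

δ-refl : (i : Fin n) → δ i i ≡ 1ℤ
δ-refl zero = refl
δ-refl (suc i) = δ-refl i

δ-≢ : {i c : Fin n} → i ≢ c → δ i c ≡ 0ℤ
δ-≢ {i = zero} {zero} p = ⊥-elim (p refl)
δ-≢ {i = zero} {suc c} p = refl
δ-≢ {i = suc i} {zero} p = refl
δ-≢ {i = suc i} {suc c} p = δ-≢ (p ∘ cong suc)

δ-sym : (i c : Fin n) → δ i c ≡ δ c i
δ-sym zero zero = refl
δ-sym zero (suc c) = refl
δ-sym (suc i) zero = refl
δ-sym (suc i) (suc c) = δ-sym i c

sum-δ : (i : Fin n) (f : Fin n → ℤ) → sum (λ k → δ i k ℤ.* f k) ≡ f i
sum-δ zero f = trans (cong (ℤ._+_ (1ℤ ℤ.* f zero)) (sum-zero (λ k → 0ℤ ℤ.* f (suc k)) (λ k → ℤP.*-zeroˡ (f (suc k)))))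
  (trans (ℤP.+-identityʳ (1ℤ ℤ.* f zero)) (ℤP.*-identityˡ (f zero)))
sum-δ (suc i) f = trans (cong (ℤ._+ rest) (ℤP.*-zeroˡ (f zero))) (trans (ℤP.+-identityˡ rest) (sum-δ i (f ∘ suc)))
  where
  rest : ℤ
  rest = sum (λ k → δ i k ℤ.* f (suc k))

stack : A → (Fin n → A) → Fin (suc n) → A
stack r T zero = r
stack r T (suc a) = T a

stack-set : (r : A) (T : Fin n → A) (i : Fin n) (s : A) (a : Fin (suc n)) → stack r (T [ i ≔ s ]) a ≡ (stack r T [ suc i ≔ s ]) a
stack-set r T i s zero = refl
stack-set r T i s (suc a) = refl

insert0 : Fin (suc n) → Row n → Row (suc n)
insert0 zero r zero = 0ℤ
insert0 zero r (suc c) = r c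
insert0 {suc n} (suc j) r zero = r zero
insert0 {suc n} (suc j) r (suc c) = insert0 j (r ∘ suc) c

insert0-cong : (j : Fin (suc n)) {r s : Row n} → (∀ c → r c ≡ s c) → ∀ c → insert0 j r c ≡ insert0 j s c
insert0-cong zero h zero = refl
insert0-cong zero h (suc c) = h c
insert0-cong {suc n} (suc j) h zero = h zero
insert0-cong {suc n} (suc j) h (suc c) = insert0-cong j (h ∘ suc) c

insert0-δ : (j : Fin (suc n)) (i : Fin n) (c : Fin (suc n)) → insert0 j (δ i) c ≡ δ (punchIn j i) c
insert0-δ zero i zero = refl
insert0-δ zero i (suc c) = refl
insert0-δ {suc n} (suc j) zero zero = refl
insert0-δ {suc n} (suc j) (suc i) zero = refl
insert0-δ {suc n} (suc j) zero (suc c) = insert0-zero j c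
  where
  insert0-zero : ∀ {n} (j : Fin (suc n)) c → insert0 {n} j (λ _ → 0ℤ) c ≡ 0ℤ
  insert0-zero zero zero = refl
  insert0-zero zero (suc c) = refl
  insert0-zero {suc n} (suc j) zero = refl
  insert0-zero {suc n} (suc j) (suc c) = insert0-zero j c
insert0-δ {suc n} (suc j) (suc i) (suc c) = insert0-δ j i c

insert0-combine : (j : Fin (suc n)) (x : ℤ) (r : Row n) (y : ℤ) (s : Row n) (c : Fin (suc n)) →
  insert0 j (combine x r y s) c ≡ combine x (insert0 j r) y (insert0 j s) c
insert0-combine zero x r y s zero = zeros x y
  where
  zeros : ∀ x y → 0ℤ ≡ x ℤ.* 0ℤ ℤ.+ y ℤ.* 0ℤ
  zeros = solveℤ-∀
insert0-combine zero x r y s (suc c) = refl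
insert0-combine {suc n} (suc j) x r y s zero = refl
insert0-combine {suc n} (suc j) x r y s (suc c) = insert0-combine j x (r ∘ suc) y (s ∘ suc) c

insert0-punchIn : (j : Fin (suc n)) (r : Row (suc n)) (c : Fin (suc n)) → r c ≡ combine 1ℤ (insert0 j (λ a → r (punchIn j a))) (r j) (δ j) c
insert0-punchIn zero r zero = eq (r zero)
  where
  eq : ∀ a → a ≡ 1ℤ ℤ.* 0ℤ ℤ.+ a ℤ.* 1ℤ
  eq = solveℤ-∀
insert0-punchIn zero r (suc c) = eq (r (suc c)) (r zero)
  where
  eq : ∀ a b → a ≡ 1ℤ ℤ.* a ℤ.+ b ℤ.* 0ℤ
  eq = solveℤ-∀
insert0-punchIn {suc n} (suc j) r zero = eq (r zero) (r (suc j))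
  where
  eq : ∀ a b → a ≡ 1ℤ ℤ.* a ℤ.+ b ℤ.* 0ℤ
  eq = solveℤ-∀
insert0-punchIn {suc n} (suc j) r (suc c) = insert0-punchIn j (r ∘ suc) c

-- Rows are exchanged one at a time; `T` is arbitrary because the other rows are a mixture of old
-- and new ones.
replace-all : (Q : (Fin n → A) → ℤ) → (∀ {S T} → (∀ a → S a ≡ T a) → Q S ≡ Q T) → (R R′ : Fin n → A) →
  (∀ T i → Q (T [ i ≔ R i ]) ≡ Q (T [ i ≔ R′ i ])) → Q R ≡ Q R′
replace-all {zero} Q ext R R′ h = ext λ ()
replace-all {suc n} Q ext R R′ h = trans (ext (λ { zero → refl ; (suc a) → refl })) (trans (h R zero)
  (trans (ext (λ { zero → refl ; (suc a) → refl })) (trans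
    (replace-all (λ T → Q (stack (R′ zero) T)) (λ e → ext λ { zero → refl ; (suc a) → e a }) (R ∘ suc) (R′ ∘ suc)
      (λ T i → trans (ext (stack-set (R′ zero) T i (R (suc i)))) (trans (h (stack (R′ zero) T) (suc i)) (sym (ext (stack-set (R′ zero) T i (R′ (suc i))))))))
    (ext (λ { zero → refl ; (suc a) → refl })))))

module _ {D : (Fin m → Row n) → ℤ} (D-alt : Alternating D) where

  zero-row : ∀ M i → D (M [ i ≔ (λ _ → 0ℤ) ]) ≡ 0ℤ
  zero-row M i = trans (ext D-alt pointwise) (trans (lin D-alt M i 0ℤ (λ _ → 0ℤ) 0ℤ (λ _ → 0ℤ)) (cong₂ ℤ._+_ (ℤP.*-zeroˡ (D (M [ i ≔ (λ _ → 0ℤ) ]))) (ℤP.*-zeroˡ (D (M [ i ≔ (λ _ → 0ℤ) ])))))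
    where
    pointwise : ∀ a c → (M [ i ≔ (λ _ → 0ℤ) ]) a c ≡ (M [ i ≔ combine 0ℤ (λ _ → 0ℤ) 0ℤ (λ _ → 0ℤ) ]) a c
    pointwise a c with a FinP.≟ i
    ... | yes refl = trans (cong (λ q → q c) (set-hit M i)) (sym (cong (λ q → q c) (set-hit M i)))
    ... | no p = trans (cong (λ q → q c) (set-miss M p)) (sym (cong (λ q → q c) (set-miss M p)))

  lin-sum : ∀ {p} (x : Fin p → ℤ) (r : Fin p → Row n) M i →
    D (M [ i ≔ (λ c → sum (λ j → x j ℤ.* r j c)) ]) ≡ sum (λ j → x j ℤ.* D (M [ i ≔ r j ]))
  lin-sum {zero} x r M i = zero-row M i
  lin-sum {suc p} x r M i = trans (ext D-alt pointwise) (trans (lin D-alt M i (x zero) (r zero) 1ℤ rest)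
    (cong (ℤ._+_ (x zero ℤ.* D (M [ i ≔ r zero ]))) (trans (ℤP.*-identityˡ (D (M [ i ≔ rest ]))) (lin-sum (x ∘ suc) (r ∘ suc) M i))))
    where
    rest : Row n
    rest c = sum (λ j → x (suc j) ℤ.* r (suc j) c)
    pointwise : ∀ a c → (M [ i ≔ (λ c → sum (λ j → x j ℤ.* r j c)) ]) a c ≡ (M [ i ≔ combine (x zero) (r zero) 1ℤ rest ]) a c
    pointwise a c with a FinP.≟ i
    ... | yes refl = trans (cong (λ q → q c) (set-hit M i)) (trans (cong (ℤ._+_ (x zero ℤ.* r zero c)) (sym (ℤP.*-identityˡ (rest c)))) (sym (cong (λ q → q c) (set-hit M i))))
    ... | no p = trans (cong (λ q → q c) (set-miss M p)) (sym (cong (λ q → q c) (set-miss M p)))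

module _ {D : (Fin (suc n) → Row (suc n)) → ℤ} (D-alt : Alternating D) where

  -- The matrix `T` bordered by the row `δ j` on top and zeros in column `j` below it. This is an
  -- alternating function of a smaller matrix, so induction applies.
  pivot : Fin (suc n) → (Fin n → Row n) → ℤ
  pivot j T = D (stack (δ j) (insert0 j ∘ T))

  pivot-alternating : ∀ j → Alternating (pivot j)
  pivot-alternating j .ext h = ext D-alt λ { zero c → refl ; (suc a) c → insert0-cong j (h a) c }
  pivot-alternating j .lin M i x r y s = trans (ext D-alt pointwise) (trans (lin D-alt (stack (δ j) (insert0 j ∘ M)) (suc i) x (insert0 j r) y (insert0 j s))
      (cong₂ (λ p q → x ℤ.* p ℤ.+ y ℤ.* q) (sym (set r)) (sym (set s))))
    where
    set : ∀ r → D (stack (δ j) (insert0 j ∘ (M [ i ≔ r ]))) ≡ D (stack (δ j) (insert0 j ∘ M) [ suc i ≔ insert0 j r ])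
    set r = ext-rows D-alt λ { zero → refl ; (suc a) → set-map (insert0 j) M i r a }
    pointwise : ∀ a c → stack (δ j) (insert0 j ∘ (M [ i ≔ combine x r y s ])) a c ≡
      (stack (δ j) (insert0 j ∘ M) [ suc i ≔ combine x (insert0 j r) y (insert0 j s) ]) a c
    pointwise zero c = refl
    pointwise (suc a) c with a FinP.≟ i
    ... | yes refl = trans (cong (λ q → insert0 j q c) (set-hit M i)) (trans (insert0-combine j x r y s c) (sym (cong (λ q → q c) (set-hit (insert0 j ∘ M) i))))
    ... | no p = trans (cong (λ q → insert0 j q c) (set-miss M p)) (sym (cong (λ q → q c) (set-miss (insert0 j ∘ M) p)))
  pivot-alternating j .alt M i≢i′ h = alt D-alt (stack (δ j) (insert0 j ∘ M)) (i≢i′ ∘ FinP.suc-injective) (insert0-cong j h)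

  -- Below the row `δ j`, column `j` can be cleared: the multiple of `δ j` split off from a lower
  -- row repeats row 0 and contributes nothing.
  pivot-minor : ∀ M j → D (M [ zero ≔ δ j ]) ≡ pivot j (minor M j)
  pivot-minor M j = trans (ext-rows D-alt λ { zero → refl ; (suc a) → refl })
    (replace-all (λ T → D (stack (δ j) T)) (λ e → ext-rows D-alt λ { zero → refl ; (suc a) → e a }) (M ∘ suc) R′ clear)
    where
    R′ : Fin n → Row (suc n)
    R′ a = insert0 j (λ c → M (suc a) (punchIn j c))
    clear : ∀ T i → D (stack (δ j) (T [ i ≔ M (suc i) ])) ≡ D (stack (δ j) (T [ i ≔ R′ i ]))
    clear T i = trans (lin-row D-alt (stack (δ j) (T [ i ≔ M (suc i) ])) (suc i) (R′ i) (δ j) (stack (δ j) T) (M (suc i) j)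
        (λ c → trans (cong (λ q → q c) (set-hit T i)) (insert0-punchIn j (M (suc i)) c)) away)
      (trans (cong₂ ℤ._+_ (sym (ext-rows D-alt (stack-set (δ j) T i (R′ i)))) (trans (cong (ℤ._*_ (M (suc i) j)) repeated) (ℤP.*-zeroʳ (M (suc i) j))))
        (ℤP.+-identityʳ (D (stack (δ j) (T [ i ≔ R′ i ])))))
      where
      away : ∀ a → a ≢ suc i → ∀ c → stack (δ j) (T [ i ≔ M (suc i) ]) a c ≡ stack (δ j) T a c
      away zero _ c = refl
      away (suc a) p c = cong (λ q → q c) (set-miss T (p ∘ cong suc))
      repeated : D (stack (δ j) T [ suc i ≔ δ j ]) ≡ 0ℤ
      repeated = alt D-alt (stack (δ j) T [ suc i ≔ δ j ]) {zero} {suc i} (λ ()) (λ c → sym (cong (λ q → q c) (set-hit T i)))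

  -- `cycle j` is the identity matrix with row `j` moved to the top. Passing from `j` to `j + 1` is
  -- one transposition and so changes the sign.
  pivot-δ : ∀ j → pivot j δ ≡ sgn j ℤ.* D δ
  pivot-δ j = go (toℕ j) j refl
    where
    cycle : Fin (suc n) → Fin (suc n) → Row (suc n)
    cycle j = stack (δ j) (λ i → δ (punchIn j i))
    pivot-cycle : ∀ j → pivot j δ ≡ D (cycle j)
    pivot-cycle j = ext D-alt λ { zero c → refl ; (suc a) c → insert0-δ j a c }
    -- The recursion is on `t`, as `inject₁ j` is not structurally smaller than `suc j`.
    go : ∀ t j → toℕ j ≡ t → pivot j δ ≡ sgn j ℤ.* D δ
    go t zero _ = trans (pivot-cycle zero) (trans (ext-rows D-alt λ { zero → refl ; (suc a) → refl }) (sym (ℤP.*-identityˡ (D δ))))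
    go (suc t) (suc j) e = trans (pivot-cycle (suc j)) (trans
      (swap D-alt {cycle (Fin.inject₁ j)} {cycle (suc j)} {zero} {suc j} (λ ())
        (λ c → cong (λ q → δ q c) (sym (after j))) (λ c → cong (λ q → δ q c) (before j)) between)
      (trans (cong -_ (trans (sym (pivot-cycle (Fin.inject₁ j))) (trans (go t (Fin.inject₁ j) (trans (FinP.toℕ-inject₁ j) (suc-injective e)))
          (cong (λ q → sign q ℤ.* D δ) (FinP.toℕ-inject₁ j)))))
        (ℤP.neg-distribˡ-* (sgn j) (D δ))))
      where
      after : ∀ {n} (j : Fin n) → punchIn (Fin.inject₁ j) j ≡ suc j
      after zero = refl
      after (suc j) = cong suc (after j)
      before : ∀ {n} (j : Fin n) → punchIn (suc j) j ≡ Fin.inject₁ j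
      before zero = refl
      before (suc j) = cong suc (before j)
      same : ∀ {n} (j a : Fin n) → a ≢ j → punchIn (suc j) a ≡ punchIn (Fin.inject₁ j) a
      same zero zero p = ⊥-elim (p refl)
      same zero (suc a) p = refl
      same (suc j) zero p = refl
      same (suc j) (suc a) p = cong suc (same j a (p ∘ cong suc))
      between : ∀ a → a ≢ zero → a ≢ suc j → ∀ c → cycle (suc j) a c ≡ cycle (Fin.inject₁ j) a c
      between zero p _ c = ⊥-elim (p refl)
      between (suc a) _ p c = cong (λ q → δ q c) (same j a (p ∘ cong suc))

det-unique : ∀ n {D : (Fin n → Row n) → ℤ} → Alternating D → ∀ M → D M ≡ detℤ n M ℤ.* D δ
det-unique zero {D} D-alt M = trans (ext-rows D-alt λ ()) (sym (ℤP.*-identityˡ (D δ)))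
det-unique (suc n) {D} D-alt M = begin
  D M
    ≡⟨ ext D-alt (λ { zero c → sym (trans (sum-cong-≗ (λ j → trans (ℤP.*-comm (M zero j) (δ j c)) (cong (ℤ._* M zero j) (δ-sym j c)))) (sum-δ c (M zero)))
                    ; (suc a) c → refl }) ⟩
  D (M [ zero ≔ (λ c → sum (λ j → M zero j ℤ.* δ j c)) ])
    ≡⟨ lin-sum D-alt (M zero) δ M zero ⟩
  sum (λ j → M zero j ℤ.* D (M [ zero ≔ δ j ]))
    ≡⟨ sum-cong-≗ (λ j → trans (cong (ℤ._*_ (M zero j)) (trans (pivot-minor D-alt M j) (trans (det-unique n (pivot-alternating D-alt j) (minor M j))
          (cong (ℤ._*_ (detℤ n (minor M j))) (pivot-δ D-alt j))))) (regroup (M zero j) (detℤ n (minor M j)) (sgn j) (D δ))) ⟩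
  sum (λ j → (sgn j ℤ.* (M zero j ℤ.* detℤ n (minor M j))) ℤ.* D δ)
    ≡⟨ sym (*-distribʳ-sum (D δ) (λ j → sgn j ℤ.* (M zero j ℤ.* detℤ n (minor M j)))) ⟩
  detℤ (suc n) M ℤ.* D δ ∎
  where
  open ≡-Reasoning
  regroup : ∀ a b c d → a ℤ.* (b ℤ.* (c ℤ.* d)) ≡ (c ℤ.* (a ℤ.* b)) ℤ.* d
  regroup = solveℤ-∀

matMul : (Fin n → Row n) → (Fin n → Row n) → Fin n → Row n
matMul A B i c = sum λ k → A i k ℤ.* B k c

detℤ-mul : ∀ n (M N : Fin n → Row n) → detℤ n (matMul M N) ≡ detℤ n M ℤ.* detℤ n N
detℤ-mul n M N = trans (det-unique n product-alternating M) (cong (ℤ._*_ (detℤ n M)) (detℤ-cong n λ i c → sum-δ i (λ k → N k c)))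
  where
  apply : Row n → Row n
  apply r c = sum λ k → r k ℤ.* N k c
  apply-combine : ∀ x r y s c → apply (combine x r y s) c ≡ combine x (apply r) y (apply s) c
  apply-combine x r y s c = trans (sum-cong-≗ λ k → distribute x (r k) y (s k) (N k c)) (sum-lin x y (λ k → r k ℤ.* N k c) (λ k → s k ℤ.* N k c))
    where
    distribute : ∀ x r y s b → (x ℤ.* r ℤ.+ y ℤ.* s) ℤ.* b ≡ x ℤ.* (r ℤ.* b) ℤ.+ y ℤ.* (s ℤ.* b)
    distribute = solveℤ-∀
  product-alternating : Alternating (λ M → detℤ n (matMul M N))
  product-alternating .ext h = detℤ-cong n λ a c → sum-cong-≗ λ k → cong (ℤ._* N k c) (h a k)
  product-alternating .lin M i x r y s = trans (detℤ-cong n pointwise) (trans (lin (detℤ-alternating n) (apply ∘ M) i x (apply r) y (apply s))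
      (cong₂ (λ p q → x ℤ.* p ℤ.+ y ℤ.* q) (sym (set r)) (sym (set s))))
    where
    set : ∀ r → detℤ n (apply ∘ (M [ i ≔ r ])) ≡ detℤ n ((apply ∘ M) [ i ≔ apply r ])
    set r = detℤ-cong n λ a c → cong (λ q → q c) (set-map apply M i r a)
    pointwise : ∀ a c → apply ((M [ i ≔ combine x r y s ]) a) c ≡ ((apply ∘ M) [ i ≔ combine x (apply r) y (apply s) ]) a c
    pointwise a c with a FinP.≟ i
    ... | yes refl = trans (cong (λ q → apply q c) (set-hit M i)) (trans (apply-combine x r y s c) (sym (cong (λ q → q c) (set-hit (apply ∘ M) i))))
    ... | no p = trans (cong (λ q → apply q c) (set-miss M p)) (sym (cong (λ q → q c) (set-miss (apply ∘ M) p)))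
  product-alternating .alt M i≢j h = alt (detℤ-alternating n) (apply ∘ M) i≢j (λ c → sum-cong-≗ λ k → cong (ℤ._* N k c) (h k))

-- Serves to show that the switching matrix `P`, whose square is 4 times the identity, has nonzero
-- determinant.
detℤ-scalar-≢0 : ∀ n → detℤ n (λ i c → + 4 ℤ.* δ i c) ≢ 0ℤ
detℤ-scalar-≢0 (suc n) e with ℤP.i*j≡0⇒i≡0∨j≡0 (+ 4) {detℤ n (λ i c → + 4 ℤ.* δ i c)} (trans (sym first) e)
  where
  first : detℤ (suc n) (λ i c → + 4 ℤ.* δ i c) ≡ + 4 ℤ.* detℤ n (λ i c → + 4 ℤ.* δ i c)
  first = trans (cong (ℤ._+_ (1ℤ ℤ.* (+ 4 ℤ.* detℤ n (λ i c → + 4 ℤ.* δ i c)))) (sum-zero (λ j → sgn (suc j) ℤ.* (0ℤ ℤ.* detℤ n (minor (λ i c → + 4 ℤ.* δ i c) (suc j))))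
      (λ j → ℤP.*-zeroʳ (sgn (suc j)))))
    (trans (ℤP.+-identityʳ (1ℤ ℤ.* (+ 4 ℤ.* detℤ n (λ i c → + 4 ℤ.* δ i c)))) (ℤP.*-identityˡ _))
... | inj₂ p = detℤ-scalar-≢0 n p

-- Evaluation of polynomials

eval : Poly → ℤ → ℤ
eval [] x = 0ℤ
eval (a ∷ p) x = a ℤ.+ x ℤ.* eval p x

eval-+ₚ : ∀ p q x → eval (p +ₚ q) x ≡ eval p x ℤ.+ eval q x
eval-+ₚ [] q x = sym (ℤP.+-identityˡ (eval q x))
eval-+ₚ (a ∷ p) [] x = sym (ℤP.+-identityʳ (eval (a ∷ p) x))
eval-+ₚ (a ∷ p) (b ∷ q) x = trans (cong (λ e → (a ℤ.+ b) ℤ.+ x ℤ.* e) (eval-+ₚ p q x)) (regroup a b x (eval p x) (eval q x))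
  where
  regroup : ∀ a b x u v → (a ℤ.+ b) ℤ.+ x ℤ.* (u ℤ.+ v) ≡ (a ℤ.+ x ℤ.* u) ℤ.+ (b ℤ.+ x ℤ.* v)
  regroup = solveℤ-∀

eval-scaleₚ : ∀ c p x → eval (scaleₚ c p) x ≡ c ℤ.* eval p x
eval-scaleₚ c [] x = sym (ℤP.*-zeroʳ c)
eval-scaleₚ c (a ∷ p) x = trans (cong (λ e → c ℤ.* a ℤ.+ x ℤ.* e) (eval-scaleₚ c p x)) (regroup c a x (eval p x))
  where
  regroup : ∀ c a x u → c ℤ.* a ℤ.+ x ℤ.* (c ℤ.* u) ≡ c ℤ.* (a ℤ.+ x ℤ.* u)
  regroup = solveℤ-∀

eval-*ₚ : ∀ p q x → eval (p *ₚ q) x ≡ eval p x ℤ.* eval q x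
eval-*ₚ [] q x = sym (ℤP.*-zeroˡ (eval q x))
eval-*ₚ (a ∷ p) q x = trans (eval-+ₚ (scaleₚ a q) (0ℤ ∷ (p *ₚ q)) x) (trans
  (cong₂ (λ u v → u ℤ.+ (0ℤ ℤ.+ x ℤ.* v)) (eval-scaleₚ a q x) (eval-*ₚ p q x)) (regroup a x (eval p x) (eval q x)))
  where
  regroup : ∀ a x u v → a ℤ.* v ℤ.+ (0ℤ ℤ.+ x ℤ.* (u ℤ.* v)) ≡ (a ℤ.+ x ℤ.* u) ℤ.* v
  regroup = solveℤ-∀

eval-sum : (f : A → Poly) (g : Fin n → A) (x : ℤ) → eval (List.foldr _+ₚ_ [] (map f (List.tabulate g))) x ≡ sum (λ j → eval (f (g j)) x)
eval-sum {n = zero} f g x = refl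
eval-sum {n = suc n} f g x = trans (eval-+ₚ (f (g zero)) _ x) (cong (ℤ._+_ (eval (f (g zero)) x)) (eval-sum f (g ∘ suc) x))

eval-det : ∀ n (M : Vec (Vec Poly n) n) x → eval (det n M) x ≡ detℤ n (λ i j → eval (lookup (lookup M i) j) x)
eval-det zero [] x = trans (cong (ℤ._+_ 1ℤ) (ℤP.*-zeroʳ x)) refl
eval-det (suc n) (r ∷ rs) x = trans (eval-sum (λ j → scaleₚ (sgn j) (lookup r j *ₚ det n (sub j))) id x) (sum-cong-≗ λ j →
  trans (eval-scaleₚ (sgn j) (lookup r j *ₚ det n (sub j)) x) (cong (ℤ._*_ (sgn j)) (trans (eval-*ₚ (lookup r j) (det n (sub j)) x)
    (cong (ℤ._*_ (eval (lookup r j) x)) (trans (eval-det n (sub j) x) (detℤ-cong n λ a c → cong (λ p → eval p x)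
      (trans (cong (λ row → lookup row c) (VecP.lookup-map a (λ row → Vec.removeAt row j) rs)) (lookup-removeAt (lookup rs a) j c))))))))
  where
  sub : Fin (suc n) → Vec (Vec Poly n) n
  sub j = Vec.map (λ row → Vec.removeAt row j) rs
  lookup-removeAt : ∀ {n} (xs : Vec Poly (suc n)) j c → lookup (Vec.removeAt xs j) c ≡ lookup xs (punchIn j c)
  lookup-removeAt (x ∷ xs) zero c = refl
  lookup-removeAt (x ∷ y ∷ xs) (suc j) zero = refl
  lookup-removeAt (x ∷ y ∷ xs) (suc j) (suc c) = lookup-removeAt (y ∷ xs) j c

-- The constant coefficient is divisible by every positive x, hence zero.
eval-zero⇒coeff-zero : ∀ p → (∀ m → eval p (+ suc m) ≡ 0ℤ) → ∀ i → coeff p i ≡ 0ℤ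
eval-zero⇒coeff-zero [] h i = refl
eval-zero⇒coeff-zero (a ∷ p) h = λ { zero → a≡0 ; (suc i) → eval-zero⇒coeff-zero p rest i }
  where
  abs-eq : ∀ m → ℤ.∣ a ∣ ≡ suc m * ℤ.∣ eval p (+ suc m) ∣
  abs-eq m = trans (sym (ℤP.∣-i∣≡∣i∣ a)) (trans (cong ℤ.∣_∣ (sym (negated (+ suc m ℤ.* eval p (+ suc m)) (h m)))) (ℤP.abs-* (+ suc m) (eval p (+ suc m))))
    where
    negated : ∀ y → a ℤ.+ y ≡ 0ℤ → y ≡ - a
    negated y e = trans (shift a y) (trans (cong (ℤ._+_ (- a)) e) (ℤP.+-identityʳ (- a)))
      where
      shift : ∀ a y → y ≡ - a ℤ.+ (a ℤ.+ y)
      shift = solveℤ-∀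
  a≡0 : a ≡ 0ℤ
  a≡0 = ℤP.∣i∣≡0⇒i≡0 (small ℤ.∣ a ∣ ℤ.∣ eval p (+ suc ℤ.∣ a ∣) ∣ (abs-eq ℤ.∣ a ∣))
    where
    small : ∀ m y → m ≡ suc m * y → m ≡ 0
    small m zero e = trans e (*-zeroʳ (suc m))
    small m (suc y) e = ⊥-elim (1+n≰n (≤-trans (m≤m*n (suc m) (suc y)) (≤-reflexive (sym e))))
  rest : ∀ m → eval p (+ suc m) ≡ 0ℤ
  rest m with ℤP.i*j≡0⇒i≡0∨j≡0 (+ suc m) {eval p (+ suc m)} (trans (sym (trans (cong (ℤ._+ (+ suc m ℤ.* eval p (+ suc m))) a≡0) (ℤP.+-identityˡ (+ suc m ℤ.* eval p (+ suc m))))) (h m))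
  ... | inj₂ e = e

coeff-+ₚ : ∀ p q i → coeff (p +ₚ q) i ≡ coeff p i ℤ.+ coeff q i
coeff-+ₚ [] q i = sym (ℤP.+-identityˡ (coeff q i))
coeff-+ₚ (a ∷ p) [] i = sym (ℤP.+-identityʳ (coeff (a ∷ p) i))
coeff-+ₚ (a ∷ p) (b ∷ q) zero = refl
coeff-+ₚ (a ∷ p) (b ∷ q) (suc i) = coeff-+ₚ p q i

coeff-scaleₚ : ∀ c p i → coeff (scaleₚ c p) i ≡ c ℤ.* coeff p i
coeff-scaleₚ c [] i = sym (ℤP.*-zeroʳ c)
coeff-scaleₚ c (a ∷ p) zero = refl
coeff-scaleₚ c (a ∷ p) (suc i) = coeff-scaleₚ c p i

eval⇒≈ₚ : ∀ p q → (∀ x → eval p x ≡ eval q x) → p ≈ₚ q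
eval⇒≈ₚ p q h i = cancel (coeff p i) (coeff q i) (trans (sym (trans (coeff-+ₚ p (scaleₚ (- 1ℤ) q) i) (cong (ℤ._+_ (coeff p i)) (coeff-scaleₚ (- 1ℤ) q i))))
  (eval-zero⇒coeff-zero (p +ₚ scaleₚ (- 1ℤ) q) (λ m → trans (eval-+ₚ p (scaleₚ (- 1ℤ) q) (+ suc m))
    (trans (cong₂ ℤ._+_ (h (+ suc m)) (eval-scaleₚ (- 1ℤ) q (+ suc m))) (zeros (eval q (+ suc m))))) i))
  where
  zeros : ∀ y → y ℤ.+ - 1ℤ ℤ.* y ≡ 0ℤ
  zeros = solveℤ-∀
  cancel : ∀ a b → a ℤ.+ - 1ℤ ℤ.* b ≡ 0ℤ → a ≡ b
  cancel a b e = trans (shift a b) (trans (cong (ℤ._+ b) e) (ℤP.+-identityˡ b))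
    where
    shift : ∀ a b → a ≡ (a ℤ.+ - 1ℤ ℤ.* b) ℤ.+ b
    shift = solveℤ-∀

charMatrix : Graph n → ℤ → Fin n → Row n
charMatrix G x i j = x ℤ.* δ i j ℤ.+ - b2z (adj G i j)

eval-charPoly : (G : Graph n) (x : ℤ) → eval (charPoly G) x ≡ detℤ n (charMatrix G x)
eval-charPoly {n} G x = trans (eval-det n _ x) (detℤ-cong n λ i j → trans
    (cong (λ p → eval p x) (trans (cong (λ r → lookup r j) (VecP.lookup∘tabulate _ i)) (VecP.lookup∘tabulate _ j))) (entry i j))
  where
  entry : ∀ i j → eval ((if does (i FinP.≟ j) then (0ℤ ∷ 1ℤ ∷ []) else []) +ₚ (- b2z (adj G i j) ∷ [])) x ≡ charMatrix G x i j
  entry i j with i FinP.≟ j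
  ... | yes refl = trans (diagonal x (- b2z (adj G i i))) (cong (λ d → x ℤ.* d ℤ.+ - b2z (adj G i i)) (sym (δ-refl i)))
    where
    diagonal : ∀ x b → (0ℤ ℤ.+ b) ℤ.+ x ℤ.* (1ℤ ℤ.+ x ℤ.* 0ℤ) ≡ x ℤ.* 1ℤ ℤ.+ b
    diagonal = solveℤ-∀
  ... | no p = trans (off x (- b2z (adj G i j))) (cong (λ d → x ℤ.* d ℤ.+ - b2z (adj G i j)) (sym (δ-≢ p)))
    where
    off : ∀ x b → b ℤ.+ x ℤ.* 0ℤ ≡ x ℤ.* 0ℤ ℤ.+ b
    off = solveℤ-∀

-- Godsil–McKay switching with respect to a set of four vertices

module Switching {n} (c : Fin 4 → Fin n) (c-injective : ∀ {m m′} → c m ≡ c m′ → m ≡ m′) where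

  Outside : Fin n → Set
  Outside k = ∀ m → c m ≢ k

  data Position : Fin n → Set where
    inside : ∀ m → Position (c m)
    outside : ∀ {k} → Outside k → Position k

  position : ∀ k → Position k
  position k with FinP.any? (λ m → c m FinP.≟ k)
  ... | yes (m , refl) = inside m
  ... | no p = outside λ m e → p (m , e)

  χ : Fin n → ℤ
  χ k = sum λ m → δ (c m) k

  χ-inside : ∀ m → χ (c m) ≡ 1ℤ
  χ-inside m = trans (sum-cong-≗ entry) (sum-δ m (λ _ → 1ℤ))
    where
    entry : ∀ m′ → δ (c m′) (c m) ≡ δ m m′ ℤ.* 1ℤ
    entry m′ with m FinP.≟ m′
    ... | yes refl = trans (δ-refl (c m)) (cong (ℤ._* 1ℤ) (sym (δ-refl m)))
    ... | no p = trans (δ-≢ (λ e → p (sym (c-injective e)))) (cong (ℤ._* 1ℤ) (sym (δ-≢ p)))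

  χ-outside : ∀ {k} → Outside k → χ k ≡ 0ℤ
  χ-outside out = sum-zero _ λ m → δ-≢ (out m)

  sum-χ : (f : Fin n → ℤ) → sum (λ k → χ k ℤ.* f k) ≡ sum (λ m → f (c m))
  sum-χ f = trans (sum-cong-≗ λ k → *-distribʳ-sum (f k) (λ m → δ (c m) k)) (trans (∑-comm (λ k m → δ (c m) k ℤ.* f k)) (sum-cong-≗ λ m → sum-δ (c m) f))

  α : Fin n → ℤ
  α i = + 2 ℤ.+ - (+ 4) ℤ.* χ i

  -- Twice the Godsil–McKay matrix, which is ½J − I on the four vertices and I elsewhere.
  P : Fin n → Row n
  P i j = α i ℤ.* δ i j ℤ.+ χ i ℤ.* χ j

  P-mul : ∀ (M : Fin n → Row n) i j → matMul P M i j ≡ α i ℤ.* M i j ℤ.+ χ i ℤ.* sum (λ m → M (c m) j)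
  P-mul M i j = trans (sum-cong-≗ λ k → distribute (α i) (δ i k) (χ i) (χ k) (M k j))
      (trans (sum-lin (α i) (χ i) (λ k → δ i k ℤ.* M k j) (λ k → χ k ℤ.* M k j))
        (cong₂ (λ p q → α i ℤ.* p ℤ.+ χ i ℤ.* q) (sum-δ i (λ k → M k j)) (sum-χ (λ k → M k j))))
    where
    distribute : ∀ a d x y q → (a ℤ.* d ℤ.+ x ℤ.* y) ℤ.* q ≡ a ℤ.* (d ℤ.* q) ℤ.+ x ℤ.* (y ℤ.* q)
    distribute = solveℤ-∀

  mul-P : ∀ (M : Fin n → Row n) i j → matMul M P i j ≡ M i j ℤ.* α j ℤ.+ χ j ℤ.* sum (λ m → M i (c m))
  mul-P M i j = trans (sum-cong-≗ λ k → trans (cong (λ d → M i k ℤ.* (α k ℤ.* d ℤ.+ χ k ℤ.* χ j)) (δ-sym k j)) (distribute (M i k) (α k) (δ j k) (χ k) (χ j)))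
      (trans (sum-lin 1ℤ (χ j) (λ k → δ j k ℤ.* (M i k ℤ.* α k)) (λ k → χ k ℤ.* M i k))
        (cong₂ (λ p q → p ℤ.+ χ j ℤ.* q) (trans (ℤP.*-identityˡ _) (sum-δ j (λ k → M i k ℤ.* α k))) (sum-χ (λ k → M i k))))
    where
    distribute : ∀ q a d y x → q ℤ.* (a ℤ.* d ℤ.+ y ℤ.* x) ≡ 1ℤ ℤ.* (d ℤ.* (q ℤ.* a)) ℤ.+ x ℤ.* (y ℤ.* q)
    distribute = solveℤ-∀

  α-inside : ∀ m → α (c m) ≡ - (+ 2)
  α-inside m = cong (λ x → + 2 ℤ.+ - (+ 4) ℤ.* x) (χ-inside m)

  α-outside : ∀ {k} → Outside k → α k ≡ + 2
  α-outside out = cong (λ x → + 2 ℤ.+ - (+ 4) ℤ.* x) (χ-outside out)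

  P-square : ∀ i j → matMul P P i j ≡ + 4 ℤ.* δ i j
  P-square i j = trans (P-mul P i j) (trans (cong (λ s → α i ℤ.* P i j ℤ.+ χ i ℤ.* s) column) (by-position (position i)))
    where
    column : sum (λ m → P (c m) j) ≡ + 2 ℤ.* χ j
    column = trans (sum-cong-≗ λ m → cong₂ (λ a x → a ℤ.* δ (c m) j ℤ.+ x ℤ.* χ j) (α-inside m) (χ-inside m))
      (trans (sum-lin (- (+ 2)) 1ℤ (λ m → δ (c m) j) (λ _ → χ j)) (four (χ j)))
      where
      four : ∀ x → - (+ 2) ℤ.* x ℤ.+ 1ℤ ℤ.* (x ℤ.+ (x ℤ.+ (x ℤ.+ (x ℤ.+ 0ℤ)))) ≡ + 2 ℤ.* x
      four = solveℤ-∀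
    by-position : ∀ {i} → Position i → α i ℤ.* P i j ℤ.+ χ i ℤ.* (+ 2 ℤ.* χ j) ≡ + 4 ℤ.* δ i j
    by-position (inside m) = trans (cong₂ (λ a x → a ℤ.* (a ℤ.* δ (c m) j ℤ.+ x ℤ.* χ j) ℤ.+ x ℤ.* (+ 2 ℤ.* χ j)) (α-inside m) (χ-inside m)) (ring (δ (c m) j) (χ j))
      where
      ring : ∀ d y → - (+ 2) ℤ.* (- (+ 2) ℤ.* d ℤ.+ 1ℤ ℤ.* y) ℤ.+ 1ℤ ℤ.* (+ 2 ℤ.* y) ≡ + 4 ℤ.* d
      ring = solveℤ-∀
    by-position {i} (outside out) = trans (cong₂ (λ a x → a ℤ.* (a ℤ.* δ i j ℤ.+ x ℤ.* χ j) ℤ.+ x ℤ.* (+ 2 ℤ.* χ j)) (α-outside out) (χ-outside out)) (ring (δ i j) (χ j))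
      where
      ring : ∀ d y → + 2 ℤ.* (+ 2 ℤ.* d ℤ.+ 0ℤ ℤ.* y) ℤ.+ 0ℤ ℤ.* (+ 2 ℤ.* y) ≡ + 4 ℤ.* d
      ring = solveℤ-∀

  det-P-≢0 : detℤ n P ≢ 0ℤ
  det-P-≢0 e = detℤ-scalar-≢0 n (trans (sym (detℤ-cong n P-square)) (trans (detℤ-mul n P P) (trans (cong (ℤ._* detℤ n P) e) (ℤP.*-zeroˡ (detℤ n P)))))

  -- Intertwining by `P` replaces conjugation, so no inverse has to exist over the integers; the
  -- factor `detℤ n P` is cancelled instead.
  det-≡ : (M M′ : Fin n → Row n) → (∀ i j → matMul P M i j ≡ matMul M′ P i j) → detℤ n M ≡ detℤ n M′
  det-≡ M M′ h = cancel (detℤ n P) det-P-≢0 (trans (sym (detℤ-mul n P M)) (trans (detℤ-cong n h) (trans (detℤ-mul n M′ P) (ℤP.*-comm (detℤ n M′) (detℤ n P)))))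
    where
    cancel : ∀ p {x y} → p ≢ 0ℤ → p ℤ.* x ≡ p ℤ.* y → x ≡ y
    cancel p {x} {y} p≢0 e = ℤP.*-cancelˡ-≡ p x y {{ℤ.≢-nonZero p≢0}} e

  -- The equation `columns` is the switching condition: an outer vertex is adjacent to none or to
  -- all of the four vertices and stays so, or it is adjacent to two of them and exchanges these for
  -- the other two. The equation `rows` is the same condition seen from `H`.
  module _ (G H : Graph n)
    (outer : ∀ {i j} → Outside i → Outside j → adj G i j ≡ adj H i j)
    (inner-G : ∀ m m′ → adj G (c m) (c m′) ≡ false) (inner-H : ∀ m m′ → adj H (c m) (c m′) ≡ false)
    (columns : ∀ m {j} → Outside j → sum (λ m′ → b2z (adj G (c m′) j)) ≡ + 2 ℤ.* (b2z (adj G (c m) j) ℤ.+ b2z (adj H (c m) j)))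
    (rows : ∀ m {i} → Outside i → sum (λ m′ → b2z (adj H i (c m′))) ≡ + 2 ℤ.* (b2z (adj G i (c m)) ℤ.+ b2z (adj H i (c m)))) where

    switching-cospectral : charPoly G ≈ₚ charPoly H
    switching-cospectral = eval⇒≈ₚ (charPoly G) (charPoly H) λ x → trans (eval-charPoly G x)
      (trans (det-≡ (charMatrix G x) (charMatrix H x) (λ i j → trans (P-mul (charMatrix G x) i j) (trans (intertwine x (position i) (position j)) (sym (mul-P (charMatrix H x) i j)))))
        (sym (eval-charPoly H x)))
      where
      sum-shift : ∀ x (f g : Fin 4 → ℤ) → sum (λ m → x ℤ.* f m ℤ.+ - g m) ≡ x ℤ.* sum f ℤ.+ - sum g
      sum-shift x f g = trans (∑-distrib-+ (λ m → x ℤ.* f m) (λ m → - g m)) (cong₂ ℤ._+_ (sym (*-distribˡ-sum x f)) (sum-neg g))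
      S S′ : ℤ → Fin n → ℤ
      S x j = sum (λ m → charMatrix G x (c m) j)
      S′ x i = sum (λ m → charMatrix H x i (c m))
      intertwine : ∀ x {i j} → Position i → Position j →
        α i ℤ.* charMatrix G x i j ℤ.+ χ i ℤ.* S x j ≡ charMatrix H x i j ℤ.* α j ℤ.+ χ j ℤ.* S′ x i
      intertwine x {i} {j} (outside p) (outside q) = trans
          (cong₂ (λ a y → a ℤ.* charMatrix G x i j ℤ.+ y ℤ.* S x j) (α-outside p) (χ-outside p))
          (trans (cong (λ b → + 2 ℤ.* (x ℤ.* δ i j ℤ.+ - b2z b) ℤ.+ 0ℤ ℤ.* S x j) (outer p q))
          (trans (ring (charMatrix H x i j) (S x j) (S′ x i))
          (sym (cong₂ (λ a y → charMatrix H x i j ℤ.* a ℤ.+ y ℤ.* S′ x i) (α-outside q) (χ-outside q)))))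
        where
        ring : ∀ h s t → + 2 ℤ.* h ℤ.+ 0ℤ ℤ.* s ≡ h ℤ.* + 2 ℤ.+ 0ℤ ℤ.* t
        ring = solveℤ-∀
      intertwine x {j = j} (inside m) (outside q) = trans
          (cong₂ (λ a y → a ℤ.* charMatrix G x (c m) j ℤ.+ y ℤ.* S x j) (α-inside m) (χ-inside m))
          (trans (cong₂ (λ d s → - (+ 2) ℤ.* (x ℤ.* d ℤ.+ - g) ℤ.+ 1ℤ ℤ.* s) (δ-≢ (q m))
             (trans (sum-shift x (λ m → δ (c m) j) (λ m → b2z (adj G (c m) j))) (cong₂ (λ y s → x ℤ.* y ℤ.+ - s) (χ-outside q) (columns m q))))
          (trans (ring x g h (S′ x (c m)))
          (sym (trans (cong₂ (λ a y → charMatrix H x (c m) j ℤ.* a ℤ.+ y ℤ.* S′ x (c m)) (α-outside q) (χ-outside q))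
            (cong (λ d → (x ℤ.* d ℤ.+ - h) ℤ.* + 2 ℤ.+ 0ℤ ℤ.* S′ x (c m)) (δ-≢ (q m)))))))
        where
        g h : ℤ
        g = b2z (adj G (c m) j)
        h = b2z (adj H (c m) j)
        ring : ∀ x g h t → - (+ 2) ℤ.* (x ℤ.* 0ℤ ℤ.+ - g) ℤ.+ 1ℤ ℤ.* (x ℤ.* 0ℤ ℤ.+ - (+ 2 ℤ.* (g ℤ.+ h))) ≡ (x ℤ.* 0ℤ ℤ.+ - h) ℤ.* + 2 ℤ.+ 0ℤ ℤ.* t
        ring = solveℤ-∀
      intertwine x {i = i} (outside p) (inside m) = trans
          (cong₂ (λ a y → a ℤ.* charMatrix G x i (c m) ℤ.+ y ℤ.* S x (c m)) (α-outside p) (χ-outside p))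
          (trans (cong (λ d → + 2 ℤ.* (x ℤ.* d ℤ.+ - g) ℤ.+ 0ℤ ℤ.* S x (c m)) (δ-≢ (p m ∘ sym)))
          (trans (ring x g h (S x (c m)))
          (sym (trans (cong₂ (λ a y → charMatrix H x i (c m) ℤ.* a ℤ.+ y ℤ.* S′ x i) (α-inside m) (χ-inside m))
            (cong₂ (λ d s → (x ℤ.* d ℤ.+ - h) ℤ.* - (+ 2) ℤ.+ 1ℤ ℤ.* s) (δ-≢ (p m ∘ sym))
              (trans (sum-shift x (λ m → δ i (c m)) (λ m → b2z (adj H i (c m))))
                (cong₂ (λ y s → x ℤ.* y ℤ.+ - s) (sum-zero _ (λ m → δ-≢ (p m ∘ sym))) (rows m p))))))))
        where
        g h : ℤ
        g = b2z (adj G i (c m))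
        h = b2z (adj H i (c m))
        ring : ∀ x g h s → + 2 ℤ.* (x ℤ.* 0ℤ ℤ.+ - g) ℤ.+ 0ℤ ℤ.* s ≡ (x ℤ.* 0ℤ ℤ.+ - h) ℤ.* - (+ 2) ℤ.+ 1ℤ ℤ.* (x ℤ.* 0ℤ ℤ.+ - (+ 2 ℤ.* (g ℤ.+ h)))
        ring = solveℤ-∀
      intertwine x (inside m) (inside m′) = trans
          (cong₂ (λ a y → a ℤ.* charMatrix G x (c m) (c m′) ℤ.+ y ℤ.* S x (c m′)) (α-inside m) (χ-inside m))
          (trans (cong₂ (λ b s → - (+ 2) ℤ.* (x ℤ.* d ℤ.+ - b2z b) ℤ.+ 1ℤ ℤ.* s) (inner-G m m′)
             (trans (sum-shift x (λ k → δ (c k) (c m′)) (λ k → b2z (adj G (c k) (c m′))))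
               (cong₂ (λ y s → x ℤ.* y ℤ.+ - s) (χ-inside m′) (sum-zero _ (λ k → cong b2z (inner-G k m′))))))
          (trans (ring x d)
          (sym (trans (cong₂ (λ a y → charMatrix H x (c m) (c m′) ℤ.* a ℤ.+ y ℤ.* S′ x (c m)) (α-inside m′) (χ-inside m′))
            (cong₂ (λ b s → (x ℤ.* d ℤ.+ - b2z b) ℤ.* - (+ 2) ℤ.+ 1ℤ ℤ.* s) (inner-H m m′)
             (trans (sum-shift x (λ k → δ (c m) (c k)) (λ k → b2z (adj H (c m) (c k))))
               (cong₂ (λ y s → x ℤ.* y ℤ.+ - s) (trans (sum-cong-≗ (λ k → δ-sym (c m) (c k))) (χ-inside m)) (sum-zero _ (λ k → cong b2z (inner-H m k))))))))))
        where
        d : ℤ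
        d = δ (c m) (c m′)
        ring : ∀ x d → - (+ 2) ℤ.* (x ℤ.* d ℤ.+ - 0ℤ) ℤ.+ 1ℤ ℤ.* (x ℤ.* 1ℤ ℤ.+ - 0ℤ) ≡ (x ℤ.* d ℤ.+ - 0ℤ) ℤ.* - (+ 2) ℤ.+ 1ℤ ℤ.* (x ℤ.* 1ℤ ℤ.+ - 0ℤ)
        ring = solveℤ-∀

-- The gadget: a spider with three legs of length two, hanging at vertex z = 7 from the middle
-- vertex 1 of a leg. Its centre is 0 and its feet are 4, 5, 6.

-- Scripts of moves on eight named vertices. The shape of the result and the admissibility of each
-- move become computations on `Graph 8`, transported to a large graph by `Fits`.
data Op : Set where
  del leaf : Fin 8 → Fin 8 → Op
  chord : Fin 8 → Fin 8 → Fin 8 → Op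

apply : Op → Graph n → (Fin 8 → Fin n) → Graph n
apply (del i j) G t = upd G (t i) (t j) false
apply (leaf z v) G t = upd G (t z) (t v) true
apply (chord v u w) G t = upd G (t u) (t w) true

applyAll : List Op → Graph 8 → Graph 8
applyAll [] S = S
applyAll (o ∷ os) S = applyAll os (apply o S id)

_==_ : Fin n → Fin n → Bool
i == j = does (i FinP.≟ j)

-- Vertex 7 may have neighbours outside the eight vertices, so its local degree says nothing; it is
-- excluded wherever isolation or a degree is used.
validᵇ : Op → Graph 8 → Bool
validᵇ (del i j) S = adj S i j
validᵇ (leaf z v) S = isolatedᵇ S v ∧ (not (v == 7F) ∧ not (z == v))
validᵇ (chord v u w) S = adj S v u ∧ (adj S v w ∧ (not (u == w) ∧ (not (v == 7F) ∧ does (deg S v ℕ.≤? 3))))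

allValidᵇ : List Op → Graph 8 → Bool
allValidᵇ [] S = true
allValidᵇ (o ∷ os) S = validᵇ o S ∧ allValidᵇ os (apply o S id)

==-false⁻ : {i j : Fin n} → not (i == j) ≡ true → i ≢ j
==-false⁻ {i = i} {j} p = does-false⁻ (i FinP.≟ j) (not-true⁻ p)

record Fits (G : Graph n) (t : Fin 8 → Fin n) (S : Graph 8) : Set where
  field
    fits-inside : ∀ i j → adj G (t i) (t j) ≡ adj S i j
    fits-closed : ∀ i → i ≢ 7F → ∀ x → E G (t i) x → ∃ λ j → x ≡ t j

open Fits

InImage : (Fin 8 → Fin n) → Fin n → Set
InImage t x = ∃ λ j → x ≡ t j

inImage? : (t : Fin 8 → Fin n) (x : Fin n) → Dec (InImage t x)
inImage? t x = FinP.any? λ j → x FinP.≟ t j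

AgreeOff : (Fin 8 → Fin n) → Graph n → Graph n → Set
AgreeOff t G H = ∀ x y → ¬ (InImage t x × InImage t y) → adj H x y ≡ adj G x y

module _ {t : Fin 8 → Fin n} (t-injective : ∀ {i j} → t i ≡ t j → i ≡ j) where

  private
    pull : ∀ {i j a b} → SamePair (t i) (t j) (t a) (t b) → SamePair i j a b
    pull = Sum.map (λ (p , q) → t-injective p , t-injective q) (λ (p , q) → t-injective p , t-injective q)
    push : ∀ {i j a b} → SamePair i j a b → SamePair (t i) (t j) (t a) (t b)
    push = Sum.map (λ (p , q) → cong t p , cong t q) (λ (p , q) → cong t p , cong t q)

  fits-upd : {G : Graph n} {S : Graph 8} → Fits G t S → ∀ i j b → Fits (upd G (t i) (t j) b) t (upd S i j b)
  fits-upd {G} {S} f i j b .fits-inside x y with samePair? i j x y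
  ... | yes p = trans (upd-hit G (t i) (t j) b (push p)) (sym (upd-hit S i j b p))
  ... | no p = trans (upd-miss G (t i) (t j) b (p ∘ pull)) (trans (fits-inside f x y) (sym (upd-miss S i j b p)))
  fits-upd {G} {S} f i j b .fits-closed a a≢7 x e with upd-E⁻ G (t i) (t j) b e
  ... | inj₁ (inj₁ (_ , q) , _) = j , q
  ... | inj₁ (inj₂ (_ , q) , _) = i , q
  ... | inj₂ (_ , e′) = fits-closed f a a≢7 x e′

  agree-upd : (G : Graph n) → ∀ i j b → AgreeOff t G (upd G (t i) (t j) b)
  agree-upd G i j b x y off = upd-miss G (t i) (t j) b λ { (inj₁ (refl , refl)) → off ((i , refl) , (j , refl)) ; (inj₂ (refl , refl)) → off ((j , refl) , (i , refl)) }

  fits-isolated : {G : Graph n} {S : Graph 8} → Fits G t S → ∀ {v} → v ≢ 7F → Isolated S v → Isolated G (t v)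
  fits-isolated {G} {S} f {v} v≢7 iso x = ≢true⇒false λ e → absurd e (fits-closed f v v≢7 x e)
    where
    absurd : ∀ {x} → E G (t v) x → ∃ (λ j → x ≡ t j) → ⊥
    absurd e (j , refl) = true≢false (trans (sym (fits-inside f v j)) e) (iso j)

  fits-deg : {G : Graph n} {S : Graph 8} → Fits G t S → ∀ {v} → v ≢ 7F → deg G (t v) ≤ deg S v
  fits-deg {G} {S} f {v} v≢7 = ≤-trans (distinct-⊆⇒length≤ (nbrs-distinct G (t v)) member) (≤-reflexive (ListP.length-map t (nbrs S v)))
    where
    member : ∀ {x} → x ∈ nbrs G (t v) → x ∈ map t (nbrs S v)
    member {x} x∈ with fits-closed f v v≢7 x (∈-nbrs⁻ G x∈)
    ... | j , refl = ∈-map⁺ t (∈-nbrs⁺ S (trans (sym (fits-inside f v j)) (∈-nbrs⁻ G x∈)))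

upd-flip : (G : Graph n) (u w : Fin n) (b : Bool) → upd G w u b ≡ upd G u w b
upd-flip G u w b = graph-ext same
  where
  flip-pair : ∀ {u w i j : Fin _} → SamePair u w i j → SamePair w u i j
  flip-pair = Sum.swap
  same : ∀ i j → adj (upd G w u b) i j ≡ adj (upd G u w b) i j
  same i j with samePair? u w i j
  ... | yes p = trans (upd-hit G w u b (flip-pair p)) (sym (upd-hit G u w b p))
  ... | no p = trans (upd-miss G w u b (p ∘ flip-pair)) (sym (upd-miss G u w b p))

-- Any two neighbours of a vertex of degree at most three are consecutive in one of the two directions.
genusClass-chord : {G : Graph n} → GenusClass k G → ∀ {v u w} → E G v u → E G v w → u ≢ w → deg G v ≤ 3 → GenusClass k (upd G u w true)
genusClass-chord {n} {k} {G} (simple , ρ , isRot , p) {v} {u} {w} vu vw u≢w d with eqFin? (ρ v u) w | eqFin? (ρ v w) u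
... | yes q | _ = subst (λ z → GenusClass k (upd G u z true)) q
      (genusClass-corner {k = k} simple isRot p vu (λ r → u≢w (trans (sym r) q)))
... | no _ | yes q = subst (GenusClass k) (trans (cong (λ z → upd G w z true) q) (upd-flip G u w true))
      (genusClass-corner {k = k} simple isRot p vw (λ r → u≢w (trans (sym q) r)))
... | no y≢w | no z≢u = ⊥-elim (1+n≰n (≤-trans four d))
  where
  rot : Rot G ρ
  rot = isRot⇒rot isRot
  open Faces G simple rot
  y≢u : ρ v u ≢ u
  y≢u r = u≢w (sym (ρ-fixed vu r vw))
  z≢w : ρ v w ≢ w
  z≢w r = u≢w (ρ-fixed vw r vu)
  four : 4 ≤ deg G v
  four = distinct-⊆⇒length≤ {xs = u ∷ w ∷ ρ v u ∷ ρ v w ∷ []}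
    ((u≢w ∷ (y≢u ∘ sym) ∷ (z≢u ∘ sym) ∷ []) ∷ ((y≢w ∘ sym) ∷ (z≢w ∘ sym) ∷ []) ∷ ((λ r → u≢w (ρ-injective vu vw r)) ∷ []) ∷ [] ∷ [])
    λ { (here refl) → ∈-nbrs⁺ G vu ; (there (here refl)) → ∈-nbrs⁺ G vw ; (there (there (here refl))) → ∈-nbrs⁺ G (rot-closed rot vu)
      ; (there (there (there (here refl)))) → ∈-nbrs⁺ G (rot-closed rot vw) }

module _ {t : Fin 8 → Fin n} (t-injective : ∀ {i j} → t i ≡ t j → i ≡ j) where

  genusClass-apply : ∀ o {G S} → validᵇ o S ≡ true → GenusClass k G → Fits G t S → GenusClass k (apply o G t)
  genusClass-apply {k} (del i j) val gc f = genusClass-delete {k = k} (trans (fits-inside f i j) val) gc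
  genusClass-apply {k} (leaf z v) {G} {S} val gc f with ∧-true⁻ {isolatedᵇ S v} val
  ... | iso , rest with ∧-true⁻ {not (v == 7F)} rest
  ...   | v≢7 , z≢v = genusClass-leaf {k = k} (fits-isolated t-injective f (==-false⁻ v≢7) (isolatedᵇ⁻ S iso)) (==-false⁻ z≢v ∘ t-injective) gc
  genusClass-apply {k} (chord v u w) {G} {S} val gc f with ∧-true⁻ {adj S v u} val
  ... | vu , rest₁ with ∧-true⁻ {adj S v w} rest₁
  ...   | vw , rest₂ with ∧-true⁻ {not (u == w)} rest₂
  ...     | u≢w , rest₃ with ∧-true⁻ {not (v == 7F)} rest₃
  ...       | v≢7 , d = genusClass-chord {k = k} gc (trans (fits-inside f v u) vu) (trans (fits-inside f v w) vw) (==-false⁻ u≢w ∘ t-injective)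
                (≤-trans (fits-deg t-injective f (==-false⁻ v≢7)) (does-true⁻ (deg S v ℕ.≤? 3) d))

  fits-apply : ∀ o {G S} → Fits G t S → Fits (apply o G t) t (apply o S id)
  fits-apply (del i j) f = fits-upd t-injective f i j false
  fits-apply (leaf z v) f = fits-upd t-injective f z v true
  fits-apply (chord v u w) f = fits-upd t-injective f u w true

  agree-apply : ∀ o G → AgreeOff t G (apply o G t)
  agree-apply (del i j) G = agree-upd t-injective G i j false
  agree-apply (leaf z v) G = agree-upd t-injective G z v true
  agree-apply (chord v u w) G = agree-upd t-injective G u w true

  genusClass-applyAll : ∀ os {G S} → allValidᵇ os S ≡ true → GenusClass k G → Fits G t S →
    ∃ λ H → GenusClass k H × Fits H t (applyAll os S) × AgreeOff t G H
  genusClass-applyAll [] {G} _ gc f = G , gc , f , λ _ _ _ → refl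
  genusClass-applyAll {k} (o ∷ os) {G} {S} val gc f with ∧-true⁻ {validᵇ o S} val
  ... | val₁ , val₂ with genusClass-applyAll {k} os val₂ (genusClass-apply {k} o val₁ gc f) (fits-apply o f)
  ...   | H , gcH , fH , agree = H , gcH , fH , λ x y off → trans (agree x y off) (agree-apply o G x y off)

empty : Graph 8
empty = fromAdj λ _ _ → false

buildSpider spiderToHexagon : List Op
buildSpider = leaf 7F 1F ∷ leaf 1F 0F ∷ leaf 1F 4F ∷ leaf 0F 2F ∷ leaf 0F 3F ∷ leaf 2F 5F ∷ leaf 3F 6F ∷ []
-- After the deletions a path 1 5 3 4 2 6 is built leaf by leaf, and the edge 2 6 is closed
-- up to 1 6 by moving a chord along the path.
spiderToHexagon = del 0F 1F ∷ del 0F 2F ∷ del 0F 3F ∷ del 1F 4F ∷ del 2F 5F ∷ del 3F 6F ∷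
  leaf 1F 5F ∷ leaf 5F 3F ∷ leaf 3F 4F ∷ leaf 4F 2F ∷ leaf 2F 6F ∷
  chord 4F 3F 2F ∷ chord 2F 3F 6F ∷ del 3F 2F ∷ chord 3F 5F 6F ∷ del 3F 6F ∷ chord 5F 1F 6F ∷ del 5F 6F ∷ []

spider hexagon : Graph 8
spider =
  (false ∷ true ∷ true ∷ true ∷ false ∷ false ∷ false ∷ false ∷ []) ∷
  (true ∷ false ∷ false ∷ false ∷ true ∷ false ∷ false ∷ true ∷ []) ∷
  (true ∷ false ∷ false ∷ false ∷ false ∷ true ∷ false ∷ false ∷ []) ∷
  (true ∷ false ∷ false ∷ false ∷ false ∷ false ∷ true ∷ false ∷ []) ∷
  (false ∷ true ∷ false ∷ false ∷ false ∷ false ∷ false ∷ false ∷ []) ∷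
  (false ∷ false ∷ true ∷ false ∷ false ∷ false ∷ false ∷ false ∷ []) ∷
  (false ∷ false ∷ false ∷ true ∷ false ∷ false ∷ false ∷ false ∷ []) ∷
  (false ∷ true ∷ false ∷ false ∷ false ∷ false ∷ false ∷ false ∷ []) ∷ []
hexagon =
  (false ∷ false ∷ false ∷ false ∷ false ∷ false ∷ false ∷ false ∷ []) ∷
  (false ∷ false ∷ false ∷ false ∷ false ∷ true ∷ true ∷ true ∷ []) ∷
  (false ∷ false ∷ false ∷ false ∷ true ∷ false ∷ true ∷ false ∷ []) ∷
  (false ∷ false ∷ false ∷ false ∷ true ∷ true ∷ false ∷ false ∷ []) ∷
  (false ∷ false ∷ true ∷ true ∷ false ∷ false ∷ false ∷ false ∷ []) ∷
  (false ∷ true ∷ false ∷ true ∷ false ∷ false ∷ false ∷ false ∷ []) ∷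
  (false ∷ true ∷ true ∷ false ∷ false ∷ false ∷ false ∷ false ∷ []) ∷
  (false ∷ true ∷ false ∷ false ∷ false ∷ false ∷ false ∷ false ∷ []) ∷ []

buildSpider-result : applyAll buildSpider empty ≡ spider
buildSpider-result = refl

spiderToHexagon-result : applyAll spiderToHexagon spider ≡ hexagon
spiderToHexagon-result = refl

buildSpider-valid : allValidᵇ buildSpider empty ≡ true
buildSpider-valid = refl

spiderToHexagon-valid : allValidᵇ spiderToHexagon spider ≡ true
spiderToHexagon-valid = refl

-- The switching set is the centre with the three feet. Each of the vertices 1, 2, 3 is adjacent to
-- the centre and one foot and receives the two other feet instead, which yields the hexagon and
-- leaves the centre isolated. All other vertices have no neighbour in the set.
corner : Fin 4 → Fin 8
corner 0F = 0F
corner 1F = 4F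
corner 2F = 5F
corner 3F = 6F

IsCorner : Fin 8 → Set
IsCorner i = ∃ λ m → corner m ≡ i

isCorner? : Decidable IsCorner
isCorner? i = FinP.any? λ m → corner m FinP.≟ i

abstract
  corner-injective : ∀ {m m′} → corner m ≡ corner m′ → m ≡ m′
  corner-injective {m} {m′} = toWitness {a? = FinP.all? λ m → FinP.all? λ m′ → (corner m FinP.≟ corner m′) →-dec (m FinP.≟ m′)} _ m m′

corner-≢7 : ∀ m → corner m ≢ 7F
corner-≢7 0F ()
corner-≢7 1F ()
corner-≢7 2F ()
corner-≢7 3F ()

abstract
  outer-local : ∀ i j → IsCorner i ⊎ IsCorner j ⊎ adj spider i j ≡ adj hexagon i j
  outer-local = toWitness {a? = FinP.all? λ i → FinP.all? λ j → isCorner? i ⊎-dec (isCorner? j ⊎-dec (adj spider i j ≟ᵇ adj hexagon i j))} _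

abstract
  inner-spider : ∀ m m′ → adj spider (corner m) (corner m′) ≡ false
  inner-spider = toWitness {a? = FinP.all? λ m → FinP.all? λ m′ → adj spider (corner m) (corner m′) ≟ᵇ false} _

abstract
  inner-hexagon : ∀ m m′ → adj hexagon (corner m) (corner m′) ≡ false
  inner-hexagon = toWitness {a? = FinP.all? λ m → FinP.all? λ m′ → adj hexagon (corner m) (corner m′) ≟ᵇ false} _

abstract
  columns-local : ∀ m j → IsCorner j ⊎ sum (λ m′ → b2z (adj spider (corner m′) j)) ≡ + 2 ℤ.* (b2z (adj spider (corner m) j) ℤ.+ b2z (adj hexagon (corner m) j))
  columns-local = toWitness {a? = FinP.all? λ m → FinP.all? λ j → isCorner? j ⊎-dec (_ ℤ.≟ _)} _

abstract
  rows-local : ∀ m i → IsCorner i ⊎ sum (λ m′ → b2z (adj hexagon i (corner m′))) ≡ + 2 ℤ.* (b2z (adj spider i (corner m)) ℤ.+ b2z (adj hexagon i (corner m)))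
  rows-local = toWitness {a? = FinP.all? λ m → FinP.all? λ i → isCorner? i ⊎-dec (_ ℤ.≟ _)} _

abstract
  spider-no-isolated : ∀ i → ∃ λ j → adj spider i j ≡ true
  spider-no-isolated = toWitness {a? = FinP.all? λ i → FinP.any? λ j → adj spider i j ≟ᵇ true} _

abstract
  hexagon-isolated : Isolated hexagon 0F
  hexagon-isolated = toWitness {a? = FinP.all? λ j → adj hexagon 0F j ≟ᵇ false} _

-- A graph with a gadget has a mate

iso⇒isolated-≤ : {G H : Graph n} → Iso G H → isolated H ≤ isolated G
iso⇒isolated-≤ {n} {G} {H} (π , pres) = ≤-trans (≤-reflexive (sym (ListP.length-map from (select (isolatedᵇ H)))))
    (distinct-⊆⇒length≤ (DistinctP.map⁺ from-injective (select-distinct (isolatedᵇ H))) member)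
  where
  open Inverse π using (to; from; strictlyInverseˡ)
  from-injective : ∀ {x y} → from x ≡ from y → x ≡ y
  from-injective {x} {y} e = trans (sym (strictlyInverseˡ x)) (trans (cong to e) (strictlyInverseˡ y))
  member : ∀ {x} → x ∈ map from (select (isolatedᵇ H)) → x ∈ select (isolatedᵇ G)
  member x∈ with ∈-map⁻ from x∈
  ... | y , y∈ , refl = ∈-select⁺ (isolatedᵇ G) (isolatedᵇ⁺ G λ x′ →
    trans (pres (from y) x′) (trans (cong (λ z → adj H z (to x′)) (strictlyInverseˡ y)) (isolatedᵇ⁻ H (∈-select⁻ (isolatedᵇ H) y∈) (to x′))))

module Mate {t : Fin 8 → Fin n} (t-injective : ∀ {i j} → t i ≡ t j → i ≡ j) {G : Graph n} (gc : GenusClass k G) (f : Fits G t spider) where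

  switched : ∃ λ H → GenusClass k H × Fits H t (applyAll spiderToHexagon spider) × AgreeOff t G H
  switched = genusClass-applyAll t-injective {k = k} spiderToHexagon spiderToHexagon-valid gc f

  H : Graph n
  H = proj₁ switched

  H-class : GenusClass k H
  H-class = proj₁ (proj₂ switched)

  fH : Fits H t hexagon
  fH = subst (Fits H t) spiderToHexagon-result (proj₁ (proj₂ (proj₂ switched)))

  agree : AgreeOff t G H
  agree = proj₂ (proj₂ (proj₂ switched))

  open Switching (t ∘ corner) (corner-injective ∘ t-injective)

  not-corner : ∀ {i} → Outside (t i) → ¬ IsCorner i
  not-corner out (m , e) = out m (cong t e)

  off-image : ∀ {K S} → Fits K t S → ∀ m {j} → ¬ InImage t j → adj K (t (corner m)) j ≡ false
  off-image fK m {j} j∉ = ≢true⇒false λ e → j∉ (fits-closed fK (corner m) (corner-≢7 m) j e)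

  cospectral : charPoly G ≈ₚ charPoly H
  cospectral = switching-cospectral G H outer
      (λ m m′ → trans (fits-inside f (corner m) (corner m′)) (inner-spider m m′))
      (λ m m′ → trans (fits-inside fH (corner m) (corner m′)) (inner-hexagon m m′)) columns rows
    where
    outer : ∀ {i j} → Outside i → Outside j → adj G i j ≡ adj H i j
    outer {i} {j} p q with inImage? t i | inImage? t j
    ... | no r | _ = sym (agree i j (r ∘ proj₁))
    ... | yes _ | no r = sym (agree i j (r ∘ proj₂))
    ... | yes (a , refl) | yes (b , refl) with outer-local a b
    ...   | inj₁ r = ⊥-elim (not-corner p r)
    ...   | inj₂ (inj₁ r) = ⊥-elim (not-corner q r)
    ...   | inj₂ (inj₂ r) = trans (fits-inside f a b) (trans r (sym (fits-inside fH a b)))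
    columns : ∀ m {j} → Outside j → sum (λ m′ → b2z (adj G (t (corner m′)) j)) ≡ + 2 ℤ.* (b2z (adj G (t (corner m)) j) ℤ.+ b2z (adj H (t (corner m)) j))
    columns m {j} p with inImage? t j
    ... | no r = trans (sum-zero _ λ m′ → cong b2z (off-image f m′ r))
            (sym (cong₂ (λ a b → + 2 ℤ.* (b2z a ℤ.+ b2z b)) (off-image f m r) (off-image fH m r)))
    ... | yes (b , refl) with columns-local m b
    ...   | inj₁ r = ⊥-elim (not-corner p r)
    ...   | inj₂ r = trans (sum-cong-≗ λ m′ → cong b2z (fits-inside f (corner m′) b)) (trans r
            (sym (cong₂ (λ a c → + 2 ℤ.* (b2z a ℤ.+ b2z c)) (fits-inside f (corner m) b) (fits-inside fH (corner m) b))))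
    rows : ∀ m {i} → Outside i → sum (λ m′ → b2z (adj H i (t (corner m′)))) ≡ + 2 ℤ.* (b2z (adj G i (t (corner m))) ℤ.+ b2z (adj H i (t (corner m))))
    rows m {i} p with inImage? t i
    ... | no r = trans (sum-zero _ λ m′ → cong b2z (trans (proj₁ (proj₁ H-class) i (t (corner m′))) (off-image fH m′ r)))
            (sym (cong₂ (λ a b → + 2 ℤ.* (b2z a ℤ.+ b2z b)) (trans (proj₁ (proj₁ gc) i (t (corner m))) (off-image f m r))
              (trans (proj₁ (proj₁ H-class) i (t (corner m))) (off-image fH m r))))
    ... | yes (b , refl) with rows-local m b
    ...   | inj₁ r = ⊥-elim (not-corner p r)
    ...   | inj₂ r = trans (sum-cong-≗ λ m′ → cong b2z (fits-inside fH b (corner m′))) (trans r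
            (sym (cong₂ (λ a c → + 2 ℤ.* (b2z a ℤ.+ b2z c)) (fits-inside f b (corner m)) (fits-inside fH b (corner m)))))

  more-isolated : isolated G < isolated H
  more-isolated = distinct-⊆⇒length≤ {xs = t 0F ∷ select (isolatedᵇ G)}
      (All.tabulate (λ x∈ e → not-isolated 0F (subst (Isolated G) (sym e) (isolatedᵇ⁻ G (∈-select⁻ (isolatedᵇ G) x∈)))) ∷ select-distinct (isolatedᵇ G))
      λ { (here refl) → ∈-select⁺ (isolatedᵇ H) (isolatedᵇ⁺ H (fits-isolated t-injective fH (λ ()) hexagon-isolated))
        ; (there x∈) → ∈-select⁺ (isolatedᵇ H) (isolatedᵇ⁺ H (still-isolated (isolatedᵇ⁻ G (∈-select⁻ (isolatedᵇ G) x∈)))) }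
    where
    not-isolated : ∀ i → ¬ Isolated G (t i)
    not-isolated i iso with spider-no-isolated i
    ... | j , e = true≢false (trans (fits-inside f i j) e) (iso (t j))
    still-isolated : ∀ {x} → Isolated G x → Isolated H x
    still-isolated {x} iso y = trans (agree x y λ { ((i , refl) , _) → not-isolated i iso }) (iso y)

  ¬iso : ¬ Iso G H
  ¬iso i = <⇒≱ more-isolated (iso⇒isolated-≤ {G = G} {H} i)

-- Freeing several vertices

notIn : Fin n → Vec (Fin n) m → Bool
notIn v vs = not (does (FinP.any? λ i → v FinP.≟ lookup vs i))

notIn⁻ : {v : Fin n} {vs : Vec (Fin n) m} → notIn v vs ≡ true → ∀ i → v ≢ lookup vs i
notIn⁻ {v = v} {vs} p i e = does-false⁻ (FinP.any? λ i → v FinP.≟ lookup vs i) (not-true⁻ p) (i , e)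

notIn-false⁻ : {v : Fin n} {vs : Vec (Fin n) m} → notIn v vs ≡ false → ∃ λ i → v ≡ lookup vs i
notIn-false⁻ {v = v} {vs} p = does-true⁻ (FinP.any? λ i → v FinP.≟ lookup vs i) (trans (sym (not-involutive _)) (cong not p))

select-notIn : (p : Fin n → Bool) (vs : Vec (Fin n) m) → length (select p) ≤ length (select λ v → p v ∧ notIn v vs) + m
select-notIn {m = m} p vs = ≤-trans (distinct-⊆⇒length≤ (select-distinct p) (λ {v} v∈ → member v (∈-select⁻ p v∈)))
  (≤-reflexive (trans (ListP.length-++ (select λ v → p v ∧ notIn v vs))
    (cong (_+_ (length (select λ v → p v ∧ notIn v vs))) (trans (ListP.length-map (lookup vs) (allFin m)) (length-allFin m)))))
  where
  member : ∀ v → p v ≡ true → v ∈ select (λ v → p v ∧ notIn v vs) ++ map (lookup vs) (allFin m)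
  member v pv with FinP.any? (λ i → v FinP.≟ lookup vs i) in eq
  ... | yes (i , refl) = ∈-++⁺ʳ (select λ v → p v ∧ notIn v vs) (∈-map⁺ (lookup vs) (∈-allFin i))
  ... | no _ = ∈-++⁺ˡ (∈-select⁺ (λ v → p v ∧ notIn v vs) (cong₂ _∧_ pv (cong (not ∘ does) eq)))

-- The large constants are abstract to keep them from being evaluated.
abstract
  restoreBound : ℕ
  restoreBound = 36 + undoBound 267 28

  length-restores-≤ : (v : Fin n) {R : Graph n} → GenusClass k R → 12 * k ≤ n → 1 ≤ n → length (restores 267 28 v R) ≤ n * restoreBound
  length-restores-≤ {k = k} v gc = length-restores {k = k} 267 28 v gc

module Freeing {n k} (𝒞? : Decidable (GenusClass k {n})) (12k≤n : 12 * k ≤ n) (1≤n : 1 ≤ n) where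

  -- Graphs outside the class are discarded because the bound on `restores` relies on a linear
  -- number of darts.
  restoresIn : Fin n → Graph n → List (Graph n)
  restoresIn v R = if does (𝒞? R) then restores 267 28 v R else []

  length-restoresIn : ∀ v R → length (restoresIn v R) ≤ n * restoreBound
  length-restoresIn v R with 𝒞? R
  ... | yes gc = length-restores-≤ {k = k} v gc 12k≤n 1≤n
  ... | no _ = z≤n

  ∈-restoresIn : ∀ {v G R} → GenusClass k R → G ∈ restores 267 28 v R → G ∈ restoresIn v R
  ∈-restoresIn {v} {G} {R} gc G∈ = subst (G ∈_) (sym (if-true (𝒞? R) gc)) G∈

  -- The head of the vector is the vertex freed last, so it is restored first.
  restoresAll : Vec (Fin n) m → Graph n → List (Graph n)
  restoresAll [] R = R ∷ []
  restoresAll (v ∷ vs) R = concatMap (restoresAll vs) (restoresIn v R)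

  length-restoresAll : (vs : Vec (Fin n) m) (R : Graph n) → length (restoresAll vs R) ≤ (n * restoreBound) ^ m
  length-restoresAll [] R = ≤-refl
  length-restoresAll {suc m} (v ∷ vs) R = ≤-trans (length-concatMap-≤ (restoresAll vs) (restoresIn v R) ((n * restoreBound) ^ m) (λ {S} _ → length-restoresAll vs S))
    (*-monoˡ-≤ ((n * restoreBound) ^ m) (length-restoresIn v R))

  record State (G : Graph n) (vs : Vec (Fin n) m) : Set where
    field
      now : Graph n
      now-class : GenusClass k now
      now-isolated : ∀ i → Isolated now (lookup vs i)
      now-distinct : ∀ {i j} → lookup vs i ≡ lookup vs j → i ≡ j
      now-restores : G ∈ restoresAll vs now
      changed : List (Fin n)
      changed-≤ : length changed ≤ m * 30
      unchanged : ∀ {x} → x ∉ changed → ∀ y → adj now x y ≡ adj G x y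

  open State public

  initial : ∀ {G} → GenusClass k G → State G []
  initial {G} gc = record
    { now = G ; now-class = gc ; now-isolated = λ () ; now-distinct = λ { {()} } ; now-restores = here refl
    ; changed = [] ; changed-≤ = z≤n ; unchanged = λ _ _ → refl }

  available : ∀ {G} {vs : Vec (Fin n) m} → State G vs → Fin n → Bool
  available {vs = vs} s v = lightᵇ (now s) v ∧ notIn v vs

  extend : ∀ {G} {vs : Vec (Fin n) m} (s : State G vs) {v} → available s v ≡ true → State G (v ∷ vs)
  extend {G = G} {vs} s {v} ok = record
    { now = freed f
    ; now-class = freed-class f
    ; now-isolated = λ { zero → freed-isolated f ; (suc i) y → trans (freed-far f (v∉ i ∘ sym) (not-nbr i) y) (now-isolated s i y) }
    ; now-distinct = dist
    ; now-restores = ∈-concatMap⁺ (restoresAll vs) (lose (∈-restoresIn (freed-class f) (freed-restores f)) (now-restores s))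
    ; changed = (v ∷ nbrs (now s) v) ++ changed s
    -- The vertex `v` and its at most 29 neighbours account for 30 per step.
    ; changed-≤ = ≤-trans (≤-reflexive (ListP.length-++ (v ∷ nbrs (now s) v))) (+-mono-≤ (s≤s (proj₁ light)) (changed-≤ s))
    ; unchanged = λ x∉ y → trans (freed-far f (λ { refl → x∉ (here refl) }) (λ e → x∉ (∈-++⁺ˡ (there (∈-nbrs⁺ (now s) e)))) y)
        (unchanged s (x∉ ∘ ∈-++⁺ʳ (v ∷ nbrs (now s) v)) y) }
    where
    light : Light (now s) v
    light = lightᵇ⁻ (now s) (proj₁ (∧-true⁻ {lightᵇ (now s) v} ok))
    v∉ : ∀ i → v ≢ lookup vs i
    v∉ = notIn⁻ {vs = vs} (proj₂ (∧-true⁻ {lightᵇ (now s) v} ok))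
    f : Freed k (now s) v
    f = free (now-class s) light
    not-nbr : ∀ i → ¬ E (now s) v (lookup vs i)
    not-nbr i e = true≢false (Simple.E-sym (now s) (proj₁ (now-class s)) e) (now-isolated s i v)
    dist : ∀ {i j} → lookup (v ∷ vs) i ≡ lookup (v ∷ vs) j → i ≡ j
    dist {zero} {zero} _ = refl
    dist {zero} {suc j} e = ⊥-elim (v∉ j e)
    dist {suc i} {zero} e = ⊥-elim (v∉ i (sym e))
    dist {suc i} {suc j} e = cong suc (now-distinct s e)

  Labelled : Graph n → ℕ → Set
  Labelled G m = Σ (Vec (Fin n) m) (State G)

  extensions : ∀ {G} → Labelled G m → List (Labelled G (suc m))
  extensions (vs , s) = mapWith∈ (select (available s)) λ {v} v∈ → v ∷ vs , extend s (∈-select⁻ (available s) v∈)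

  extensions-labels : ∀ {G} (l : Labelled G m) → map proj₁ (extensions l) ≡ map (_∷ proj₁ l) (select (available (proj₂ l)))
  extensions-labels (vs , s) = trans (map-mapWith∈ (select (available s)) _ proj₁) (mapWith∈≗map (_∷ vs) (select (available s)))

  states : ∀ {G} → GenusClass k G → ∀ m → List (Labelled G m)
  states gc zero = ([] , initial gc) ∷ []
  states gc (suc m) = concatMap extensions (states gc m)

  -- A vector comes from one state only, since its tail determines the preceding state by induction.
  -- States themselves carry proofs and are compared through their vectors.
  states-distinct : ∀ {G} (gc : GenusClass k G) m → Distinct (map proj₁ (states gc m))
  states-distinct gc zero = [] ∷ []
  states-distinct gc (suc m) = subst Distinct (sym (ListP.map-concatMap proj₁ extensions (states gc m)))
    (concatMap-distinct (apart⇒distinct refl labels)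
      (λ {l} _ → subst Distinct (sym (extensions-labels l)) (DistinctP.map⁺ (λ { refl → refl }) (select-distinct (available (proj₂ l)))))
      same)
    where
    labels : AllPairs (λ l l′ → ¬ (proj₁ l ≡ proj₁ l′)) (states gc m)
    labels = AllPairsP.map⁻ (states-distinct gc m)
    same : ∀ {l l′ y} → l ∈ states gc m → l′ ∈ states gc m → y ∈ map proj₁ (extensions l) → y ∈ map proj₁ (extensions l′) → l ≡ l′
    same {l} {l′} {y} l∈ l′∈ y∈ y∈′ = apart⇒≡ labels l∈ l′∈ tails (sym tails)
      where
      tails : proj₁ l ≡ proj₁ l′
      tails with ∈-map⁻ (_∷ proj₁ l) (subst (y ∈_) (extensions-labels l) y∈) | ∈-map⁻ (_∷ proj₁ l′) (subst (y ∈_) (extensions-labels l′) y∈′)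
      ... | _ , _ , refl | _ , _ , refl = refl

  -- Every step offers at least n/8 vertices: a quarter of all vertices is light, and at most n/8
  -- are excluded as freed before.
  length-states : 32 * k ≤ n → ∀ {G} (gc : GenusClass k G) m → 8 * m ≤ n → n ^ m ≤ length (states gc m) * 8 ^ m
  length-states 32k≤n gc zero _ = ≤-refl
  length-states 32k≤n {G} gc (suc m) 8m≤n = ≤-trans (*-monoʳ-≤ n (length-states 32k≤n gc m (≤-trans (*-monoʳ-≤ 8 (n≤1+n m)) 8m≤n)))
    (≤-trans (≤-reflexive (regroup₁ n (length (states gc m)) (8 ^ m))) (≤-trans
      (*-monoˡ-≤ (8 ^ m) (length-concatMap-≥ (extensions {m} {G}) (states gc m) n 8 (λ {l} _ → enough l)))
      (≤-reflexive (*-assoc (length (concatMap extensions (states gc m))) 8 (8 ^ m)))))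
    where
    regroup₁ : ∀ n l e → n * (l * e) ≡ l * n * e
    regroup₁ = solve-∀
    enough : ∀ l → n ≤ length (extensions {m} {G} l) * 8
    enough l@(vs , s) = subst (λ a → n ≤ a * 8) (sym len) (+-cancelʳ-≤ n _ _ (≤-trans (≤-reflexive (double n))
      (≤-trans (light-count {k = k} (now-class s) 32k≤n) (≤-trans (*-monoʳ-≤ 8 (select-notIn (lightᵇ (now s)) vs))
        (≤-trans (≤-reflexive (regroup₂ (length (select (available s))) m)) (+-monoʳ-≤ (length (select (available s)) * 8) (≤-trans (*-monoʳ-≤ 8 (n≤1+n m)) 8m≤n)))))))
      where
      len : length (extensions l) ≡ length (select (available s))
      len = trans (sym (ListP.length-map proj₁ (extensions l))) (trans (cong length (extensions-labels l)) (ListP.length-map (_∷ vs) (select (available s))))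
      double : ∀ n → n + n ≡ 2 * n
      double = solve-∀
      regroup₂ : ∀ a m → 8 * (a + m) ≡ a * 8 + 8 * m
      regroup₂ = solve-∀

-- Counting gadgets

allVec-complete : {xs : List A} (v : Vec A m) → (∀ i → lookup v i ∈ xs) → v ∈ allVec xs m
allVec-complete [] h = here refl
allVec-complete {xs = xs} (x ∷ v) h = ∈-concatMap⁺ (λ x → map (x ∷_) (allVec xs _)) (lose (h zero) (∈-map⁺ (x ∷_) (allVec-complete v (h ∘ suc))))

allVec-distinct : {xs : List A} → Distinct xs → ∀ m → Distinct (allVec xs m)
allVec-distinct dist zero = [] ∷ []
allVec-distinct {xs = xs} dist (suc m) = concatMap-distinct dist (λ {x} _ → DistinctP.map⁺ (λ { refl → refl }) (allVec-distinct dist m)) λ _ _ → same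
  where
  same : ∀ {x x′ y} → y ∈ map (x ∷_) (allVec xs m) → y ∈ map (x′ ∷_) (allVec xs m) → x ≡ x′
  same p q with ∈-map⁻ _ p | ∈-map⁻ _ q
  ... | _ , _ , refl | _ , _ , refl = refl

length-allVec : (xs : List A) (m : ℕ) → length (allVec xs m) ≤ length xs ^ m
length-allVec xs zero = ≤-refl
length-allVec xs (suc m) = length-concatMap-≤ (λ x → map (x ∷_) (allVec xs m)) xs (length xs ^ m)
  λ {x} _ → ≤-trans (≤-reflexive (ListP.length-map (x ∷_) (allVec xs m))) (length-allVec xs m)

-- Cutting off after three neighbours bounds the ball in every graph. Within a gadget nothing is
-- lost, as all its vertices except the last have degree at most 3.
near : Graph n → Fin n → List (Fin n)
near G x = x ∷ take 3 (nbrs G x)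

ball : Graph n → ℕ → Fin n → List (Fin n)
ball G zero x = x ∷ []
ball G (suc r) x = concatMap (near G) (ball G r x)

length-ball : (G : Graph n) (r : ℕ) (x : Fin n) → length (ball G r x) ≤ 4 ^ r
length-ball G zero x = ≤-refl
length-ball G (suc r) x = ≤-trans (length-concatMap-≤ (near G) (ball G r x) 4 (λ {y} _ → s≤s (≤-trans (≤-reflexive (ListP.length-take 3 (nbrs G y))) (m⊓n≤m 3 (deg G y)))))
  (≤-trans (*-monoˡ-≤ 4 (length-ball G r x)) (≤-reflexive (*-comm (4 ^ r) 4)))

-- No step leads out of 7: in the large graph this vertex may have many neighbours, and `near` might
-- omit the one in the gadget.
localNear : Fin 8 → List (Fin 8)
localNear i = if i == 7F then i ∷ [] else i ∷ nbrs spider i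

localBall : ℕ → Fin 8 → List (Fin 8)
localBall zero i = i ∷ []
localBall (suc r) i = concatMap localNear (localBall r i)

abstract
  -- The radius 4 is the distance between two feet, the largest distance in the spider. Vertex 7 is
  -- a leaf, so shortest paths between other vertices avoid it.
  localBall-4 : ∀ i → i ≡ 7F ⊎ (∀ j → j ∈ localBall 4 i)
  localBall-4 = toWitness {a? = FinP.all? λ i → (i FinP.≟ 7F) ⊎-dec (FinP.all? λ j → Any.any? (j FinP.≟_) (localBall 4 i))} _

abstract
  spider-deg : ∀ i → deg spider i ≤ 3
  spider-deg = toWitness {a? = FinP.all? λ i → deg spider i ℕ.≤? 3} _

IsGadget : Graph n → (Fin 8 → Fin n) → Set
IsGadget G t = (∀ i j → t i ≡ t j → i ≡ j) × (∀ i j → adj G (t i) (t j) ≡ adj spider i j) ×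
  (∀ i → ¬ (i ≡ 7F) → ∀ x → E G (t i) x → InImage t x)

-- Abstract, so that unification does not unfold the decision procedure.
abstract
  isGadget? : (G : Graph n) (t : Fin 8 → Fin n) → Dec (IsGadget G t)
  isGadget? G t = (FinP.all? λ i → FinP.all? λ j → (t i FinP.≟ t j) →-dec (i FinP.≟ j)) ×-dec
    ((FinP.all? λ i → FinP.all? λ j → adj G (t i) (t j) ≟ᵇ adj spider i j) ×-dec
     (FinP.all? λ i → ¬? (i FinP.≟ 7F) →-dec (FinP.all? λ x → (adj G (t i) x ≟ᵇ true) →-dec inImage? t x)))

gadget-fits : {G : Graph n} {t : Fin 8 → Fin n} → IsGadget G t → Fits G t spider
gadget-fits (_ , inside , closed) = record { fits-inside = inside ; fits-closed = closed }

gadgets : Graph n → List (Vec (Fin n) 8)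
gadgets {n} G = filter (λ t → isGadget? G (lookup t)) (allVec (allFin n) 8)

∈-gadgets⁺ : {G : Graph n} (t : Vec (Fin n) 8) → IsGadget G (lookup t) → t ∈ gadgets G
∈-gadgets⁺ {G = G} t g = ∈-filter⁺ (λ t → isGadget? G (lookup t)) (allVec-complete t λ _ → ∈-allFin _) g

∈-gadgets⁻ : {G : Graph n} {t : Vec (Fin n) 8} → t ∈ gadgets G → IsGadget G (lookup t)
∈-gadgets⁻ {n} {G} t∈ = proj₂ (∈-filter⁻ (λ t → isGadget? G (lookup t)) {xs = allVec (allFin n) 8} t∈)

gadget-ball : {G : Graph n} {t : Fin 8 → Fin n} → IsGadget G t → ∀ {i} → i ≢ 7F → ∀ j → t j ∈ ball G 4 (t i)
gadget-ball {n} {G} {t} g@(inj , inside , _) {i} i≢7 j with localBall-4 i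
... | inj₁ e = ⊥-elim (i≢7 e)
... | inj₂ h = transport 4 (h j)
  where
  next : ∀ {a b} → b ∈ localNear a → t b ∈ near G (t a)
  next {a} {b} b∈ with a FinP.≟ 7F
  next {a} {b} (here refl) | yes _ = here refl
  next {a} {b} (here refl) | no _ = here refl
  next {a} {b} (there b∈) | no a≢7 = there (deg≤⇒take G (≤-trans (fits-deg (λ {i} {j} → inj i j) (gadget-fits {G = G} g) a≢7) (spider-deg a))
    (∈-nbrs⁺ G (trans (inside a b) (∈-nbrs⁻ spider {a} b∈))))
  transport : ∀ r {j} → j ∈ localBall r i → t j ∈ ball G r (t i)
  transport zero (here refl) = here refl
  transport (suc r) j∈ with find (∈-concatMap⁻ localNear {xs = localBall r i} j∈)
  ... | a , a∈ , j∈′ = ∈-concatMap⁺ (near G) (lose (transport r a∈) (next {a} j∈′))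

gadget-transfer : {G H : Graph n} → IsSimple G → {t : Fin 8 → Fin n} → (∀ i → i ≢ 7F → ∀ y → adj H (t i) y ≡ adj G (t i) y) → IsGadget H t → IsGadget G t
gadget-transfer {G = G} {H} simple {t} same (inj , inside , closed) = inj , inside′ , λ i i≢7 x e → closed i i≢7 x (trans (same i i≢7 x) e)
  where
  inside′ : ∀ i j → adj G (t i) (t j) ≡ adj spider i j
  inside′ i j with i FinP.≟ 7F | j FinP.≟ 7F
  ... | no p | _ = trans (sym (same i p (t j))) (inside i j)
  ... | yes refl | no q = trans (proj₁ simple (t 7F) (t j)) (trans (sym (same j q (t 7F))) (trans (inside j 7F) (symmetric j)))
    where
    symmetric : ∀ j → adj spider j 7F ≡ adj spider 7F j
    symmetric = toWitness {a? = FinP.all? λ j → adj spider j 7F ≟ᵇ adj spider 7F j} _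
  ... | yes refl | yes refl = proj₂ simple (t 7F)

length-allVec-ball : (G : Graph n) (r m : ℕ) (x : Fin n) → length (allVec (ball G r x) m) ≤ (4 ^ r) ^ m
length-allVec-ball G r m x = ≤-trans (length-allVec (ball G r x) m) (^-monoˡ-≤ m (length-ball G r x))

abstract
  gadgetBound : ℕ
  gadgetBound = (4 ^ 4) ^ 8

  nearby : Graph n → Fin n → List (Vec (Fin n) 8)
  nearby G x = allVec (ball G 4 x) 8

  length-nearby : (G : Graph n) (x : Fin n) → length (nearby G x) ≤ gadgetBound
  length-nearby G x = length-allVec-ball G 4 8 x

  ∈-nearby : {G : Graph n} {x : Fin n} (t : Vec (Fin n) 8) → (∀ i → lookup t i ∈ ball G 4 x) → t ∈ nearby G x
  ∈-nearby t h = allVec-complete t h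

-- Every gadget of H meets the set W of vertices whose neighbourhood changed.
gadgets-≤ : {G H : Graph n} → IsSimple G → (∀ t → ¬ IsGadget G t) → (W : List (Fin n)) → (∀ {x} → x ∉ W → ∀ y → adj H x y ≡ adj G x y) →
  length (gadgets H) ≤ length W * gadgetBound
gadgets-≤ {n} {G} {H} simple none W same = ≤-trans (distinct-⊆⇒length≤ (DistinctP.filter⁺ (λ t → isGadget? H (lookup t)) (allVec-distinct (DistinctP.allFin⁺ n) 8)) member)
    (length-concatMap-≤ (nearby H) W gadgetBound (λ {x} _ → length-nearby H x))
  where
  member : ∀ {t} → t ∈ gadgets H → t ∈ concatMap (nearby H) W
  member {t} t∈ with FinP.any? (λ i → ¬? (i FinP.≟ 7F) ×-dec Any.any? (lookup t i FinP.≟_) W)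
  ... | yes (i , i≢7 , i∈W) = ∈-concatMap⁺ (nearby H) (lose i∈W (∈-nearby {G = H} t (gadget-ball {G = H} (∈-gadgets⁻ t∈) i≢7)))
  ... | no p = ⊥-elim (none (lookup t) (gadget-transfer {G = G} {H} simple (λ i i≢7 → same (λ i∈W → p (i , i≢7 , i∈W))) (∈-gadgets⁻ t∈)))

-- The double counting

lookup-∷ʳ-inject₁ : (xs : Vec A m) (z : A) (i : Fin m) → lookup (xs Vec.∷ʳ z) (Fin.inject₁ i) ≡ lookup xs i
lookup-∷ʳ-inject₁ (x ∷ xs) z zero = refl
lookup-∷ʳ-inject₁ (x ∷ xs) z (suc i) = lookup-∷ʳ-inject₁ xs z i

lookup-∷ʳ-last : (xs : Vec A m) (z : A) → lookup (xs Vec.∷ʳ z) (Fin.fromℕ m) ≡ z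
lookup-∷ʳ-last [] z = refl
lookup-∷ʳ-last (x ∷ xs) z = lookup-∷ʳ-last xs z

last-view : (i : Fin (suc m)) → i ≡ Fin.fromℕ m ⊎ ∃ λ i′ → i ≡ Fin.inject₁ i′
last-view {zero} zero = inj₁ refl
last-view {suc m} zero = inj₂ (zero , refl)
last-view {suc m} (suc i) = Sum.map (cong suc) (λ (i′ , e) → suc i′ , cong suc e) (last-view i)

^-distrib-* : ∀ e a b → (a * b) ^ e ≡ a ^ e * b ^ e
^-distrib-* zero a b = refl
^-distrib-* (suc e) a b = trans (cong (a * b *_) (^-distrib-* e a b)) (exchange a b (a ^ e) (b ^ e))
  where
  exchange : ∀ a b x y → a * b * (x * y) ≡ a * x * (b * y)
  exchange = solve-∀

-- Removing all edges at the freed vertices takes the gadget off again, for these vertices were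
-- isolated before it was built.
clear : Vec (Fin n) m → Graph n → Graph n
clear vs H = fromAdj λ x y → adj H x y ∧ (notIn x vs ∧ notIn y vs)

unique⇒no-gadget : {G : Graph n} → Unique charPoly (GenusClass k) G → ∀ t → ¬ IsGadget G t
unique⇒no-gadget {n} {k} {G} (gc , no-mate) t g@(inj , _) = no-mate (n , H , H-class , ¬iso , cospectral)
  where open Mate {n} {k} (λ {i} {j} → inj i j) gc (gadget-fits g)

module _ {n k} (𝒞? : Decidable (GenusClass k {n})) (12k≤n : 12 * k ≤ n) (1≤n : 1 ≤ n) where

  open Freeing {n} {k} 𝒞? 12k≤n 1≤n

  module Build {G : Graph n} {vs : Vec (Fin n) 7} (s : State G vs) (z : Fin n) (z∉ : notIn z vs ≡ true) where

    t : Fin 8 → Fin n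
    t = lookup (vs Vec.∷ʳ z)

    data View : Fin 8 → Set where
      old : ∀ i → View (Fin.inject₁ i)
      top : View 7F

    view : ∀ i → View i
    view i with last-view i
    ... | inj₁ refl = top
    ... | inj₂ (i′ , refl) = old i′

    t-old : ∀ i → t (Fin.inject₁ i) ≡ lookup vs i
    t-old = lookup-∷ʳ-inject₁ vs z

    t-top : t 7F ≡ z
    t-top = lookup-∷ʳ-last vs z

    t-injective : ∀ {i j} → t i ≡ t j → i ≡ j
    t-injective {i} {j} e = by (view i) (view j) e
      where
      by : ∀ {i j} → View i → View j → t i ≡ t j → i ≡ j
      by (old i) (old j) e = cong Fin.inject₁ (now-distinct s (trans (sym (t-old i)) (trans e (t-old j))))
      by (old i) top e = ⊥-elim (notIn⁻ {v = z} {vs} z∉ i (trans (sym t-top) (trans (sym e) (t-old i))))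
      by top (old j) e = ⊥-elim (notIn⁻ {v = z} {vs} z∉ j (trans (sym t-top) (trans e (t-old j))))
      by top top _ = refl

    open Simple (now s) (proj₁ (now-class s))

    t-isolated : ∀ i → i ≢ 7F → Isolated (now s) (t i)
    t-isolated i i≢7 = by (view i) i≢7
      where
      by : ∀ {i} → View i → i ≢ 7F → Isolated (now s) (t i)
      by (old i) _ = subst (Isolated (now s)) (sym (t-old i)) (now-isolated s i)
      by top p = ⊥-elim (p refl)

    fits-empty : Fits (now s) t empty
    fits-empty = record
      { fits-inside = λ i j → trans (inside i j) (sym (adj-fromAdj (λ _ _ → false) i j))
      ; fits-closed = λ i i≢7 x e → ⊥-elim (true≢false e (t-isolated i i≢7 x)) }
      where
      inside : ∀ i j → adj (now s) (t i) (t j) ≡ false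
      inside i j with i FinP.≟ 7F | j FinP.≟ 7F
      ... | no p | _ = t-isolated i p (t j)
      ... | yes _ | no q = trans (proj₁ (proj₁ (now-class s)) (t i) (t j)) (t-isolated j q (t i))
      ... | yes refl | yes refl = proj₂ (proj₁ (now-class s)) (t 7F)

    built : ∃ λ H → GenusClass k H × Fits H t (applyAll buildSpider empty) × AgreeOff t (now s) H
    built = genusClass-applyAll t-injective {k = k} buildSpider buildSpider-valid (now-class s) fits-empty

    H : Graph n
    H = proj₁ built

    H-class : GenusClass k H
    H-class = proj₁ (proj₂ built)

    H-fits : Fits H t spider
    H-fits = subst (Fits H t) buildSpider-result (proj₁ (proj₂ (proj₂ built)))

    agree : AgreeOff t (now s) H
    agree = proj₂ (proj₂ (proj₂ built))

    H-gadget : IsGadget H t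
    H-gadget = (λ i j → t-injective) , fits-inside H-fits , fits-closed H-fits

    clear-H : clear vs H ≡ now s
    clear-H = graph-ext λ x y → trans (adj-fromAdj _ x y) (same x y)
      where
      image : ∀ {x} → InImage t x → notIn x vs ≡ true → x ≡ z
      image (j , refl) p = by (view j) p
        where
        by : ∀ {j} → View j → notIn (t j) vs ≡ true → t j ≡ z
        by (old j) p = ⊥-elim (notIn⁻ {v = t (Fin.inject₁ j)} {vs} p j (t-old j))
        by top _ = t-top
      isolated-in : ∀ x → notIn x vs ≡ false → Isolated (now s) x
      isolated-in x p with notIn-false⁻ {v = x} {vs} p
      ... | i , refl = now-isolated s i
      same : ∀ x y → adj H x y ∧ (notIn x vs ∧ notIn y vs) ≡ adj (now s) x y
      same x y = by (notIn x vs) (notIn y vs) refl refl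
        where
        by : ∀ a b → notIn x vs ≡ a → notIn y vs ≡ b → adj H x y ∧ (a ∧ b) ≡ adj (now s) x y
        by false b p q = trans (∧-zeroʳ (adj H x y)) (sym (isolated-in x p y))
        by true false p q = trans (∧-zeroʳ (adj H x y)) (sym (trans (proj₁ (proj₁ (now-class s)) x y) (isolated-in y q x)))
        by true true p q with inImage? t x | inImage? t y
        ... | no r | _ = trans (∧-identityʳ (adj H x y)) (agree x y (r ∘ proj₁))
        ... | yes _ | no r = trans (∧-identityʳ (adj H x y)) (agree x y (r ∘ proj₂))
        ... | yes r | yes r′ with image r p | image r′ q
        ...   | refl | refl = trans (cong (_∧ true) (proj₂ (proj₁ H-class) z)) (sym (proj₂ (proj₁ (now-class s)) z))

    touched : List (Fin n)
    touched = changed s ++ map t (allFin 8)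

    -- 218 = 7 * 30 + 8: seven freeing steps and the eight vertices of the gadget.
    touched-≤ : length touched ≤ 218
    touched-≤ = ≤-trans (≤-reflexive (ListP.length-++ (changed s))) (+-mono-≤ (changed-≤ s) (≤-reflexive (ListP.length-map t (allFin 8))))

    untouched : ∀ {x} → x ∉ touched → ∀ y → adj H x y ≡ adj G x y
    untouched {x} x∉ y = trans (agree x y λ { ((j , refl) , _) → x∉ (∈-++⁺ʳ (changed s) (∈-map⁺ t (∈-allFin j))) }) (unchanged s (x∉ ∘ ∈-++⁺ˡ) y)

  Choice : ℕ → Set
  Choice m = Graph n × Vec (Fin n) m × Fin n

  choicesOf : {G : Graph n} → Labelled G m → List (Choice m)
  choicesOf {G = G} (vs , _) = map (λ z → G , vs , z) (select (λ z → notIn z vs))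

  -- Abstract, since the normal form of states grows exponentially with m.
  abstract
    choicesIn : {G : Graph n} → GenusClass k G → ∀ m → List (Choice m)
    choicesIn gc m = concatMap choicesOf (states gc m)

    ∈-choicesIn⁻ : ∀ {G m c} (gc : GenusClass k G) → c ∈ choicesIn gc m → ∃ λ vs → ∃ λ z → c ≡ (G , vs , z) × State G vs × notIn z vs ≡ true
    ∈-choicesIn⁻ {G} {m} gc c∈ with find (∈-concatMap⁻ choicesOf {xs = states gc m} c∈)
    ... | (vs , s) , _ , c∈′ with ∈-map⁻ (λ z → G , vs , z) c∈′
    ...   | z , z∈ , e = vs , z , e , s , ∈-select⁻ (λ z → notIn z vs) z∈

    choicesIn-distinct : ∀ {G} (gc : GenusClass k G) m → Distinct (choicesIn gc m)
    choicesIn-distinct {G} gc m = concatMap-distinct (apart⇒distinct refl labels)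
        (λ {l} _ → DistinctP.map⁺ (λ { refl → refl }) (select-distinct (λ z → notIn z (proj₁ l))))
        λ {l} {l′} l∈ l′∈ c∈ c∈′ → apart⇒≡ labels l∈ l′∈ (same {l} {l′} c∈ c∈′) (sym (same {l} {l′} c∈ c∈′))
      where
      labels : AllPairs (λ l l′ → ¬ (proj₁ l ≡ proj₁ l′)) (states gc m)
      labels = AllPairsP.map⁻ (states-distinct gc m)
      same : ∀ {l l′ : Labelled G m} {c} → c ∈ choicesOf l → c ∈ choicesOf l′ → proj₁ l ≡ proj₁ l′
      same {l} {l′} p q with ∈-map⁻ (λ z → G , proj₁ l , z) p | ∈-map⁻ (λ z → G , proj₁ l′ , z) q
      ... | _ , _ , refl | _ , _ , refl = refl

    -- Beside the at least (n/8)^m vectors there are at least n/2 choices of `z`, since the vector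
    -- occupies at most n/8 vertices.
    length-choicesIn : 32 * k ≤ n → ∀ {G} (gc : GenusClass k G) m → 8 * m ≤ n → n * n ^ m ≤ length (choicesIn gc m) * (2 * 8 ^ m)
    length-choicesIn 32k≤n {G} gc m 8m≤n = ≤-trans (*-monoʳ-≤ n (length-states 32k≤n gc m 8m≤n)) (≤-trans (≤-reflexive (regroup n (length (states gc m)) (8 ^ m)))
        (≤-trans (*-monoˡ-≤ (8 ^ m) (length-concatMap-≥ choicesOf (states gc m) n 2 (λ {l} _ → enough l)))
          (≤-reflexive (*-assoc (length (concatMap choicesOf (states gc m))) 2 (8 ^ m)))))
      where
      regroup : ∀ n l e → n * (l * e) ≡ l * n * e
      regroup = solve-∀
      enough : ∀ l → n ≤ length (choicesOf {m} {G} l) * 2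
      enough (vs , _) = subst (λ a → n ≤ a * 2) (sym (ListP.length-map (λ z → G , vs , z) free-z)) (+-cancelʳ-≤ n _ _ (≤-trans (+-mono-≤ all-n all-n)
          (≤-trans (≤-reflexive (double (length free-z) m)) (+-monoʳ-≤ (length free-z * 2) (≤-trans (*-monoˡ-≤ m (m≤m+n 2 6)) 8m≤n)))))
        where
        free-z : List (Fin n)
        free-z = select (λ z → notIn z vs)
        all-n : n ≤ length free-z + m
        all-n = ≤-trans (≤-trans (≤-reflexive (sym (length-allFin n))) (distinct-⊆⇒length≤ (DistinctP.allFin⁺ n) (λ _ → ∈-select⁺ (λ _ → true) refl)))
          (select-notIn (λ _ → true) vs)
        double : ∀ a m → (a + m) + (a + m) ≡ a * 2 + 2 * m
        double = solve-∀

  choices : Graph n → List (Choice 7)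
  choices G with 𝒞? G
  ... | yes gc = choicesIn gc 7
  ... | no _ = []

  abstract
    -- A gadget of `H` reveals the freed vertices and `z`. The cut by `take` gives the bound for
    -- every `H`, and it removes nothing when `H` arises from a graph without gadgets.
    sources : Graph n → List (Choice 7)
    sources H = concatMap (λ t → map (λ G → G , Vec.init t , Vec.last t) (restoresAll (Vec.init t) (clear (Vec.init t) H))) (take (218 * gadgetBound) (gadgets H))

    length-sources : ∀ H → length (sources H) ≤ 218 * gadgetBound * (n * restoreBound) ^ 7
    length-sources H = ≤-trans (length-concatMap-≤ _ (take (218 * gadgetBound) (gadgets H)) ((n * restoreBound) ^ 7)
        (λ {t} _ → ≤-trans (≤-reflexive (ListP.length-map _ (restoresAll (Vec.init t) (clear (Vec.init t) H)))) (length-restoresAll (Vec.init t) (clear (Vec.init t) H))))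
      (*-monoˡ-≤ ((n * restoreBound) ^ 7) (≤-trans (≤-reflexive (ListP.length-take (218 * gadgetBound) (gadgets H))) (m⊓n≤m (218 * gadgetBound) (length (gadgets H)))))

    choice-source : {G : Graph n} → (∀ t → ¬ IsGadget G t) → IsSimple G → {vs : Vec (Fin n) 7} → State G vs → {z : Fin n} → notIn z vs ≡ true →
      ∃ λ H → GenusClass k H × (G , vs , z) ∈ sources H
    choice-source {G} none simple {vs} s {z} z∉ = H , H-class , ∈-concatMap⁺ _ (lose t∈ G∈)
      where
      open Build s z z∉
      t∈ : vs Vec.∷ʳ z ∈ take (218 * gadgetBound) (gadgets H)
      t∈ = subst (vs Vec.∷ʳ z ∈_) (sym (ListP.take-all (218 * gadgetBound) (gadgets H)
          (≤-trans (gadgets-≤ {G = G} {H} simple none touched untouched) (*-monoˡ-≤ gadgetBound touched-≤)))) (∈-gadgets⁺ {G = H} (vs Vec.∷ʳ z) H-gadget)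
      G∈ : (G , vs , z) ∈ map (λ G → G , Vec.init (vs Vec.∷ʳ z) , Vec.last (vs Vec.∷ʳ z)) (restoresAll (Vec.init (vs Vec.∷ʳ z)) (clear (Vec.init (vs Vec.∷ʳ z)) H))
      G∈ = subst₂ (λ us y → (G , vs , z) ∈ map (λ G → G , us , y) (restoresAll us (clear us H))) (sym (VecP.init-∷ʳ z vs)) (sym (VecP.last-∷ʳ z vs))
        (∈-map⁺ (λ G → G , vs , z) (subst (λ R → G ∈ restoresAll vs R) (sym clear-H) (now-restores s)))

  ∈-choices⁻ : ∀ {G c} → c ∈ choices G → ∃ λ vs → ∃ λ z → c ≡ (G , vs , z) × State G vs × notIn z vs ≡ true
  ∈-choices⁻ {G} c∈ with 𝒞? G
  ... | yes gc = ∈-choicesIn⁻ gc c∈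

  choices-distinct : ∀ G → Distinct (choices G)
  choices-distinct G with 𝒞? G
  ... | no _ = []
  ... | yes gc = choicesIn-distinct gc 7

  length-choices : 32 * k ≤ n → 56 ≤ n → ∀ {G} → GenusClass k G → n * n ^ 7 ≤ length (choices G) * (2 * 8 ^ 7)
  length-choices 32k≤n 56≤n {G} gc with 𝒞? G
  ... | no ¬gc = ⊥-elim (¬gc gc)
  ... | yes gc′ = length-choicesIn 32k≤n gc′ 7 56≤n

  unique-count : 32 * k ≤ n → 56 ≤ n → (U? : Decidable (Unique charPoly (GenusClass k) {n})) →
    length (filter U? (allGraphs n)) * n ≤ length (filter 𝒞? (allGraphs n)) * (218 * gadgetBound * restoreBound ^ 7 * (2 * 8 ^ 7))
  unique-count 32k≤n 56≤n U? = arith (length us) (length cs) (length (concatMap choices us)) (218 * gadgetBound) restoreBound (2 * 8 ^ 7) 7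
      (length-concatMap-≥ choices us (n * n ^ 7) (2 * 8 ^ 7) (λ G∈ → length-choices 32k≤n 56≤n (proj₁ (unique G∈))))
      (≤-trans (distinct-⊆⇒length≤ all-distinct all-⊆) (length-concatMap-≤ sources cs (218 * gadgetBound * (n * restoreBound) ^ 7) (λ {H} _ → length-sources H)))
    where
    us cs : List (Graph n)
    us = filter U? (allGraphs n)
    cs = filter 𝒞? (allGraphs n)
    bools-distinct : Distinct (true ∷ false ∷ [])
    bools-distinct = ((λ ()) ∷ []) ∷ [] ∷ []
    bool-∈ : ∀ b → b ∈ true ∷ false ∷ []
    bool-∈ true = here refl
    bool-∈ false = there (here refl)
    graphs-distinct : Distinct (allGraphs n)
    graphs-distinct = allVec-distinct (allVec-distinct bools-distinct n) n
    graph-∈ : ∀ G → G ∈ allGraphs n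
    graph-∈ G = allVec-complete G λ i → allVec-complete (lookup G i) λ j → bool-∈ (adj G i j)
    unique : ∀ {G} → G ∈ us → Unique charPoly (GenusClass k) G
    unique G∈ = proj₂ (∈-filter⁻ U? {xs = allGraphs n} G∈)
    all-distinct : Distinct (concatMap choices us)
    all-distinct = concatMap-distinct (DistinctP.filter⁺ U? graphs-distinct) (λ {G} _ → choices-distinct G) λ _ _ → same
      where
      same : ∀ {G G′ c} → c ∈ choices G → c ∈ choices G′ → G ≡ G′
      same p q with ∈-choices⁻ p | ∈-choices⁻ q
      ... | _ , _ , refl , _ | _ , _ , refl , _ = refl
    all-⊆ : ∀ {c} → c ∈ concatMap choices us → c ∈ concatMap sources cs
    all-⊆ c∈ with find (∈-concatMap⁻ choices {xs = us} c∈)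
    ... | G , G∈ , c∈′ with ∈-choices⁻ c∈′
    ...   | vs , z , refl , s , z∉ with choice-source (unique⇒no-gadget {k = k} (unique G∈)) (proj₁ (proj₁ (unique G∈))) s z∉
    ...     | H , H-class , ∈H = ∈-concatMap⁺ sources (lose (∈-filter⁺ 𝒞? (graph-∈ H) H-class) ∈H)
    arith : ∀ u c l b r q e → u * (n * n ^ e) ≤ l * q → l ≤ c * (b * (n * r) ^ e) → u * n ≤ c * (b * r ^ e * q)
    -- The power n^7 common to the constructions and to the sources cancels; the factor n due to `z`
    -- remains on the left.
    arith u c l b r q e p p′ = *-cancelʳ-≤ (u * n) (c * (b * r ^ e * q)) (n ^ e) {{m^n≢0 n e {{ℕ.>-nonZero 1≤n}}}}
      (≤-trans (≤-reflexive (*-assoc u n (n ^ e))) (≤-trans p (≤-trans (*-monoˡ-≤ q p′)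
        (≤-reflexive (trans (cong (λ a → c * (b * a) * q) (^-distrib-* e n r)) (regroup c b (n ^ e) (r ^ e) q))))))
      where
      regroup : ∀ c b x y q → c * (b * (x * y)) * q ≡ c * (b * y * q) * x
      regroup = solve-∀

theorem4p7 : (k : ℕ) → WeaklyDistinguishing charPoly (GenusClass k)
theorem4p7 k 𝒞? U? m = N , λ n N≤n → conclude n (≤-trans (≤-trans (m≤m+n (m * suc Q) (32 * k)) (m≤m+n (m * suc Q + 32 * k) 56)) N≤n)
    (≤-trans (≤-trans (m≤n+m (32 * k) (m * suc Q)) (m≤m+n (m * suc Q + 32 * k) 56)) N≤n) (≤-trans (m≤n+m 56 (m * suc Q + 32 * k)) N≤n)
  where
  Q N : ℕ
  Q = 218 * gadgetBound * restoreBound ^ 7 * (2 * 8 ^ 7)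
  -- The summands serve the final ratio, the supply of light vertices, and seven steps with 8 * 7 =
  -- 56. The successor in `suc Q` makes it a nonzero factor to cancel.
  N = m * suc Q + 32 * k + 56
  conclude : ∀ n → m * suc Q ≤ n → 32 * k ≤ n → 56 ≤ n →
    m * count {Unique charPoly (GenusClass k)} U? n ≤ count {GenusClass k} 𝒞? n
  conclude n mQ≤n 32k≤n 56≤n = arith (count {Unique charPoly (GenusClass k)} U? n) (count {GenusClass k} 𝒞? n) Q mQ≤n
    (unique-count {n} {k} 𝒞? (≤-trans (*-monoˡ-≤ k (m≤m+n 12 20)) 32k≤n) (≤-trans (m≤m+n 1 55) 56≤n) 32k≤n 56≤n U?)
    where
    arith : ∀ u c Q → m * suc Q ≤ n → u * n ≤ c * Q → m * u ≤ c
    arith u c Q p q = *-cancelʳ-≤ (m * u) c (suc Q) (≤-trans (≤-reflexive (regroup m u (suc Q))) (≤-trans (*-monoʳ-≤ u p) (≤-trans q (*-monoʳ-≤ c (n≤1+n Q)))))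
      where
      regroup : ∀ m u s → m * u * s ≡ u * (m * s)
      regroup = solve-∀
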